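{- Let $\Delta$ be of type $D_n$ and let $\mathfrak{Ab}$ be its poset of abelian ideals. Then (i) $\mathcal K^{u}_{\mathfrak{Ab}}(q)=\sum_{k\ge0}\big(\binom{n+2}{2k}-4\binom{n-1}{2k-2}\big)q^k=\sum_{k\ge0}\big(\binom{n}{2k}+\binom{n-1}{2k-1}+\binom{n-2}{2k-1}+\binom{n-2}{2k-4}\big)q^k$; (ii) $\mathcal K^{l}_{\mathfrak{Ab}}(q)=\sum_{k\ge0}\big(\binom{n}{2k+1}+\binom{n}{2k-2}\big)q^k$; (iii) $D_{\mathfrak{Ab}}(q)=-\sum_{k\ge0}\big(\binom{n-2}{2k+1}+\binom{n-3}{2k}\big)q^k$.
   Context: Type $D_n$: positive roots $\Delta^+=\{\varepsilon_i\pm\varepsilon_j:1\le i<j\le n\}$, simple roots $\varepsilon_i-\varepsilon_{i+1}$ ($i<n$), $\varepsilon_{n-1}+\varepsilon_n$, with the root order (generated by $\gamma$ covering $\mu$ iff $\gamma-\mu$ is a simple root). An upper ideal $I\subset\Delta^+$ (up-closed subset) is abelian if $\gamma'+\gamma''\notin\Delta^+$ for all $\gamma',\gamma''\in I$; $\mathfrak{Ab}$ is the poset of all abelian upper ideals (including $\varnothing$) ordered by inclusion. For a finite poset $\mathcal P$, $\kappa(x)$ (resp. $\iota(x)$) is the number of elements covered by (resp. covering) $x$; $\mathcal K^{u}_{\mathcal P}=\sum_x q^{\kappa(x)}$, $\mathcal K^{l}_{\mathcal P}=\sum_x q^{\iota(x)}$, and $D_{\mathcal P}$ is defined by $\mathcal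 K^{u}_{\mathcal P}-\mathcal K^{l}_{\mathcal P}=(q-1)^2D_{\mathcal P}$. Binomial coefficients with negative lower index are $0$. -}

module Defs where

open import Data.Nat as ℕ using (ℕ; zero; suc; _∸_; _<?_)
open import Data.Nat.Combinatorics using (_C_)
open import Data.Integer as ℤ using (ℤ; +_; -[1+_]; _-_)
import Data.Integer.Properties as ℤP
open import Data.Fin using (Fin; toℕ)
open import Data.Vec using (Vec; tabulate; zipWith)
import Data.Vec.Properties as VecP
open import Data.List using (List; []; _∷_; map; _++_; filter; length; concatMap; allFin)
open import Data.List.Relation.Unary.All as All using (All)
open import Data.Product using (_×_; _,_)
open import Relation.Nullary using (¬_; Dec; does)
open import Data.Bool using (if_then_else_)
open import Data.Fin using () renaming (_≟_ to _Fin≟_)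
open import Relation.Nullary.Decidable using (_×-dec_; ¬?; _→-dec_)
open import Relation.Binary.PropositionalEquality using (_≡_)
open import Relation.Binary.Definitions using (DecidableEquality)
open import Relation.Unary using (Decidable)

-- Generic finite-poset notions.
-- A finite poset is given by the list of its elements (without
-- repetitions) and a decidable strict order _<_ on them.

module FinitePoset {A : Set} (elems : List A)
                   (_<_ : A → A → Set) (_<?_ : (x y : A) → Dec (x < y)) where

  Covers : A → A → Set
  Covers x y = (y < x) × All (λ z → ¬ ((y < z) × (z < x))) elems

  covers? : (x y : A) → Dec (Covers x y)
  covers? x y = (y <? x) ×-dec All.all? (λ z → ¬? ((y <? z) ×-dec (z <? x))) elems

  κ : A → ℕ
  κ x = length (filter (covers? x) elems)

  ι : A → ℕ
  ι x = length (filter (λ y → covers? y x) elems)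

  -- coefficient of q^k in K^u = Σ_x q^{κ(x)} and K^l = Σ_x q^{ι(x)}
  Ku : ℕ → ℕ
  Ku k = length (filter (λ x → κ x ℕ.≟ k) elems)

  Kl : ℕ → ℕ
  Kl k = length (filter (λ x → ι x ℕ.≟ k) elems)

-- Root system D_n realised in ℤ^n (ε-coordinates).

Vecℤ : ℕ → Set
Vecℤ n = Vec ℤ n

_≟ᵥ_ : ∀ {n} → DecidableEquality (Vecℤ n)
_≟ᵥ_ = VecP.≡-dec ℤ._≟_

_+ᵥ_ : ∀ {n} → Vecℤ n → Vecℤ n → Vecℤ n
_+ᵥ_ = zipWith ℤ._+_

_-ᵥ_ : ∀ {n} → Vecℤ n → Vecℤ n → Vecℤ n
_-ᵥ_ = zipWith ℤ._-_

ε : ∀ {n} → Fin n → Vecℤ n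
ε i = tabulate (λ j → if does (i Fin≟ j) then + 1 else + 0)

pairs : (n : ℕ) → List (Fin n × Fin n)
pairs n = concatMap (λ i → map (i ,_) (filter (λ j → toℕ i <? toℕ j) (allFin n))) (allFin n)

posRoots : (n : ℕ) → List (Vecℤ n)
posRoots n = concatMap (λ { (i , j) → (ε i -ᵥ ε j) ∷ (ε i +ᵥ ε j) ∷ [] }) (pairs n)

-- simple roots: ε_i - ε_{i+1} (i < n), ε_{n-1} + ε_n   (1-based in the paper)
simpleRoots : (n : ℕ) → List (Vecℤ n)
simpleRoots n =
     map (λ { (i , j) → ε i -ᵥ ε j })
         (filter (λ { (i , j) → toℕ j ℕ.≟ suc (toℕ i) }) (pairs n))
  ++ map (λ { (i , j) → ε i +ᵥ ε j })
         (filter (λ { (i , j) → (toℕ i ℕ.≟ n ∸ 2) ×-dec (toℕ j ℕ.≟ n ∸ 1) }) (pairs n))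

module Mem (n : ℕ) where
  open import Data.List.Membership.DecPropositional (_≟ᵥ_ {n = n}) public using (_∈_; _∈?_)
  open import Data.List.Relation.Binary.Subset.DecPropositional (_≟ᵥ_ {n = n}) public using (_⊆_; _⊆?_)

subsets : {A : Set} → List A → List (List A)
subsets [] = [] ∷ []
subsets (x ∷ xs) = map (x ∷_) (subsets xs) ++ subsets xs

module TypeD (n : ℕ) where
  open Mem n

  Δ⁺ : List (Vecℤ n)
  Δ⁺ = posRoots n

  -- I is an upper ideal: up-closed for the root order, which is generated by
  -- the covering relation "γ covers μ iff γ - μ is a simple root";
  -- i.e. μ ∈ I, α simple, μ + α ∈ Δ⁺  ⇒  μ + α ∈ I.
  IsUpper : List (Vecℤ n) → Set
  IsUpper I = All (λ μ → All (λ α → (μ +ᵥ α) ∈ Δ⁺ → (μ +ᵥ α) ∈ I) (simpleRoots n)) I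

  isUpper? : (I : List (Vecℤ n)) → Dec (IsUpper I)
  isUpper? I = All.all? (λ μ → All.all? (λ α → ((μ +ᵥ α) ∈? Δ⁺) →-dec ((μ +ᵥ α) ∈? I)) (simpleRoots n)) I

  IsAbelian : List (Vecℤ n) → Set
  IsAbelian I = All (λ a → All (λ b → ¬ ((a +ᵥ b) ∈ Δ⁺)) I) I

  isAbelian? : (I : List (Vecℤ n)) → Dec (IsAbelian I)
  isAbelian? I = All.all? (λ a → All.all? (λ b → ¬? ((a +ᵥ b) ∈? Δ⁺)) I) I

  Ab : List (List (Vecℤ n))
  Ab = filter (λ I → isUpper? I ×-dec isAbelian? I) (subsets Δ⁺)

  _⊂_ : List (Vecℤ n) → List (Vecℤ n) → Set
  I ⊂ J = (I ⊆ J) × ¬ (J ⊆ I)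

  _⊂?_ : (I J : List (Vecℤ n)) → Dec (I ⊂ J)
  I ⊂? J = (I ⊆? J) ×-dec ¬? (J ⊆? I)

  open FinitePoset Ab _⊂_ _⊂?_ public using (κ; ι; Ku; Kl)

-- Polynomials in q with ℤ coefficients, as coefficient sequences.

Poly : Set
Poly = ℕ → ℤ

sumTo : ℕ → (ℕ → ℤ) → ℤ
sumTo zero f = f 0
sumTo (suc k) f = sumTo k f ℤ.+ f (suc k)

_*ₚ_ : Poly → Poly → Poly
(f *ₚ g) k = sumTo k (λ i → f i ℤ.* g (k ∸ i))

q-1² : Poly
q-1² 0 = + 1
q-1² 1 = ℤ.- (+ 2)
q-1² 2 = + 1
q-1² (suc (suc (suc _))) = + 0

binom : ℕ → ℤ → ℤ
binom m (+ k) = + (m C k)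
binom m -[1+ _ ] = + 0

{-# OPTIONS --safe #-}
module Submission where

-- A cover in the poset of abelian ideals adds a single root: if J ⊂ I, a root of minimal height in I ∖ J can be
-- removed from I. Arrange the roots ε_i ± ε_j in rows i. An abelian ideal I that misses one of ε_0 ± ε_N (N the last
-- index) is, up to the sign of ε_N, an up-set of the triangle {ε_i + ε_j}, i.e. a lattice path, i.e. a binary word.
-- If I contains both, then row 0 of I ends at some ε_0 − ε_t, no other row contains a difference, and by
-- commutativity the rest of I is an up-set of the triangle on the indices 1, …, t − 1. Conversely each of these sets
-- is abelian because a linear weight is ≥ 2 on it and ≤ 3 on all roots. The covers become corner flips of the path
-- together with a few moves between the families, and the words with a given number of flips are counted by
-- binomial coefficients through Pascal's rule.

open import Defs
open import Data.Bool using (Bool; true; false; not)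
open import Data.Bool.Properties using () renaming (_≟_ to _≟ᵇ_)
open import Data.Empty using (⊥; ⊥-elim)
open import Data.Fin using (Fin; toℕ; fromℕ<) renaming (zero to fzero; suc to fsuc)
import Data.Fin.Properties as FinP
open import Data.Integer as ℤ using (ℤ; +_; -[1+_]; -_; _-_; +≤+; -≤+) renaming (_+_ to _+ℤ_; _*_ to _*ℤ_)
import Data.Integer.Properties as ℤP
open import Data.Integer.Tactic.RingSolver using (solve-∀)
open import Data.List using (List; []; _∷_; map; _++_; filter; length; concatMap; allFin; upTo; cartesianProduct)
open import Data.List.Membership.Propositional using (_∈_; _∉_)
open import Data.List.Membership.Propositional.Properties
open import Data.List.Membership.Propositional.Properties.WithK using (unique∧set⇒bag)
open import Data.List.Properties using (length-map; length-++; filter-accept; filter-reject)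
open import Data.List.Relation.Binary.BagAndSetEquality using (∼bag⇒↭)
open import Data.List.Relation.Binary.Permutation.Propositional.Properties using (↭-length)
open import Data.List.Relation.Unary.All as All using (All; []; _∷_)
open import Data.List.Relation.Unary.AllPairs using ([]; _∷_)
open import Data.List.Relation.Unary.Any using (here; there)
open import Data.List.Relation.Unary.Unique.Propositional using (Unique)
import Data.List.Relation.Unary.Unique.Propositional.Properties as Uniq
open import Data.Nat as ℕ using (ℕ; zero; suc; pred; _+_; _*_; _∸_; z≤n; s≤s; s≤s⁻¹; _≤_; _<_)
open import Data.Nat.Combinatorics using (nCk+nC[k+1]≡[n+1]C[k+1])
import Data.Nat.Properties as ℕP
open import Data.Product using (_×_; _,_; proj₁; proj₂; ∃)
open import Data.Sum using (_⊎_; inj₁; inj₂)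
open import Data.Unit using (⊤; tt)
open import Data.Vec using (Vec; []; _∷_; tabulate; replicate)
import Data.Vec.Properties as VecP
open import Function using (_∘_; mk⇔)
open import Relation.Binary.Definitions using (tri<; tri≈; tri>)
open import Relation.Binary.PropositionalEquality
open import Relation.Nullary using (¬_; Dec; yes; no)
open import Relation.Nullary.Decidable using (_×-dec_; _⊎-dec_; ¬?)
open import Relation.Unary using (Decidable)
open ≡-Reasoning

-- The fork of the Dynkin diagram is the obstacle: ε_0 + ε_N and ε_0 - ε_N are incomparable, and the
-- shape of an ideal depends on how many of them it contains. With none, both choices of the sign of
-- ε_N describe the same ideal, so this case is kept apart to be counted once. With at most one, a
-- difference ε_i - ε_j with j < N is impossible, because it lies below both of ε_0 ± ε_N. With
-- both, only commutativity restricts the lower rows. To see that a described set is upward closed,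
-- roots are compared by evaluating dominant weights, such as ε_0 + ... + ε_{k-1} and ε_0 + ... +
-- ε_{N-1} ± ε_N. Rows, signs and columns are read off from the values, without a case analysis of
-- sums of roots. In the counts, lowering k by one lowers the lower index of a binomial by two,
-- while Pascal's rule moves it by one. Hence each final formula reduces to a linear identity
-- between the numbers binom(n - 3, 2k + 1 - i) with 0 ≤ i ≤ 6.

-- Repetition-free lists and sublists

unique-map : {A B : Set} (f : A → B) {xs : List A} →
  (∀ {x y} → x ∈ xs → y ∈ xs → f x ≡ f y → x ≡ y) → Unique xs → Unique (map f xs)
unique-map f inj [] = []
unique-map f {x ∷ xs} inj (x∉ ∷ u) =
  All.tabulate (λ v∈ eq → let (y , y∈ , eq′) = ∈-map⁻ f v∈ in
    All.lookup x∉ y∈ (inj (here refl) (there y∈) (trans eq eq′)))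
  ∷ unique-map f (λ p q → inj (there p) (there q)) u

-- Repetition-free lists with the same members are permutations of each other; this is applied to
-- `xs` and `map f ys`. All numbers of the theorem are carried from ideals to codes in this way,
-- with `f` the decoding map.
length-bijection : {A B : Set} {xs : List A} {ys : List B} (f : B → A) →
  Unique xs → Unique ys → (∀ {x y} → x ∈ ys → y ∈ ys → f x ≡ f y → x ≡ y) →
  (∀ {y} → y ∈ ys → f y ∈ xs) → (∀ {x} → x ∈ xs → ∃ λ y → y ∈ ys × f y ≡ x) →
  length xs ≡ length ys
length-bijection {ys = ys} f uxs uys inj to from =
  trans (↭-length (∼bag⇒↭ (unique∧set⇒bag uxs (unique-map f inj uys)
          (mk⇔ (λ x∈ → let (y , y∈ , eq) = from x∈ in subst (_∈ map f ys) eq (∈-map⁺ f y∈))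
               (λ x∈ → let (y , y∈ , eq) = ∈-map⁻ f x∈ in subst (_∈ _) (sym eq) (to y∈))))))
        (length-map f ys)

unique-concatMap : {A B : Set} (f : A → List B) {xs : List A} → Unique xs →
  (∀ {x} → x ∈ xs → Unique (f x)) → (∀ {x y v} → x ∈ xs → y ∈ xs → v ∈ f x → v ∈ f y → x ≡ y) →
  Unique (concatMap f xs)
unique-concatMap f [] _ _ = []
unique-concatMap f {x ∷ xs} (x∉ ∷ uxs) u disj =
  Uniq.++⁺ (u (here refl)) (unique-concatMap f uxs (u ∘ there) (λ p q → disj (there p) (there q)))
    (λ (v∈ , v∈′) → let (y , y∈ , v∈y) = ∈-cm v∈′ in
      All.lookup x∉ y∈ (disj (here refl) (there y∈) v∈ v∈y))
  where
  ∈-cm : ∀ {v ys} → v ∈ concatMap f ys → ∃ λ y → y ∈ ys × v ∈ f y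
  ∈-cm {ys = y ∷ ys} v∈ with ∈-++⁻ (f y) v∈
  ... | inj₁ p = y , here refl , p
  ... | inj₂ p = let (z , z∈ , q) = ∈-cm p in z , there z∈ , q

module _ {A : Set} where

  ∈-subsets : {xs : List A} {ys : List A} → ys ∈ subsets xs → ∀ {v} → v ∈ ys → v ∈ xs
  ∈-subsets {[]} (here refl) ()
  ∈-subsets {x ∷ xs} p v∈ with ∈-++⁻ (map (x ∷_) (subsets xs)) p
  ... | inj₂ q = there (∈-subsets q v∈)
  ... | inj₁ q with ∈-map⁻ (x ∷_) q
  ...   | zs , zs∈ , refl with v∈
  ...     | here eq = here eq
  ...     | there r = there (∈-subsets zs∈ r)

  subsets-unique : {xs : List A} → Unique xs → Unique (subsets xs)
  subsets-unique [] = [] ∷ []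
  subsets-unique {x ∷ xs} (x∉ ∷ u) =
    Uniq.++⁺ (Uniq.map⁺ (λ { refl → refl }) (subsets-unique u)) (subsets-unique u)
      (λ (p , q) → let (_ , _ , eq) = ∈-map⁻ (x ∷_) p in
         All.lookup x∉ (∈-subsets q (subst (x ∈_) (sym eq) (here refl))) refl)

  filter-∈-subsets : {P : A → Set} (P? : Decidable P) {xs ys : List A} →
    ys ∈ subsets xs → filter P? ys ∈ subsets xs
  filter-∈-subsets P? {[]} (here refl) = here refl
  filter-∈-subsets P? {x ∷ xs} p with ∈-++⁻ (map (x ∷_) (subsets xs)) p
  ... | inj₂ q = ∈-++⁺ʳ (map (x ∷_) (subsets xs)) (filter-∈-subsets P? {xs} q)
  ... | inj₁ q with ∈-map⁻ (x ∷_) q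
  ...   | zs , zs∈ , refl with P? x
  ...     | yes _ = ∈-++⁺ˡ (∈-map⁺ (x ∷_) (filter-∈-subsets P? {xs} zs∈))
  ...     | no _ = ∈-++⁺ʳ (map (x ∷_) (subsets xs)) (filter-∈-subsets P? {xs} zs∈)

  self-∈-subsets : (xs : List A) → xs ∈ subsets xs
  self-∈-subsets [] = here refl
  self-∈-subsets (x ∷ xs) = ∈-++⁺ˡ (∈-map⁺ (x ∷_) (self-∈-subsets xs))

  -- Entries of `subsets xs` keep the order of `xs`, so having the same members forces equality as
  -- lists. Each ideal thus occurs as one list only.
  subsets-ext : {xs ys zs : List A} → Unique xs → ys ∈ subsets xs → zs ∈ subsets xs →
    (∀ {v} → v ∈ ys → v ∈ zs) → (∀ {v} → v ∈ zs → v ∈ ys) → ys ≡ zs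
  subsets-ext {[]} _ (here refl) (here refl) _ _ = refl
  subsets-ext {x ∷ xs} (x∉ ∷ u) p q to from
    with ∈-++⁻ (map (x ∷_) (subsets xs)) p | ∈-++⁻ (map (x ∷_) (subsets xs)) q
  ... | inj₂ p′ | inj₂ q′ = subsets-ext u p′ q′ to from
  ... | inj₁ p′ | inj₂ q′ with ∈-map⁻ (x ∷_) p′
  ...   | _ , _ , refl = ⊥-elim (All.lookup x∉ (∈-subsets q′ (to (here refl))) refl)
  subsets-ext {x ∷ xs} (x∉ ∷ u) p q to from | inj₂ p′ | inj₁ q′ with ∈-map⁻ (x ∷_) q′
  ...   | _ , _ , refl = ⊥-elim (All.lookup x∉ (∈-subsets p′ (from (here refl))) refl)
  subsets-ext {x ∷ xs} (x∉ ∷ u) p q to from | inj₁ p′ | inj₁ q′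
    with ∈-map⁻ (x ∷_) p′ | ∈-map⁻ (x ∷_) q′
  ... | ys , ys∈ , refl | zs , zs∈ , refl =
    cong (x ∷_) (subsets-ext u ys∈ zs∈ (tail ys∈ to) (tail zs∈ from))
    where
    tail : ∀ {as bs} → as ∈ subsets xs → (∀ {v} → v ∈ x ∷ as → v ∈ x ∷ bs) → ∀ {v} → v ∈ as → v ∈ bs
    tail as∈ sub v∈ with sub (there v∈)
    ... | there r = r
    ... | here refl = ⊥-elim (All.lookup x∉ (∈-subsets as∈ v∈) refl)

-- Coordinates of roots

-- The i-th unit vector, and the zero vector when i ≥ n.
e : ∀ {n} → ℕ → Vecℤ n
e {zero} _ = []
e {suc n} zero = + 1 ∷ replicate n (+ 0)
e {suc n} (suc i) = + 0 ∷ e i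

ε≡e : ∀ {n} (i : Fin n) → ε i ≡ e (toℕ i)
ε≡e {suc n} fzero = cong (+ 1 ∷_) (tabulate-const n)
  where
  tabulate-const : ∀ n → tabulate {n = n} (λ _ → + 0) ≡ replicate n (+ 0)
  tabulate-const zero = refl
  tabulate-const (suc n) = cong (+ 0 ∷_) (tabulate-const n)
ε≡e (fsuc i) = cong (+ 0 ∷_) (ε≡e i)

root : ∀ {n} → Bool → ℕ → ℕ → Vecℤ n
root true i j = e i +ᵥ e j
root false i j = e i -ᵥ e j

dot : ∀ {n} → (ℕ → ℤ) → Vecℤ n → ℤ
dot w [] = + 0
dot w (x ∷ v) = w 0 ℤ.* x ℤ.+ dot (λ k → w (suc k)) v

dot-+ : ∀ {n} w (u v : Vecℤ n) → dot w (u +ᵥ v) ≡ dot w u ℤ.+ dot w v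
dot-+ w [] [] = refl
dot-+ w (x ∷ u) (y ∷ v) rewrite dot-+ (λ k → w (suc k)) u v = lem (w 0) x y _ _
  where
  lem : ∀ a x y s t → a ℤ.* (x ℤ.+ y) ℤ.+ (s ℤ.+ t) ≡ (a ℤ.* x ℤ.+ s) ℤ.+ (a ℤ.* y ℤ.+ t)
  lem = solve-∀

dot-− : ∀ {n} w (u v : Vecℤ n) → dot w (u -ᵥ v) ≡ dot w u ℤ.- dot w v
dot-− w [] [] = refl
dot-− w (x ∷ u) (y ∷ v) rewrite dot-− (λ k → w (suc k)) u v = lem (w 0) x y _ _
  where
  lem : ∀ a x y s t → a ℤ.* (x ℤ.- y) ℤ.+ (s ℤ.- t) ≡ (a ℤ.* x ℤ.+ s) ℤ.- (a ℤ.* y ℤ.+ t)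
  lem = solve-∀

dot-0 : ∀ n w → dot w (replicate n (+ 0)) ≡ + 0
dot-0 zero w = refl
dot-0 (suc n) w rewrite dot-0 n (λ k → w (suc k)) | ℤP.*-zeroʳ (w 0) = refl

dot-e : ∀ {n} w {k} → k ℕ.< n → dot {n} w (e k) ≡ w k
dot-e {suc n} w {zero} _ rewrite dot-0 n (λ k → w (suc k)) = trans (ℤP.+-identityʳ _) (ℤP.*-identityʳ _)
dot-e {suc n} w {suc k} (s≤s k<n) rewrite ℤP.*-zeroʳ (w 0) =
  trans (ℤP.+-identityˡ _) (dot-e (λ k → w (suc k)) k<n)

signed : Bool → ℤ → ℤ
signed true x = x
signed false x = - x

dot-root : ∀ {n} w σ {i j} → i ℕ.< n → j ℕ.< n → dot {n} w (root σ i j) ≡ w i ℤ.+ signed σ (w j)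
dot-root {n} w true {i} {j} i< j< = trans (dot-+ {n} w (e i) (e j)) (cong₂ ℤ._+_ (dot-e w i<) (dot-e w j<))
dot-root {n} w false {i} {j} i< j< = trans (dot-− {n} w (e i) (e j)) (cong₂ ℤ._-_ (dot-e w i<) (dot-e w j<))

+ᵥ-comm : ∀ {n} (u v : Vecℤ n) → u +ᵥ v ≡ v +ᵥ u
+ᵥ-comm = VecP.zipWith-comm ℤP.+-comm

+-swap-first : ∀ {n} (x y z : Vecℤ n) → (x +ᵥ y) +ᵥ (z -ᵥ x) ≡ z +ᵥ y
+-swap-first [] [] [] = refl
+-swap-first (x ∷ xs) (y ∷ ys) (z ∷ zs) = cong₂ _∷_ (lem x y z) (+-swap-first xs ys zs)
  where
  lem : ∀ x y z → (x ℤ.+ y) ℤ.+ (z ℤ.- x) ≡ z ℤ.+ y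
  lem = solve-∀

−-swap-first : ∀ {n} (x y z : Vecℤ n) → (x -ᵥ y) +ᵥ (z -ᵥ x) ≡ z -ᵥ y
−-swap-first [] [] [] = refl
−-swap-first (x ∷ xs) (y ∷ ys) (z ∷ zs) = cong₂ _∷_ (lem x y z) (−-swap-first xs ys zs)
  where
  lem : ∀ x y z → (x ℤ.- y) ℤ.+ (z ℤ.- x) ≡ z ℤ.- y
  lem = solve-∀

−-swap-second : ∀ {n} (x y z : Vecℤ n) → (x -ᵥ y) +ᵥ (z +ᵥ y) ≡ x +ᵥ z
−-swap-second [] [] [] = refl
−-swap-second (x ∷ xs) (y ∷ ys) (z ∷ zs) = cong₂ _∷_ (lem x y z) (−-swap-second xs ys zs)
  where
  lem : ∀ x y z → (x ℤ.- y) ℤ.+ (z ℤ.+ y) ≡ x ℤ.+ z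
  lem = solve-∀

module _ {n : ℕ} where

  root-comm : ∀ i j → root {n} true i j ≡ root true j i
  root-comm i j = +ᵥ-comm (e i) (e j)

  raise-first : ∀ σ i j k → root {n} σ i j +ᵥ root false k i ≡ root σ k j
  raise-first true i j k = +-swap-first (e i) (e j) (e k)
  raise-first false i j k = −-swap-first (e i) (e j) (e k)

  raise-second : ∀ i j k → root {n} true i j +ᵥ root false k j ≡ root true i k
  raise-second i j k = trans (cong (_+ᵥ root false k j) (root-comm i j))
    (trans (raise-first true j i k) (root-comm k i))

  -- Used in two ways: with the simple root ε_{N-1} + ε_N it leads from differences to sums in the
  -- root order, and for general indices it produces the sums that an abelian ideal forbids.
  cancel-second : ∀ i j k → root {n} false i j +ᵥ root true k j ≡ root true i k
  cancel-second i j k = −-swap-second (e i) (e j) (e k)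

  raise-second⁻ : ∀ i j k → root {n} false i j +ᵥ root false j k ≡ root false i k
  raise-second⁻ i j k = trans (+ᵥ-comm _ _) (raise-first false j k i)

∈-pairs⁺ : ∀ {n} {i j : Fin n} → toℕ i ℕ.< toℕ j → (i , j) ∈ pairs n
∈-pairs⁺ {n} {i} {j} i<j = ∈-concat⁺′ (∈-map⁺ (i ,_) (∈-filter⁺ (λ j → toℕ i ℕ.<? toℕ j) (∈-allFin j) i<j))
  (∈-map⁺ (λ i → map (i ,_) (filter (λ j → toℕ i ℕ.<? toℕ j) (allFin n))) (∈-allFin i))

∈-pairs⁻ : ∀ {n} {p : Fin n × Fin n} → p ∈ pairs n → toℕ (proj₁ p) ℕ.< toℕ (proj₂ p)
∈-pairs⁻ {n} p∈ with ∈-concat⁻′ (map (λ i → map (i ,_) (filter (λ j → toℕ i ℕ.<? toℕ j) (allFin n))) (allFin n)) p∈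
... | xs , p∈xs , xs∈ with ∈-map⁻ (λ i → map (i ,_) (filter (λ j → toℕ i ℕ.<? toℕ j) (allFin n))) xs∈
... | i , _ , refl with ∈-map⁻ (i ,_) p∈xs
... | j , j∈ , refl = proj₂ (∈-filter⁻ (λ j → toℕ i ℕ.<? toℕ j) {xs = allFin n} j∈)

pairs-unique : ∀ n → Unique (pairs n)
pairs-unique n = unique-concatMap _ (Uniq.allFin⁺ n)
  (λ {i} _ → Uniq.map⁺ (λ { refl → refl }) (Uniq.filter⁺ (λ j → toℕ i ℕ.<? toℕ j) (Uniq.allFin⁺ n)))
  (λ {i} {i′} _ _ p q → let (_ , _ , eq) = ∈-map⁻ (i ,_) p ; (_ , _ , eq′) = ∈-map⁻ (i′ ,_) q in
     trans (sym (cong proj₁ eq)) (cong proj₁ eq′))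

IsRoot : ℕ → ℕ → ℕ → Set
IsRoot n i j = i ℕ.< j × j ℕ.< n

pairRoots : ∀ {n} → Fin n × Fin n → List (Vecℤ n)
pairRoots (i , j) = (ε i -ᵥ ε j) ∷ (ε i +ᵥ ε j) ∷ []

root-ε : ∀ {n} σ (i j : Fin n) → root σ (toℕ i) (toℕ j) ∈ pairRoots (i , j)
root-ε true i j = there (here (cong₂ _+ᵥ_ (sym (ε≡e i)) (sym (ε≡e j))))
root-ε false i j = here (cong₂ _-ᵥ_ (sym (ε≡e i)) (sym (ε≡e j)))

∈-pairRoots⁻ : ∀ {n v} {i j : Fin n} → v ∈ pairRoots (i , j) → ∃ λ σ → v ≡ root σ (toℕ i) (toℕ j)
∈-pairRoots⁻ {i = i} {j} (here refl) = false , cong₂ _-ᵥ_ (ε≡e i) (ε≡e j)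
∈-pairRoots⁻ {i = i} {j} (there (here refl)) = true , cong₂ _+ᵥ_ (ε≡e i) (ε≡e j)

root∈posRoots : ∀ {n i j} σ → IsRoot n i j → root σ i j ∈ posRoots n
root∈posRoots {n} {i} {j} σ (i<j , j<n) =
  subst₂ (λ a b → root σ a b ∈ posRoots n) (FinP.toℕ-fromℕ< i<n) (FinP.toℕ-fromℕ< j<n)
    (∈-concat⁺′ (root-ε σ (fromℕ< i<n) (fromℕ< j<n))
      (∈-map⁺ pairRoots (∈-pairs⁺ (subst₂ ℕ._<_ (sym (FinP.toℕ-fromℕ< i<n)) (sym (FinP.toℕ-fromℕ< j<n)) i<j))))
  where
  i<n = ℕP.<-trans i<j j<n

posRoots⁻ : ∀ {n v} → v ∈ posRoots n → ∃ λ σ → ∃ λ i → ∃ λ j → IsRoot n i j × v ≡ root σ i j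
posRoots⁻ {n} v∈ with ∈-concat⁻′ (map pairRoots (pairs n)) v∈
... | xs , v∈xs , xs∈ with ∈-map⁻ pairRoots xs∈
... | (i , j) , p∈ , refl with ∈-pairRoots⁻ v∈xs
... | σ , eq = σ , toℕ i , toℕ j , (∈-pairs⁻ p∈ , FinP.toℕ<n j) , eq

module _ {n : ℕ} where
  private
    P? : (p : Fin n × Fin n) → Dec (toℕ (proj₂ p) ≡ suc (toℕ (proj₁ p)))
    P? p = toℕ (proj₂ p) ℕ.≟ suc (toℕ (proj₁ p))
    Q? : (p : Fin n × Fin n) → Dec ((toℕ (proj₁ p) ≡ n ∸ 2) × (toℕ (proj₂ p) ≡ n ∸ 1))
    Q? p = (toℕ (proj₁ p) ℕ.≟ n ∸ 2) ×-dec (toℕ (proj₂ p) ℕ.≟ n ∸ 1)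
    diff sum : Fin n × Fin n → Vecℤ n
    diff p = ε (proj₁ p) -ᵥ ε (proj₂ p)
    sum p = ε (proj₁ p) +ᵥ ε (proj₂ p)

  -- Here n is arbitrary, so the second case records the inequalities that truncated subtraction
  -- would violate for small n.
  simpleRoots⁻ : ∀ {α} → α ∈ simpleRoots n →
    (∃ λ k → suc k ℕ.< n × α ≡ root false k (suc k)) ⊎ (n ∸ 2 ℕ.< n ∸ 1 × n ∸ 1 ℕ.< n × α ≡ root true (n ∸ 2) (n ∸ 1))
  simpleRoots⁻ α∈ with ∈-++⁻ (map diff (filter P? (pairs n))) α∈
  ... | inj₁ q with ∈-map⁻ diff q
  ...   | (i , j) , p∈ , refl with ∈-filter⁻ P? {xs = pairs n} p∈
  ...   | _ , eq = inj₁ (toℕ i , subst (ℕ._< n) eq (FinP.toℕ<n j) , cong₂ _-ᵥ_ (ε≡e i) (trans (ε≡e j) (cong e eq)))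
  simpleRoots⁻ α∈ | inj₂ q with ∈-map⁻ sum q
  ...   | (i , j) , p∈ , refl with ∈-filter⁻ Q? {xs = pairs n} p∈
  ...   | ∈p , eq , eq′ = inj₂ (subst₂ ℕ._<_ eq eq′ (∈-pairs⁻ ∈p) , subst (ℕ._< n) eq′ (FinP.toℕ<n j) ,
                              cong₂ _+ᵥ_ (trans (ε≡e i) (cong e eq)) (trans (ε≡e j) (cong e eq′)))

  simple-diff : ∀ {k} → suc k ℕ.< n → root false k (suc k) ∈ simpleRoots n
  simple-diff {k} k+1<n = ∈-++⁺ˡ (subst (_∈ map diff (filter P? (pairs n)))
    (cong₂ _-ᵥ_ (trans (ε≡e _) (cong e (FinP.toℕ-fromℕ< k<n))) (trans (ε≡e _) (cong e (FinP.toℕ-fromℕ< k+1<n))))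
    (∈-map⁺ diff (∈-filter⁺ P? (∈-pairs⁺ {i = fromℕ< k<n} {fromℕ< k+1<n} lt) eq)))
    where
    k<n = ℕP.<-trans (ℕP.n<1+n k) k+1<n
    eq : toℕ (fromℕ< k+1<n) ≡ suc (toℕ (fromℕ< k<n))
    eq = trans (FinP.toℕ-fromℕ< k+1<n) (cong suc (sym (FinP.toℕ-fromℕ< k<n)))
    lt : toℕ (fromℕ< k<n) ℕ.< toℕ (fromℕ< k+1<n)
    lt = subst (toℕ (fromℕ< k<n) ℕ.<_) (sym eq) (ℕP.n<1+n _)

  simple-sum : n ∸ 2 ℕ.< n ∸ 1 → n ∸ 1 ℕ.< n → root true (n ∸ 2) (n ∸ 1) ∈ simpleRoots n
  simple-sum lt₁ lt₂ = ∈-++⁺ʳ (map diff (filter P? (pairs n))) (subst (_∈ map sum (filter Q? (pairs n)))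
    (cong₂ _+ᵥ_ (trans (ε≡e _) (cong e eqi)) (trans (ε≡e _) (cong e eqj)))
    (∈-map⁺ sum (∈-filter⁺ Q? (∈-pairs⁺ {i = fromℕ< i<n} {fromℕ< lt₂} (subst₂ ℕ._<_ (sym eqi) (sym eqj) lt₁)) (eqi , eqj))))
    where
    i<n = ℕP.<-trans lt₁ lt₂
    eqi = FinP.toℕ-fromℕ< i<n
    eqj = FinP.toℕ-fromℕ< lt₂

-- Covers in the poset of abelian ideals

minimum-by : {A : Set} (f : A → ℤ) (x : A) (xs : List A) →
  ∃ λ m → m ∈ x ∷ xs × (∀ {y} → y ∈ x ∷ xs → f m ℤ.≤ f y)
minimum-by f x [] = x , here refl , λ { (here refl) → ℤP.≤-refl }
minimum-by f x (y ∷ ys) with minimum-by f y ys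
... | m , m∈ , min with ℤP.≤-total (f x) (f m)
...   | inj₁ x≤m = x , here refl , λ { (here refl) → ℤP.≤-refl ; (there z∈) → ℤP.≤-trans x≤m (min z∈) }
...   | inj₂ m≤x = m , there m∈ , λ { (here refl) → m≤x ; (there z∈) → min z∈ }

module Ideals (n : ℕ) where
  open TypeD n public
  open Mem n using (_∈?_; _⊆?_)
  module Poset = FinitePoset Ab _⊂_ _⊂?_

  private
    ab? : (I : List (Vecℤ n)) → Dec (IsUpper I × IsAbelian I)
    ab? I = isUpper? I ×-dec isAbelian? I

  Ab⁺ : ∀ {I} → I ∈ subsets Δ⁺ → IsUpper I → IsAbelian I → I ∈ Ab
  Ab⁺ p u a = ∈-filter⁺ ab? p (u , a)

  Ab⁻ : ∀ {I} → I ∈ Ab → I ∈ subsets Δ⁺ × IsUpper I × IsAbelian I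
  Ab⁻ = ∈-filter⁻ ab? {xs = subsets Δ⁺}

  ∈-Ab-root : ∀ {I v} → I ∈ Ab → v ∈ I → v ∈ Δ⁺
  ∈-Ab-root I∈ v∈ = ∈-subsets (proj₁ (Ab⁻ I∈)) v∈

  -- Not the usual height: the weights n - l give the value 3 to the last simple root and 1 to the
  -- others. What is used is that it is linear and positive on simple roots.
  height : Vecℤ n → ℤ
  height = dot (λ l → + (n ∸ l))

  simple-height : ∀ {α} → α ∈ simpleRoots n → + 0 ℤ.< height α
  simple-height α∈ with simpleRoots⁻ α∈
  ... | inj₁ (k , k+1<n , refl) = subst (+ 0 ℤ.<_) (sym eq) (ℤ.+<+ (s≤s z≤n))
    where
    eq : height (root false k (suc k)) ≡ + 1
    eq = trans (dot-root {n} _ false (ℕP.<-trans (ℕP.n<1+n k) k+1<n) k+1<n)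
      (trans (cong (λ x → + x ℤ.- + (n ∸ suc k)) (ℕP.+-∸-assoc 1 {n} {suc k} k+1<n′)) (lem (n ∸ suc k)))
      where
      k+1<n′ : suc k ℕ.≤ n
      k+1<n′ = ℕP.<⇒≤ k+1<n
      lem : ∀ x → + (suc x) ℤ.- + x ≡ + 1
      lem x = trans (ℤP.m-n≡m⊖n (suc x) x) (trans (ℤP.⊖-≥ (ℕP.n≤1+n x)) (cong +_ (ℕP.m+n∸n≡m 1 x)))
  ... | inj₂ (lt₁ , lt₂ , refl) = subst (+ 0 ℤ.<_) (sym (dot-root {n} _ true lt lt₂))
          (ℤ.+<+ (ℕP.<-≤-trans (ℕP.m<n⇒0<n∸m lt) (ℕP.m≤m+n _ _)))
    where
    lt : n ∸ 2 ℕ.< n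
    lt = ℕP.<-trans lt₁ lt₂

  AddsRoot : List (Vecℤ n) → List (Vecℤ n) → Vecℤ n → Set
  AddsRoot I J γ = γ ∈ I × γ ∉ J × (∀ {δ} → δ ∈ J → δ ∈ I) × (∀ {δ} → δ ∈ I → δ ∈ J ⊎ δ ≡ γ)

  addsRoot⇒covers : ∀ {I J γ} → AddsRoot I J γ → Poset.Covers I J
  addsRoot⇒covers {I} {J} {γ} (γ∈I , γ∉J , J⊆I , only) =
    (J⊆I , λ I⊆J → γ∉J (I⊆J γ∈I)) ,
    All.tabulate λ { {K} K∈ ((J⊆K , K⊈J) , (K⊆I , I⊈K)) → between K J⊆K K⊈J K⊆I I⊈K }
    where
    between : ∀ K → (∀ {δ} → δ ∈ J → δ ∈ K) → ¬ (∀ {δ} → δ ∈ K → δ ∈ J) →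
      (∀ {δ} → δ ∈ K → δ ∈ I) → ¬ (∀ {δ} → δ ∈ I → δ ∈ K) → ⊥
    between K J⊆K K⊈J K⊆I I⊈K with γ ∈? K
    ... | yes γ∈K = I⊈K λ δ∈ → case (only δ∈)
      where
      case : ∀ {δ} → δ ∈ J ⊎ δ ≡ γ → δ ∈ K
      case (inj₁ p) = J⊆K p
      case (inj₂ refl) = γ∈K
    ... | no γ∉K = K⊈J λ δ∈ → case δ∈ (only (K⊆I δ∈))
      where
      case : ∀ {δ} → δ ∈ K → δ ∈ J ⊎ δ ≡ γ → δ ∈ J
      case δ∈ (inj₁ p) = p
      case δ∈ (inj₂ refl) = ⊥-elim (γ∉K δ∈)

  -- Removing from I a root of I ∖ J of minimal height leaves an abelian ideal that still contains J.
  covers⇒addsRoot : ∀ {I J} → I ∈ Ab → J ∈ Ab → Poset.Covers I J → ∃ λ γ → AddsRoot I J γ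
  covers⇒addsRoot {I} {J} I∈ J∈ ((J⊆I , I⊈J) , none) with filter (λ v → ¬? (v ∈? J)) I in diff≡
  ... | [] = ⊥-elim (I⊈J λ {δ} δ∈ → contra δ∈ (δ ∈? J))
    where
    contra : ∀ {δ} → δ ∈ I → Dec (δ ∈ J) → δ ∈ J
    contra δ∈ (yes p) = p
    contra δ∈ (no q) with () ← subst (_ ∈_) diff≡ (∈-filter⁺ (λ v → ¬? (v ∈? J)) δ∈ q)
  ... | d ∷ ds with minimum-by height d ds
  ... | γ , γ∈ , min = γ , γ∈I , γ∉J , J⊆I , only
    where
    γ∈∖ : γ ∈ I × γ ∉ J
    γ∈∖ = ∈-filter⁻ (λ v → ¬? (v ∈? J)) {xs = I} (subst (γ ∈_) (sym diff≡) γ∈)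
    γ∈I = proj₁ γ∈∖
    γ∉J = proj₂ γ∈∖
    ≢γ? : ∀ v → Dec (¬ (v ≡ γ))
    ≢γ? v = ¬? (v ≟ᵥ γ)
    K = filter ≢γ? I
    K⊆I : ∀ {δ} → δ ∈ K → δ ∈ I
    K⊆I δ∈ = proj₁ (∈-filter⁻ ≢γ? {xs = I} δ∈)
    higher : ∀ {μ α} → α ∈ simpleRoots n → μ +ᵥ α ≡ γ → height γ ℤ.≤ height μ → ⊥
    higher {μ} {α} α∈ refl le = ℤP.<-irrefl refl (ℤP.<-≤-trans
      (subst₂ ℤ._<_ (ℤP.+-identityʳ _) (sym (dot-+ {n} (λ l → + (n ∸ l)) μ α)) (ℤP.+-monoʳ-< (height μ) (simple-height α∈))) le)
    upper : IsUpper K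
    upper = All.tabulate λ {μ} μ∈ → All.tabulate λ {α} α∈ +∈ →
      ∈-filter⁺ ≢γ? (All.lookup (All.lookup (proj₁ (proj₂ (Ab⁻ I∈))) (K⊆I μ∈)) α∈ +∈) (≢γ μ∈ α∈ +∈)
      where
      ≢γ : ∀ {μ α} → μ ∈ K → α ∈ simpleRoots n → μ +ᵥ α ∈ Δ⁺ → ¬ (μ +ᵥ α ≡ γ)
      -- If γ = μ + α with μ in `J`, then γ is in `J` because `J` is upper; otherwise μ is a lower
      -- root of `I` outside `J`, against the choice of γ.
      ≢γ {μ} {α} μ∈ α∈ +∈ eq with μ ∈? J
      ... | yes μ∈J = γ∉J (subst (_∈ J) eq (All.lookup (All.lookup (proj₁ (proj₂ (Ab⁻ J∈))) μ∈J) α∈ +∈))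
      ... | no μ∉J = higher α∈ eq (min (subst (μ ∈_) diff≡ (∈-filter⁺ (λ v → ¬? (v ∈? J)) (K⊆I μ∈) μ∉J)))
    abelian : IsAbelian K
    abelian = All.tabulate λ a∈ → All.tabulate λ b∈ →
      All.lookup (All.lookup (proj₂ (proj₂ (Ab⁻ I∈))) (K⊆I a∈)) (K⊆I b∈)
    K∈Ab : K ∈ Ab
    K∈Ab = Ab⁺ (filter-∈-subsets ≢γ? {xs = Δ⁺} (proj₁ (Ab⁻ I∈))) upper abelian
    J⊆K : ∀ {δ} → δ ∈ J → δ ∈ K
    J⊆K δ∈ = ∈-filter⁺ ≢γ? (J⊆I δ∈) λ { refl → γ∉J δ∈ }
    only : ∀ {δ} → δ ∈ I → δ ∈ J ⊎ δ ≡ γ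
    only {δ} δ∈ with δ ∈? J | δ ≟ᵥ γ
    ... | yes p | _ = inj₁ p
    ... | _ | yes q = inj₂ q
    ... | no δ∉J | no δ≢γ = ⊥-elim (All.lookup none K∈Ab
      ((J⊆K , λ K⊆J → δ∉J (K⊆J (∈-filter⁺ ≢γ? δ∈ δ≢γ))) ,
       (K⊆I , λ I⊆K → proj₂ (∈-filter⁻ ≢γ? {xs = I} (I⊆K γ∈I)) refl)))

-- Words as boundary paths

Word : ℕ → Set
Word = Vec Bool

≤-push : ∀ a m {j} → j ≤ suc a + m → j ≤ a + suc m
≤-push a m j≤ = ℕP.≤-trans j≤ (ℕP.≤-reflexive (sym (ℕP.+-suc a m)))

≤-pull : ∀ a m {j} → j ≤ a + suc m → j ≤ suc a + m
≤-pull a m j≤ = ℕP.≤-trans j≤ (ℕP.≤-reflexive (ℕP.+-suc a m))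

-- Cells (i , j) of the triangle a ≤ i < j ≤ a + m on one side of the boundary path that starts at the corner
-- (a , a + m): true keeps row a and steps to the next row, false discards the last column.
Cell : ∀ {m} → ℕ → Word m → ℕ → ℕ → Set
Cell a [] i j = ⊥
Cell a (false ∷ w) i j = Cell a w i j
Cell {suc m} a (true ∷ w) i j = (i ≡ a × a < j × j ≤ a + suc m) ⊎ Cell (suc a) w i j

cell? : ∀ {m} a (w : Word m) i j → Dec (Cell a w i j)
cell? a [] i j = no λ ()
cell? a (false ∷ w) i j = cell? a w i j
cell? {suc m} a (true ∷ w) i j = (i ℕ.≟ a ×-dec (a ℕ.<? j ×-dec j ℕ.≤? a + suc m)) ⊎-dec cell? (suc a) w i j

cell-bounds : ∀ {m} a (w : Word m) {i j} → Cell a w i j → a ≤ i × i < j × j ≤ a + m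
cell-bounds {suc m} a (false ∷ w) c = let (a≤i , i<j , j≤) = cell-bounds a w c in
  a≤i , i<j , ℕP.≤-trans j≤ (ℕP.+-monoʳ-≤ a (ℕP.n≤1+n m))
cell-bounds a (true ∷ w) (inj₁ (refl , a<j , j≤)) = ℕP.≤-refl , a<j , j≤
cell-bounds {suc m} a (true ∷ w) (inj₂ c) = let (a<i , i<j , j≤) = cell-bounds (suc a) w c in
  ℕP.<⇒≤ a<i , i<j , ≤-push a m j≤

-- Smaller indices mean higher roots ε_i + ε_j, so this is the up-set property of the region bounded
-- by a path.
cell-upward : ∀ {m} a (w : Word m) {i j i′ j′} → Cell a w i j → a ≤ i′ → i′ ≤ i → i′ < j′ → j′ ≤ j → Cell a w i′ j′
cell-upward a (false ∷ w) c = cell-upward a w c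
cell-upward a (true ∷ w) (inj₁ (refl , a<j , j≤)) a≤i′ i′≤i i′<j′ j′≤j
  rewrite ℕP.≤-antisym i′≤i a≤i′ = inj₁ (refl , i′<j′ , ℕP.≤-trans j′≤j j≤)
cell-upward {suc m} a (true ∷ w) {i′ = i′} (inj₂ c) a≤i′ i′≤i i′<j′ j′≤j with ℕP.m≤n⇒m<n∨m≡n a≤i′
... | inj₁ a<i′ = inj₂ (cell-upward (suc a) w c a<i′ i′≤i i′<j′ j′≤j)
... | inj₂ refl = inj₁ (refl , i′<j′ , ℕP.≤-trans j′≤j (≤-push a m (proj₂ (proj₂ (cell-bounds (suc a) w c)))))

row-not-below : ∀ {m} a (w : Word m) {j} → ¬ Cell (suc a) w a j
row-not-below a w c = ℕP.<-irrefl refl (proj₁ (cell-bounds (suc a) w c))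

-- Together with `no-corner` this reads the first letter off the cells, which is the basis for
-- recovering the whole word.
corner : ∀ {m} a (w : Word m) → Cell a (true ∷ w) a (a + suc m)
corner {m} a w = inj₁ (refl , ℕP.m<m+n a (s≤s z≤n) , ℕP.≤-refl)

no-corner : ∀ {m} a (w : Word m) {i} → ¬ Cell a w i (a + suc m)
no-corner {m} a w c = ℕP.<-irrefl refl (ℕP.<-≤-trans (ℕP.+-monoʳ-< a (ℕP.n<1+n m)) (proj₂ (proj₂ (cell-bounds a w c))))

cells-injective : ∀ {m} a (w w′ : Word m) → (∀ {i j} → Cell a w i j → Cell a w′ i j) →
  (∀ {i j} → Cell a w′ i j → Cell a w i j) → w ≡ w′
cells-injective a [] [] _ _ = refl
cells-injective a (false ∷ w) (false ∷ w′) f g = cong (false ∷_) (cells-injective a w w′ f g)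
cells-injective a (true ∷ w) (false ∷ w′) f g = ⊥-elim (no-corner a w′ (f (corner a w)))
cells-injective a (false ∷ w) (true ∷ w′) f g = ⊥-elim (no-corner a w (g (corner a w′)))
cells-injective a (true ∷ w) (true ∷ w′) f g = cong (true ∷_) (cells-injective (suc a) w w′ (tail w w′ f) (tail w′ w g))
  where
  tail : ∀ v v′ → (∀ {i j} → Cell a (true ∷ v) i j → Cell a (true ∷ v′) i j) → ∀ {i j} → Cell (suc a) v i j → Cell (suc a) v′ i j
  tail v v′ h c with h (inj₂ c)
  ... | inj₂ c′ = c′
  ... | inj₁ (refl , _) = ⊥-elim (row-not-below a v c)

-- Removal of one outer corner of the path. Paths have fixed length and end anywhere on the
-- diagonal, so a corner also arises at the free end: `last` removes the cell next to the diagonal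
-- there.
data Flip : ∀ {m} → Word m → Word m → Set where
  last : Flip (true ∷ []) (false ∷ [])
  swap : ∀ {m} {w : Word m} → Flip (true ∷ false ∷ w) (false ∷ true ∷ w)
  cons : ∀ {m} {w w′ : Word m} x → Flip w w′ → Flip (x ∷ w) (x ∷ w′)

AddsCell : ∀ {m} (a : ℕ) (w w′ : Word m) (r c : ℕ) → Set
AddsCell a w w′ r c = Cell a w r c × ¬ Cell a w′ r c × (∀ {i j} → Cell a w′ i j → Cell a w i j) ×
  (∀ {i j} → Cell a w i j → Cell a w′ i j ⊎ (i ≡ r × j ≡ c))

flip⇒addsCell : ∀ {m} a {w w′ : Word m} → Flip w w′ → ∃ λ r → ∃ λ c → AddsCell a w w′ r c
flip⇒addsCell a last = a , a + 1 , corner a [] , (λ ()) , (λ ()) ,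
  λ { {j = j} (inj₁ (refl , a<j , j≤)) → inj₂ (refl , ℕP.≤-antisym j≤ (subst (_≤ j) (ℕP.+-comm 1 a) a<j)) }
flip⇒addsCell a {true ∷ false ∷ w} (swap {m}) = a , a + suc (suc m) , corner a (false ∷ w) , no-corner a (true ∷ w) , sub , only
  where
  sub : ∀ {i j} → Cell a (false ∷ true ∷ w) i j → Cell a (true ∷ false ∷ w) i j
  sub (inj₁ (refl , a<j , j≤)) = inj₁ (refl , a<j , ℕP.≤-trans j≤ (ℕP.+-monoʳ-≤ a (ℕP.n≤1+n _)))
  sub (inj₂ c) = inj₂ c
  only : ∀ {i j} → Cell a (true ∷ false ∷ w) i j → Cell a (false ∷ true ∷ w) i j ⊎ (i ≡ a × j ≡ a + suc (suc m))
  only (inj₂ c) = inj₁ (inj₂ c)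
  only (inj₁ (refl , a<j , j≤)) with ℕP.m≤n⇒m<n∨m≡n j≤
  ... | inj₂ j≡ = inj₂ (refl , j≡)
  ... | inj₁ j< = inj₁ (inj₁ (refl , a<j , s≤s⁻¹ (≤-pull a (suc m) j<)))
flip⇒addsCell a (cons false f) = flip⇒addsCell a f
flip⇒addsCell a (cons {w = w} {w′} true f) with flip⇒addsCell (suc a) f
... | r , c , inside , outside , sub , only = r , c , inj₂ inside , notIn , (λ { (inj₁ p) → inj₁ p ; (inj₂ p) → inj₂ (sub p) }) , only′
  where
  notIn : ¬ Cell a (true ∷ w′) r c
  notIn (inj₁ (refl , _)) = row-not-below a w inside
  notIn (inj₂ p) = outside p
  only′ : ∀ {i j} → Cell a (true ∷ w) i j → Cell a (true ∷ w′) i j ⊎ (i ≡ r × j ≡ c)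
  only′ (inj₁ p) = inj₁ (inj₁ p)
  only′ (inj₂ p) with only p
  ... | inj₁ q = inj₁ (inj₂ q)
  ... | inj₂ q = inj₂ q

-- Equal first letters are stripped. Where the words first differ, the corner cell itself is the
-- extra one; everything else must agree, which leaves only a swap or the last letter.
addsCell⇒flip : ∀ {m} a {w w′ : Word m} {r c} → AddsCell a w w′ r c → Flip w w′
addsCell⇒flip a {[]} {[]} (() , _)
addsCell⇒flip a {false ∷ w} {false ∷ w′} d = cons false (addsCell⇒flip a d)
addsCell⇒flip a {false ∷ w} {true ∷ w′} (_ , _ , sub , _) = ⊥-elim (no-corner a w (sub (corner a w′)))
addsCell⇒flip a {true ∷ w} {true ∷ w′} {r} {c} (inj₁ p , notIn , _) = ⊥-elim (notIn (inj₁ p))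
addsCell⇒flip a {true ∷ w} {true ∷ w′} {r} {c} (inj₂ p , notIn , sub , only) =
  cons true (addsCell⇒flip (suc a) {w} {w′} (p , (λ q → notIn (inj₂ q)) , sub′ , only′))
  where
  sub′ : ∀ {i j} → Cell (suc a) w′ i j → Cell (suc a) w i j
  sub′ q with sub (inj₂ q)
  ... | inj₂ q′ = q′
  ... | inj₁ (refl , _) = ⊥-elim (row-not-below a w′ q)
  only′ : ∀ {i j} → Cell (suc a) w i j → Cell (suc a) w′ i j ⊎ (i ≡ r × j ≡ c)
  only′ q with only (inj₂ q)
  ... | inj₂ eq = inj₂ eq
  ... | inj₁ (inj₂ q′) = inj₁ q′
  ... | inj₁ (inj₁ (refl , _)) = ⊥-elim (row-not-below a w q)
addsCell⇒flip a {true ∷ []} {false ∷ []} _ = last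
-- Two leading steps `false` would discard two columns, hence two cells of row a at once.
addsCell⇒flip {suc (suc m)} a {true ∷ w} {false ∷ false ∷ w′} (_ , _ , _ , only)
  with only (corner a w) | only {a} {a + suc m} (inj₁ (refl , ℕP.m<m+n a (s≤s z≤n) , ℕP.+-monoʳ-≤ a (ℕP.n≤1+n _)))
... | inj₁ p | _ = ⊥-elim (no-corner a (false ∷ w′) p)
... | inj₂ _ | inj₁ p = ⊥-elim (no-corner a w′ p)
... | inj₂ (_ , eq) | inj₂ (_ , eq′) = ⊥-elim (ℕP.1+n≢n (ℕP.+-cancelˡ-≡ a _ _ (trans eq (sym eq′))))
addsCell⇒flip {suc (suc m)} a {true ∷ w} {false ∷ true ∷ w′} {r} {c} (_ , _ , sub , only)
  with cells-injective (suc a) w (false ∷ w′) to from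
  where
  r≡a : r ≡ a
  r≡a with only (corner a w)
  ... | inj₁ p = ⊥-elim (no-corner a (true ∷ w′) p)
  ... | inj₂ (eq , _) = sym eq
  to : ∀ {i j} → Cell (suc a) w i j → Cell (suc a) w′ i j
  to q with only (inj₂ q)
  ... | inj₁ (inj₂ q′) = q′
  ... | inj₁ (inj₁ (refl , _)) = ⊥-elim (row-not-below a w q)
  ... | inj₂ (refl , _) = ⊥-elim (row-not-below a w (subst (λ r → Cell (suc a) w r _) r≡a q))
  from : ∀ {i j} → Cell (suc a) w′ i j → Cell (suc a) w i j
  from q with sub (inj₂ q)
  ... | inj₂ q′ = q′
  ... | inj₁ (refl , _) = ⊥-elim (row-not-below a w′ q)
... | refl = swap

-- The path is found greedily at the corner (a , a + m). If `P` holds there, it holds on the whole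
-- row a, which can be split off; if not, it fails on the whole last column. Closure is assumed
-- inside the triangle only, as is needed for the smaller triangle of a wing.
boundary : ∀ m a (P : ℕ → ℕ → Set) → (∀ i j → Dec (P i j)) →
  (∀ {i j i′ j′} → P i j → a ≤ i′ → i′ ≤ i → i′ < j′ → j′ ≤ j → i < j → j ≤ a + m → P i′ j′) →
  ∃ λ (w : Word m) → (∀ {i j} → Cell a w i j → P i j) × (∀ {i j} → P i j → a ≤ i → i < j → j ≤ a + m → Cell a w i j)
boundary zero a P P? up = [] , (λ ()) , λ p a≤i i<j j≤ →
  ⊥-elim (ℕP.<-irrefl refl (ℕP.<-≤-trans (ℕP.≤-<-trans a≤i i<j) (ℕP.≤-trans j≤ (ℕP.≤-reflexive (ℕP.+-identityʳ a)))))
boundary (suc m) a P P? up with P? a (a + suc m)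
... | yes p = let (w , to , from) = boundary m (suc a) P P?
                    (λ q a<i′ i′≤i i′<j′ j′≤j i<j j≤ → up q (ℕP.<⇒≤ a<i′) i′≤i i′<j′ j′≤j i<j (≤-push a m j≤)) in
  true ∷ w , (λ { (inj₁ (refl , a<j , j≤)) → up p ℕP.≤-refl ℕP.≤-refl a<j j≤ (ℕP.m<m+n a (s≤s z≤n)) ℕP.≤-refl ; (inj₂ c) → to c }) ,
  λ {i} {j} q a≤i i<j j≤ → case {w} from q a≤i i<j j≤
  where
  case : ∀ {w : Word m} → (∀ {i j} → P i j → suc a ≤ i → i < j → j ≤ suc a + m → Cell (suc a) w i j) →
    ∀ {i j} → P i j → a ≤ i → i < j → j ≤ a + suc m → Cell a (true ∷ w) i j
  case from q a≤i i<j j≤ with ℕP.m≤n⇒m<n∨m≡n a≤i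
  ... | inj₂ refl = inj₁ (refl , i<j , j≤)
  ... | inj₁ a<i = inj₂ (from q a<i i<j (≤-pull a m j≤))
... | no ¬p = let (w , to , from) = boundary m a P P?
                    (λ q a≤i′ i′≤i i′<j′ j′≤j i<j j≤ →
                      up q a≤i′ i′≤i i′<j′ j′≤j i<j (ℕP.≤-trans j≤ (ℕP.+-monoʳ-≤ a (ℕP.n≤1+n m)))) in
  false ∷ w , to , λ q a≤i i<j j≤ → from q a≤i i<j (drop q a≤i i<j j≤)
  where
  drop : ∀ {i j} → P i j → a ≤ i → i < j → j ≤ a + suc m → j ≤ a + m
  drop q a≤i i<j j≤ with ℕP.m≤n⇒m<n∨m≡n j≤
  ... | inj₁ j< = s≤s⁻¹ (≤-pull a m j<)
  ... | inj₂ refl = ⊥-elim (¬p (up q ℕP.≤-refl a≤i (ℕP.m<m+n a (s≤s z≤n)) ℕP.≤-refl i<j ℕP.≤-refl))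

-- The root order

-- The weight ε_0 + ... + ε_{k-1}, one of the test weights for the root order.
step : ℕ → ℕ → ℤ
step k l with l ℕ.<? k
... | yes _ = + 1
... | no _ = + 0

step-view : ∀ k l → (l < k × step k l ≡ + 1) ⊎ (k ≤ l × step k l ≡ + 0)
step-view k l with l ℕ.<? k
... | yes l<k = inj₁ (l<k , refl)
... | no l≮k = inj₂ (ℕP.≮⇒≥ l≮k , refl)

step-below : ∀ {k l} → l < k → step k l ≡ + 1
step-below {k} {l} l<k with step-view k l
... | inj₁ (_ , eq) = eq
... | inj₂ (k≤l , _) = ⊥-elim (ℕP.<⇒≱ l<k k≤l)

step-above : ∀ {k l} → k ≤ l → step k l ≡ + 0
step-above {k} {l} k≤l with step-view k l
... | inj₂ (_ , eq) = eq
... | inj₁ (l<k , _) = ⊥-elim (ℕP.<⇒≱ l<k k≤l)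

descend : ∀ {Q : ℕ → Set} {i′ i} → i′ ≤ i → (∀ k → i′ ≤ k → k < i → Q (suc k) → Q k) → Q i → Q i′
descend {Q} {i′} {i} le = go (ℕP.≤⇒≤′ le)
  where
  go : ∀ {i} → i′ ℕ.≤′ i → (∀ k → i′ ≤ k → k < i → Q (suc k) → Q k) → Q i → Q i′
  go ℕ.≤′-refl _ q = q
  go (ℕ.≤′-step {n = k} le) st q =
    go le (λ k′ a b → st k′ a (ℕP.m≤n⇒m≤1+n b)) (st k (ℕP.≤′⇒≤ le) ℕP.≤-refl q)

ascend : ∀ {Q : ℕ → Set} {i i′} → i ≤ i′ → (∀ k → i ≤ k → k < i′ → Q k → Q (suc k)) → Q i → Q i′
ascend {Q} {i} le = go (ℕP.≤⇒≤′ le)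
  where
  go : ∀ {i′} → i ℕ.≤′ i′ → (∀ k → i ≤ k → k < i′ → Q k → Q (suc k)) → Q i → Q i′
  go ℕ.≤′-refl _ q = q
  go (ℕ.≤′-step {n = k} le) st q =
    st k (ℕP.≤′⇒≤ le) ℕP.≤-refl (go le (λ k′ a b → st k′ a (ℕP.m≤n⇒m≤1+n b)) q)

least : ∀ {P : ℕ → Set} → (∀ k → Dec (P k)) → ∀ k → P k → ∃ λ u → u ≤ k × P u × (∀ v → v < u → ¬ P v)
least P? zero p = 0 , z≤n , p , λ _ ()
least P? (suc k) p with P? 0
... | yes p₀ = 0 , z≤n , p₀ , λ _ ()
... | no ¬p₀ with least (λ v → P? (suc v)) k p
...   | u , u≤k , pu , min = suc u , s≤s u≤k , pu , λ { zero _ → ¬p₀ ; (suc v) (s≤s v<u) → min v v<u }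

module Roots (p : ℕ) where
  n N : ℕ
  n = 3 ℕ.+ p
  N = 2 ℕ.+ p

  open Ideals n public

  -- With s = false the sign of the last coordinate is reversed, which is an automorphism of the root system.
  colSign : Bool → ℕ → Bool
  colSign s j with j ℕ.≟ N
  ... | yes _ = s
  ... | no _ = true

  colSign-N : ∀ s → colSign s N ≡ s
  colSign-N s with N ℕ.≟ N
  ... | yes _ = refl
  ... | no ≢ = ⊥-elim (≢ refl)

  colSign-< : ∀ s {j} → j < N → colSign s j ≡ true
  colSign-< s {j} j<N with j ℕ.≟ N
  ... | no _ = refl
  ... | yes refl = ⊥-elim (ℕP.<-irrefl refl j<N)

  colSign-true : ∀ j → colSign true j ≡ true
  colSign-true j with j ℕ.≟ N
  ... | yes _ = refl
  ... | no _ = refl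

  -- Twice a half-spin weight. On positive roots it is 2 where the sign agrees with `colSign s` and
  -- 0 elsewhere.
  ends : Bool → ℕ → ℤ
  ends s l = signed (colSign s l) (+ 1)

  Dominant : (ℕ → ℤ) → Set
  Dominant w = (∀ k → suc k < n → w (suc k) ℤ.≤ w k) × (+ 0 ℤ.≤ w (suc p) ℤ.+ w N)

  simple-dominant : ∀ {w α} → Dominant w → α ∈ simpleRoots n → + 0 ℤ.≤ dot w α
  simple-dominant {w} (dec , nonneg) α∈ with simpleRoots⁻ α∈
  ... | inj₁ (k , k< , refl) = subst (+ 0 ℤ.≤_) (sym (dot-root {n} w false (ℕP.<-trans (ℕP.n<1+n k) k<) k<)) (ℤP.i≤j⇒0≤j-i (dec k k<))
  ... | inj₂ (lt , lt′ , refl) = subst (+ 0 ℤ.≤_) (sym (dot-root {n} w true (ℕP.<-trans lt lt′) lt′)) nonneg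

  step-dominant : ∀ k → Dominant (step k)
  step-dominant k = (λ l _ → dec l) , nonneg
    where
    dec : ∀ l → step k (suc l) ℤ.≤ step k l
    dec l with step-view k (suc l) | step-view k l
    ... | inj₁ (l< , eq) | _ rewrite eq | step-below (ℕP.<-trans (ℕP.n<1+n l) l<) = ℤP.≤-refl
    ... | inj₂ (_ , eq) | inj₁ (_ , eq′) rewrite eq | eq′ = +≤+ z≤n
    ... | inj₂ (_ , eq) | inj₂ (_ , eq′) rewrite eq | eq′ = ℤP.≤-refl
    nonneg : + 0 ℤ.≤ step k (suc p) ℤ.+ step k N
    nonneg with step-view k (suc p) | step-view k N
    ... | inj₁ (_ , eq) | inj₁ (_ , eq′) rewrite eq | eq′ = +≤+ z≤n
    ... | inj₁ (_ , eq) | inj₂ (_ , eq′) rewrite eq | eq′ = +≤+ z≤n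
    ... | inj₂ (_ , eq) | inj₁ (_ , eq′) rewrite eq | eq′ = +≤+ z≤n
    ... | inj₂ (_ , eq) | inj₂ (_ , eq′) rewrite eq | eq′ = +≤+ z≤n

  ends-dominant : ∀ s → Dominant (ends s)
  ends-dominant s = dec , nonneg
    where
    dec : ∀ k → suc k < n → ends s (suc k) ℤ.≤ ends s k
    dec k (s≤s k<N) rewrite colSign-< s k<N with colSign s (suc k)
    ... | true = ℤP.≤-refl
    ... | false = -≤+
    nonneg : + 0 ℤ.≤ ends s (suc p) ℤ.+ ends s N
    nonneg rewrite colSign-< s (ℕP.n<1+n (suc p)) with colSign s N
    ... | true = +≤+ z≤n
    ... | false = +≤+ z≤n

  IsRootₙ : ℕ → ℕ → Set
  IsRootₙ = IsRoot n

  dot-rootₙ : ∀ w σ {i j} → IsRootₙ i j → dot {n} w (root σ i j) ≡ w i ℤ.+ signed σ (w j)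
  dot-rootₙ w σ (i<j , j<n) = dot-root {n} w σ (ℕP.<-trans i<j j<n) j<n

  -- Stands in for the root order: it holds whenever a simple root is added, and well-chosen weights
  -- `w` turn it into comparisons of indices and signs.
  record _≼_ (μ δ : Vecℤ n) : Set where
    constructor dominated
    field dot-≤ : ∀ w → Dominant w → dot w μ ℤ.≤ dot w δ
  open _≼_ public

  +simple-≼ : ∀ {μ α} → α ∈ simpleRoots n → μ ≼ (μ +ᵥ α)
  +simple-≼ {μ} {α} α∈ = dominated λ w dom → subst₂ ℤ._≤_ (ℤP.+-identityʳ _) (sym (dot-+ {n} w μ α))
    (ℤP.+-monoʳ-≤ (dot w μ) (simple-dominant {w} dom α∈))

  ≼-reflexive : ∀ {μ δ} → μ ≡ δ → μ ≼ δ
  ≼-reflexive refl = dominated λ _ _ → ℤP.≤-refl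

  ≼-dot : ∀ σ σ′ {i j i′ j′} → IsRootₙ i j → IsRootₙ i′ j′ → root σ i j ≼ root σ′ i′ j′ →
    ∀ w → Dominant w → w i ℤ.+ signed σ (w j) ℤ.≤ w i′ ℤ.+ signed σ′ (w j′)
  ≼-dot σ σ′ r r′ le w dom = subst₂ ℤ._≤_ (dot-rootₙ w σ r) (dot-rootₙ w σ′ r′) (dot-≤ le w dom)

  -- The weight `step (suc i)` is 1 at i and 0 at every column j > i, so it does not see the sign.
  -- It would vanish on the larger root if i < i′.
  ≼-row : ∀ σ σ′ {i j i′ j′} → IsRootₙ i j → IsRootₙ i′ j′ → root σ i j ≼ root σ′ i′ j′ → i′ ≤ i
  ≼-row σ σ′ {i} {j} {i′} {j′} r r′ le with i′ ℕ.≤? i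
  ... | yes i′≤i = i′≤i
  ... | no i′≰i = ⊥-elim (absurd σ σ′ (subst₂ ℤ._≤_
      (cong₂ (λ x y → x ℤ.+ signed σ y) (step-below (ℕP.n<1+n i)) (step-above (proj₁ r)))
      (cong₂ (λ x y → x ℤ.+ signed σ′ y) (step-above i<i′) (step-above (ℕP.<⇒≤ (ℕP.≤-<-trans i<i′ (proj₁ r′)))))
      (≼-dot σ σ′ r r′ le (step (suc i)) (step-dominant (suc i)))))
    where
    i<i′ = ℕP.≰⇒> i′≰i
    absurd : ∀ σ σ′ → + 1 ℤ.+ signed σ (+ 0) ℤ.≤ + 0 ℤ.+ signed σ′ (+ 0) → ⊥
    absurd true true (+≤+ ())
    absurd true false (+≤+ ())
    absurd false true (+≤+ ())
    absurd false false (+≤+ ())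

  ends-< : ∀ s {i} → i < N → ends s i ≡ + 1
  ends-< s i<N = cong (λ b → signed b (+ 1)) (colSign-< s i<N)

  signed-involutive : ∀ b x → signed b (signed b x) ≡ x
  signed-involutive true x = refl
  signed-involutive false x = ℤP.neg-involutive x

  row<N : ∀ {i j} → IsRootₙ i j → i < N
  row<N (i<j , s≤s j≤N) = ℕP.<-≤-trans i<j j≤N

  -- The weight `ends s` already has its largest value 2 on the smaller root, so the larger one must
  -- reach 2 as well.
  ≼-sign : ∀ s σ′ {i j i′ j′} → IsRootₙ i j → IsRootₙ i′ j′ → root (colSign s j) i j ≼ root σ′ i′ j′ → σ′ ≡ colSign s j′
  ≼-sign s σ′ {i} {j} {i′} {j′} r r′ le = agree σ′ (colSign s j′) (subst₂ ℤ._≤_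
      (cong₂ ℤ._+_ (ends-< s (row<N r)) (signed-involutive (colSign s j) (+ 1)))
      (cong (ℤ._+ signed σ′ (ends s j′)) (ends-< s (row<N r′)))
      (≼-dot (colSign s j) σ′ r r′ le (ends s) (ends-dominant s)))
    where
    agree : ∀ a b → + 1 ℤ.+ + 1 ℤ.≤ + 1 ℤ.+ signed a (signed b (+ 1)) → a ≡ b
    agree true true _ = refl
    agree false false _ = refl
    agree true false (+≤+ ())
    agree false true (+≤+ ())

  ≼-plus : ∀ σ′ {i j i′ j′} → IsRootₙ i j → IsRootₙ i′ j′ → root true i j ≼ root σ′ i′ j′ → σ′ ≡ true
  ≼-plus σ′ {i} {j} {i′} {j′} r r′ le =
    trans (≼-sign true σ′ r r′ (subst (λ b → root b i j ≼ root σ′ i′ j′) (sym (colSign-true j)) le)) (colSign-true j′)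

  -- The weight `step (suc j)` is 2 on ε_i + ε_j, but at most 1 on a sum whose column lies beyond j.
  ≼-column⁺ : ∀ {i j i′ j′} → IsRootₙ i j → IsRootₙ i′ j′ → root true i j ≼ root true i′ j′ → j′ ≤ j
  ≼-column⁺ {i} {j} {i′} {j′} r r′ le with step-view (suc j) i′ | step-view (suc j) j′
      | ≼-dot true true r r′ le (step (suc j)) (step-dominant (suc j))
  ... | _ | inj₁ (j′<j+1 , _) | _ = s≤s⁻¹ j′<j+1
  ... | inj₁ (_ , eq) | inj₂ (_ , eq′) | h
    rewrite eq | eq′ | step-below (ℕP.m≤n⇒m≤1+n (proj₁ r)) | step-below (ℕP.n<1+n j) with +≤+ (s≤s ()) ← h
  ... | inj₂ (_ , eq) | inj₂ (_ , eq′) | h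
    rewrite eq | eq′ | step-below (ℕP.m≤n⇒m≤1+n (proj₁ r)) | step-below (ℕP.n<1+n j) with +≤+ () ← h

  -- The weight `step j` is 1 on ε_i - ε_j, but at most 0 on a difference whose column lies before
  -- j.
  ≼-column⁻ : ∀ {i j i′ j′} → IsRootₙ i j → IsRootₙ i′ j′ → root false i j ≼ root false i′ j′ → j ≤ j′
  ≼-column⁻ {i} {j} {i′} {j′} r r′ le with step-view j i′ | step-view j j′
      | ≼-dot false false r r′ le (step j) (step-dominant j)
  ... | _ | inj₂ (j≤j′ , _) | _ = j≤j′
  ... | inj₁ (_ , eq) | inj₁ (_ , eq′) | h
    rewrite eq | eq′ | step-below (proj₁ r) | step-above (ℕP.≤-refl {j}) with +≤+ () ← h
  ... | inj₂ (_ , eq) | inj₁ (_ , eq′) | h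
    rewrite eq | eq′ | step-below (proj₁ r) | step-above (ℕP.≤-refl {j}) with () ← h

  -- Equal vectors are comparable in both directions, so the comparisons above and antisymmetry of ≤
  -- recover the indices.
  root-injective : ∀ σ σ′ {i j i′ j′} → IsRootₙ i j → IsRootₙ i′ j′ → root {n} σ i j ≡ root σ′ i′ j′ →
    σ ≡ σ′ × i ≡ i′ × j ≡ j′
  root-injective true true r r′ eq =
    refl , ℕP.≤-antisym (≼-row true true r′ r (≼-reflexive (sym eq))) (≼-row true true r r′ (≼-reflexive eq)) ,
    ℕP.≤-antisym (≼-column⁺ r′ r (≼-reflexive (sym eq))) (≼-column⁺ r r′ (≼-reflexive eq))
  root-injective false false r r′ eq =
    refl , ℕP.≤-antisym (≼-row false false r′ r (≼-reflexive (sym eq))) (≼-row false false r r′ (≼-reflexive eq)) ,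
    ℕP.≤-antisym (≼-column⁻ r r′ (≼-reflexive eq)) (≼-column⁻ r′ r (≼-reflexive (sym eq)))
  root-injective true false r r′ eq with () ← ≼-plus false r r′ (≼-reflexive eq)
  root-injective false true r r′ eq with () ← ≼-plus false r′ r (≼-reflexive (sym eq))

  Δ⁺-unique : Unique Δ⁺
  Δ⁺-unique = unique-concatMap pairRoots (pairs-unique n) each disjoint
    where
    open import Data.Fin using (toℕ)
    import Data.Fin.Properties as FinP
    isRoot : ∀ {q} → q ∈ pairs n → IsRootₙ (toℕ (proj₁ q)) (toℕ (proj₂ q))
    isRoot {q} q∈ = ∈-pairs⁻ q∈ , FinP.toℕ<n (proj₂ q)
    each : ∀ {q} → q ∈ pairs n → Unique (pairRoots q)
    each {i , j} q∈ = ((λ eq → absurd (trans (sym (cong₂ _-ᵥ_ (ε≡e i) (ε≡e j))) (trans eq (cong₂ _+ᵥ_ (ε≡e i) (ε≡e j))))) ∷ []) ∷ [] ∷ []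
      where
      absurd : root {n} false (toℕ i) (toℕ j) ≡ root true (toℕ i) (toℕ j) → ⊥
      absurd eq with () ← proj₁ (root-injective false true (isRoot q∈) (isRoot q∈) eq)
    disjoint : ∀ {q q′ v} → q ∈ pairs n → q′ ∈ pairs n → v ∈ pairRoots q → v ∈ pairRoots q′ → q ≡ q′
    disjoint q∈ q′∈ v∈ v∈′ with ∈-pairRoots⁻ v∈ | ∈-pairRoots⁻ v∈′
    ... | σ , eq | σ′ , eq′ with root-injective σ σ′ (isRoot q∈) (isRoot q′∈) (trans (sym eq) eq′)
    ... | _ , i≡ , j≡ = cong₂ _,_ (FinP.toℕ-injective i≡) (FinP.toℕ-injective j≡)

  Ab-unique : Unique Ab
  Ab-unique = Uniq.filter⁺ _ (subsets-unique Δ⁺-unique)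

  Ab-ext : ∀ {I J} → I ∈ Ab → J ∈ Ab → (∀ {v} → v ∈ I → v ∈ J) → (∀ {v} → v ∈ J → v ∈ I) → I ≡ J
  Ab-ext I∈ J∈ = subsets-ext Δ⁺-unique (proj₁ (Ab⁻ I∈)) (proj₁ (Ab⁻ J∈))

  module UpperIdeal {I : List (Vecℤ n)} (upper : IsUpper I) where

    raise : ∀ σ i j α σ′ {i′ j′} → root σ i j ∈ I → α ∈ simpleRoots n → root σ i j +ᵥ α ≡ root σ′ i′ j′ →
      IsRootₙ i′ j′ → root σ′ i′ j′ ∈ I
    raise σ i j α σ′ r∈ α∈ eq r′ = subst (_∈ I) eq
      (All.lookup (All.lookup upper r∈) α∈ (subst (_∈ Δ⁺) (sym eq) (root∈posRoots σ′ r′)))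

    raise-row : ∀ σ {i i′ j} → i′ ≤ i → IsRootₙ i j → root σ i j ∈ I → root σ i′ j ∈ I
    raise-row σ {i} {i′} {j} i′≤i (i<j , j<n) = descend {λ i → root σ i j ∈ I} i′≤i
      λ k _ k<i r∈ → raise σ (suc k) j (root false k (suc k)) σ r∈ (simple-diff (ℕP.≤-<-trans k<i (ℕP.<-trans i<j j<n)))
        (raise-first {n} σ (suc k) j k) (ℕP.<-trans k<i i<j , j<n)

    raise-column⁺ : ∀ {i j j′} → i < j′ → j′ ≤ j → j < n → root true i j ∈ I → root true i j′ ∈ I
    raise-column⁺ {i} {j} {j′} i<j′ j′≤j j<n = descend {λ j → root true i j ∈ I} j′≤j
      λ k j′≤k k<j r∈ → raise true i (suc k) (root false k (suc k)) true r∈ (simple-diff (ℕP.≤-<-trans k<j j<n))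
        (raise-second {n} i (suc k) k) (ℕP.<-≤-trans i<j′ j′≤k , ℕP.<-trans k<j j<n)

    raise-column⁻ : ∀ {i j j′} → i < j → j ≤ j′ → j′ < n → root false i j ∈ I → root false i j′ ∈ I
    raise-column⁻ {i} {j} {j′} i<j j≤j′ j′<n = ascend {λ j → root false i j ∈ I} j≤j′
      λ k j≤k k<j′ r∈ → raise false i k (root false k (suc k)) false r∈ (simple-diff (ℕP.≤-<-trans k<j′ j′<n))
        (raise-second⁻ {n} i k (suc k)) (ℕP.≤-trans (ℕP.<-≤-trans i<j j≤k) (ℕP.n≤1+n k) , ℕP.≤-<-trans k<j′ j′<n)

    α-last : root true (suc p) N ∈ simpleRoots n
    α-last = simple-sum {n} (ℕP.n<1+n (suc p)) (ℕP.n<1+n N)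

    -- The fork of the diagram: adding ε_{N-1} + ε_N changes -ε_N into ε_{N-1}, and in `turn′` it
    -- changes -ε_{N-1} into ε_N.
    turn : ∀ {i} → i < suc p → root false i N ∈ I → root true i (suc p) ∈ I
    turn {i} i< r∈ = raise false i N (root true (suc p) N) true r∈ α-last (cancel-second {n} i N (suc p))
      (i< , ℕP.m<n⇒m<1+n (ℕP.n<1+n (suc p)))

    turn′ : ∀ {i} → i < suc p → root false i (suc p) ∈ I → root true i N ∈ I
    turn′ {i} i< r∈ = raise false i (suc p) (root true N (suc p)) true r∈
      (subst (_∈ simpleRoots n) (root-comm {n} (suc p) N) α-last)
      (cancel-second {n} i (suc p) N) (ℕP.m<n⇒m<1+n i< , ℕP.n<1+n N)

-- Classification of the abelian ideals

module Codes (p : ℕ) where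
  open Roots p public
  open Mem n using (_∈?_)

  -- Row i consists of the roots ε_i ± ε_j with j > i. The code low w stands for an ideal with neither of
  -- ε_0 ± ε_N, high s w for one with exactly one of them (the plus sign when s = true), and wing u w for one with
  -- both, in which row 0 ends at ε_0 − ε_{u+1}; the word bounds the remaining roots ε_i + ε_j.
  data Code : Set where
    low  : Word (suc p) → Code
    high : Bool → Word (suc p) → Code
    wing : ∀ u → Word (pred u) → Code

  -- An up-set in one of the two abelian nilradicals of the fork: all sums ε_i + ε_j, or their
  -- images when the sign of ε_N is reversed.
  Strict : Bool → Word N → Bool → ℕ → ℕ → Set
  Strict s w σ i j = σ ≡ colSign s j × Cell 0 w i j

  -- A word of length `pred u` based at 1 spans the indices 1, ..., u. For u = 0 and u = 1 there is
  -- no cell to describe, and the word is empty in both cases.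
  Wing : ∀ u → Word (pred u) → Bool → ℕ → ℕ → Set
  Wing u w σ i j = (i ≡ 0 × (σ ≡ true ⊎ u < j)) ⊎ (σ ≡ true × Cell 1 w i j)

  ⟦_⟧ : Code → Bool → ℕ → ℕ → Set
  ⟦ low w ⟧ = Strict true (false ∷ w)
  ⟦ high s w ⟧ = Strict s (true ∷ w)
  ⟦ wing u w ⟧ = Wing u w

  ⟦_⟧? : ∀ c σ i j → Dec (⟦ c ⟧ σ i j)
  ⟦ low w ⟧? σ i j = (σ ≟ᵇ colSign true j) ×-dec cell? 0 (false ∷ w) i j
  ⟦ high s w ⟧? σ i j = (σ ≟ᵇ colSign s j) ×-dec cell? 0 (true ∷ w) i j
  ⟦ wing u w ⟧? σ i j = (i ℕ.≟ 0 ×-dec (σ ≟ᵇ true ⊎-dec u ℕ.<? j)) ⊎-dec (σ ≟ᵇ true ×-dec cell? 1 w i j)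

  -- For a wing the bound says u < N, that is, ε_0 - ε_N is present.
  Valid : Code → Set
  Valid (low _) = ⊤
  Valid (high _ _) = ⊤
  Valid (wing u _) = u ≤ suc p

  Matches : List (Vecℤ n) → (Bool → ℕ → ℕ → Set) → Set
  Matches I X = ∀ σ i j → IsRootₙ i j → (root σ i j ∈ I → X σ i j) × (X σ i j → root σ i j ∈ I)

  column-view : ∀ {i j} → IsRootₙ i j → j < N ⊎ j ≡ N
  column-view (_ , s≤s j≤N) = ℕP.m≤n⇒m<n∨m≡n j≤N

  cell-isRoot : ∀ (w : Word N) {i j} → Cell 0 w i j → IsRootₙ i j
  cell-isRoot w c = let (_ , i<j , j≤N) = cell-bounds 0 w c in i<j , s≤s j≤N

  -- The leading `false` discards column N, the only column where `s` is visible. This is why `low`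
  -- carries no sign.
  low-sign : ∀ s (w : Word (suc p)) {σ i j} → Strict true (false ∷ w) σ i j → Strict s (false ∷ w) σ i j
  low-sign s w {j = j} (refl , c) =
    trans (colSign-true j) (sym (colSign-< s (s≤s (proj₂ (proj₂ (cell-bounds 0 w c)))))) , c

  low-unsign : ∀ s (w : Word (suc p)) {σ i j} → Strict s (false ∷ w) σ i j → Strict true (false ∷ w) σ i j
  low-unsign s w {j = j} (refl , c) =
    trans (colSign-< s (s≤s (proj₂ (proj₂ (cell-bounds 0 w c))))) (sym (colSign-true j)) , c

  module _ {I : List (Vecℤ n)} (upper : IsUpper I) where
    open UpperIdeal upper

    strict-upward : ∀ s {i j i′ j′} → i′ ≤ i → i′ < j′ → j′ ≤ j → IsRootₙ i j →
      root (colSign s j) i j ∈ I → root (colSign s j′) i′ j′ ∈ I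
    strict-upward s {i} {j} {i′} {j′} i′≤i i′<j′ j′≤j r r∈₀ = go (ℕP.m≤n⇒m<n∨m≡n j′≤j) (column-view r)
      where
      r∈ : root (colSign s j) i′ j ∈ I
      r∈ = raise-row (colSign s j) i′≤i r r∈₀
      -- Column N is left by the simple root ε_{N-1} - ε_N or by ε_{N-1} + ε_N, depending on `s`;
      -- all further moves stay among sums.
      to-column : j′ < N → ∀ s → root s i′ N ∈ I → root true i′ (suc p) ∈ I
      to-column j′<N true = raise-column⁺ (ℕP.<-≤-trans i′<j′ (s≤s⁻¹ j′<N)) (ℕP.n≤1+n _) (ℕP.n<1+n N)
      to-column j′<N false = turn (ℕP.<-≤-trans i′<j′ (s≤s⁻¹ j′<N))
      go : j′ < j ⊎ j′ ≡ j → j < N ⊎ j ≡ N → root (colSign s j′) i′ j′ ∈ I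
      go (inj₂ refl) _ = r∈
      go (inj₁ j′<j) (inj₁ j<N) = subst (λ σ → root σ i′ j′ ∈ I) (sym (colSign-< s (ℕP.<-trans j′<j j<N)))
        (raise-column⁺ i′<j′ j′≤j (proj₂ r) (subst (λ σ → root σ i′ j ∈ I) (colSign-< s j<N) r∈))
      go (inj₁ j′<N) (inj₂ refl) = subst (λ σ → root σ i′ j′ ∈ I) (sym (colSign-< s j′<N))
        (raise-column⁺ i′<j′ (s≤s⁻¹ j′<N) (ℕP.m<n⇒m<1+n (ℕP.n<1+n (suc p)))
          (to-column j′<N s (subst (λ σ → root σ i′ N ∈ I) (colSign-N s) r∈)))

    -- Raising rows shows that the sign `not s` is missing from all of column N. A difference ε_i -
    -- ε_j with j < N would raise to both of ε_i ± ε_N, one of which is missing. So every column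
    -- carries a single sign, and `boundary` supplies the word.
    classify-strict : ∀ s → root (not s) 0 N ∉ I → ∃ λ w → Matches I (Strict s w)
    classify-strict s missing with boundary N 0 (λ i j → root (colSign s j) i j ∈ I) (λ i j → root (colSign s j) i j ∈? I)
      (λ r∈ _ i′≤i i′<j′ j′≤j i<j j≤N → strict-upward s i′≤i i′<j′ j′≤j (i<j , s≤s j≤N) r∈)
    ... | w , to , from = w , λ σ i j r →
          (λ r∈ → let eq = sign σ r r∈ in eq , from (subst (λ σ → root σ i j ∈ I) eq r∈) z≤n (proj₁ r) (s≤s⁻¹ (proj₂ r))) ,
          λ { (refl , c) → to c }
      where
      missing-row : ∀ {i} → IsRootₙ i N → root (not s) i N ∉ I
      missing-row r r∈ = missing (raise-row (not s) z≤n r r∈)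
      both : ∀ s {i} → root true i N ∈ I → root false i N ∈ I → root (not s) i N ∈ I
      both true _ b = b
      both false a _ = a
      sign-N : ∀ σ s → σ ≢ not s → σ ≡ s
      sign-N true true _ = refl
      sign-N false false _ = refl
      sign-N true false ne = ⊥-elim (ne refl)
      sign-N false true ne = ⊥-elim (ne refl)
      sign : ∀ σ {i j} → IsRootₙ i j → root σ i j ∈ I → σ ≡ colSign s j
      sign σ r r∈ with column-view r
      sign σ r r∈ | inj₂ refl = trans (sign-N σ s λ { refl → missing-row r r∈ }) (sym (colSign-N s))
      sign true r r∈ | inj₁ j<N = sym (colSign-< s j<N)
      sign false {i} {j} r r∈ | inj₁ j<N = ⊥-elim (missing-row rN (both s
          (turn′ i<p+1 (raise-column⁻ (proj₁ r) (s≤s⁻¹ j<N) (ℕP.m<n⇒m<1+n (ℕP.n<1+n (suc p))) r∈))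
          (raise-column⁻ (proj₁ r) (ℕP.<⇒≤ j<N) (ℕP.n<1+n N) r∈)))
        where
        i<p+1 : i < suc p
        i<p+1 = ℕP.<-≤-trans (proj₁ r) (s≤s⁻¹ j<N)
        rN : IsRootₙ i N
        rN = ℕP.m<n⇒m<1+n i<p+1 , ℕP.n<1+n N

    -- All sums of row 0 lie above ε_0 + ε_N, hence are present. For i ≥ 1, a difference ε_i - ε_j
    -- together with ε_0 + ε_j, or a sum ε_i + ε_j with j > u together with ε_0 - ε_j, would add up
    -- to the root ε_0 + ε_i. What remains below row 0 is a set of sums on the indices 1, ..., u.
    classify-wing : IsAbelian I → root true 0 N ∈ I → root false 0 N ∈ I →
      ∃ λ u → ∃ λ w → u ≤ suc p × Matches I (Wing u w)
    classify-wing abelian true∈ false∈ with least (λ v → root false 0 (suc v) ∈? I) (suc p) false∈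
    ... | u , u≤ , u∈ , min with boundary (pred u) 1 (λ i j → root true i j ∈ I) (λ i j → root true i j ∈? I)
      (λ {i} {j} r∈ _ i′≤i i′<j′ j′≤j i<j j≤ → raise-column⁺ i′<j′ j′≤j (s≤s (ℕP.≤-trans j≤ (s≤s (ℕP.≤-trans (ℕP.pred[n]≤n {u}) u≤))))
        (raise-row true i′≤i (i<j , s≤s (ℕP.≤-trans j≤ (s≤s (ℕP.≤-trans (ℕP.pred[n]≤n {u}) u≤)))) r∈))
    ... | w , to , from = u , w , u≤ , λ σ i j r → into σ i j r , outof σ i j r
      where
      no-sum : ∀ i k j {a b} → root false i j ∈ I → root true k j ∈ I →
        root {n} false i j +ᵥ root true k j ≡ root true a b → IsRootₙ a b → ⊥
      no-sum i k j a∈ b∈ eq r = All.lookup (All.lookup abelian a∈) b∈ (subst (_∈ Δ⁺) (sym eq) (root∈posRoots true r))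
      row⁺ : ∀ {j} → IsRootₙ 0 j → root true 0 j ∈ I
      row⁺ (0<j , s≤s j≤N) = raise-column⁺ 0<j j≤N (ℕP.n<1+n N) true∈
      row⁻ : ∀ {j} → u < j → j < n → root false 0 j ∈ I
      row⁻ u<j j<n = raise-column⁻ (s≤s z≤n) u<j j<n u∈
      bound : ∀ {i j} → IsRootₙ (suc i) j → root true (suc i) j ∈ I → j ≤ u
      bound {i} {j} r r∈ with u ℕ.<? j
      ... | no u≮j = ℕP.≮⇒≥ u≮j
      ... | yes u<j = ⊥-elim (no-sum 0 (suc i) j (row⁻ u<j (proj₂ r)) r∈ (cancel-second {n} 0 j (suc i))
                        (s≤s z≤n , ℕP.<-trans (proj₁ r) (proj₂ r)))
      positive : ∀ {v j} → suc j ≤ v → v ≡ suc (pred v)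
      positive (s≤s _) = refl
      into : ∀ σ i j → IsRootₙ i j → root σ i j ∈ I → Wing u w σ i j
      into true zero j r r∈ = inj₁ (refl , inj₁ refl)
      into true (suc i) j r@(i<j , _) r∈ = inj₂ (refl , from r∈ (s≤s z≤n) i<j
        (subst (j ≤_) (positive (ℕP.≤-trans i<j (bound r r∈))) (bound r r∈)))
      into false zero (suc v) r r∈ with u ℕ.<? suc v
      ... | yes u<j = inj₁ (refl , inj₂ u<j)
      ... | no u≮j = ⊥-elim (min v (ℕP.≮⇒≥ u≮j) r∈)
      into false (suc i) j (i<j , j<n) r∈ = ⊥-elim (no-sum (suc i) 0 j r∈ (row⁺ (ℕP.≤-<-trans z≤n i<j , j<n))
        (trans (cancel-second {n} (suc i) j 0) (root-comm {n} (suc i) 0)) (s≤s z≤n , ℕP.<-trans i<j j<n))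
      outof : ∀ σ i j → IsRootₙ i j → Wing u w σ i j → root σ i j ∈ I
      outof true i j r (inj₁ (refl , _)) = row⁺ r
      outof false i j r (inj₁ (refl , inj₂ u<j)) = row⁻ u<j (proj₂ r)
      outof σ i j r (inj₂ (refl , c)) = to c

  classify : ∀ {I} → I ∈ Ab → ∃ λ c → Valid c × Matches I ⟦ c ⟧
  classify {I} I∈ = go (Ab⁻ I∈) (root true 0 N ∈? I) (root false 0 N ∈? I)
    where
    strict : ∀ s → (∃ λ w → Matches I (Strict s w)) → ∃ λ c → Valid c × Matches I ⟦ c ⟧
    strict s (true ∷ w , m) = high s w , tt , m
    strict s (false ∷ w , m) = low w , tt , λ σ i j r →
      (λ r∈ → low-unsign s w (proj₁ (m σ i j r) r∈)) , (λ x → proj₂ (m σ i j r) (low-sign s w x))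
    go : I ∈ subsets Δ⁺ × IsUpper I × IsAbelian I → Dec (root true 0 N ∈ I) → Dec (root false 0 N ∈ I) →
      ∃ λ c → Valid c × Matches I ⟦ c ⟧
    go (_ , upper , abelian) (yes true∈) (yes false∈) =
      let (u , w , u≤ , m) = classify-wing upper abelian true∈ false∈ in wing u w , u≤ , m
    go (_ , upper , _) (no true∉) _ = strict false (classify-strict upper false true∉)
    go (_ , upper , _) (yes _) (no false∉) = strict true (classify-strict upper true false∉)

-- Every code describes an abelian ideal

module Decode (p : ℕ) where
  open Codes p public
  open Mem n using (_∈?_)

  strict-upward-closed : ∀ s w {σ σ′ i j i′ j′} → IsRootₙ i j → IsRootₙ i′ j′ →
    root σ i j ≼ root σ′ i′ j′ → Strict s w σ i j → Strict s w σ′ i′ j′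
  strict-upward-closed s w {σ′ = σ′} {i} {j} {i′} {j′} r r′ le (refl , c) =
    ≼-sign s σ′ r r′ le , cell-upward 0 w c z≤n (≼-row (colSign s j) σ′ r r′ le) (proj₁ r′) (column (column-view r))
    where
    -- From column N the bound is free. From an earlier column the root is a sum, everything above
    -- it is a sum, and columns of sums can be compared.
    column : j < N ⊎ j ≡ N → j′ ≤ j
    column (inj₂ refl) = s≤s⁻¹ (proj₂ r′)
    column (inj₁ j<N) = plus σ′ (≼-plus σ′ r r′ le′) le′
      where
      le′ : root true i j ≼ root σ′ i′ j′
      le′ = subst (λ σ → root σ i j ≼ root σ′ i′ j′) (colSign-< s j<N) le
      plus : ∀ σ′ → σ′ ≡ true → root true i j ≼ root σ′ i′ j′ → j′ ≤ j
      plus _ refl le = ≼-column⁺ r r′ le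

  wing-upward-closed : ∀ u w σ σ′ {i j i′ j′} → IsRootₙ i j → IsRootₙ i′ j′ →
    root σ i j ≼ root σ′ i′ j′ → Wing u w σ i j → Wing u w σ′ i′ j′
  wing-upward-closed u w σ true r r′ le (inj₁ (refl , _)) = inj₁ (ℕP.n≤0⇒n≡0 (≼-row σ true r r′ le) , inj₁ refl)
  wing-upward-closed u w true false r r′ le (inj₁ (refl , _)) with () ← ≼-plus false r r′ le
  wing-upward-closed u w false false r r′ le (inj₁ (refl , inj₂ u<j)) =
    inj₁ (ℕP.n≤0⇒n≡0 (≼-row false false r r′ le) , inj₂ (ℕP.<-≤-trans u<j (≼-column⁻ r r′ le)))
  wing-upward-closed u w true false r r′ le (inj₂ (refl , c)) with () ← ≼-plus false r r′ le
  wing-upward-closed u w true true {i′ = zero} r r′ le (inj₂ (refl , c)) = inj₁ (refl , inj₁ refl)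
  wing-upward-closed u w true true {i′ = suc _} r r′ le (inj₂ (refl , c)) =
    inj₂ (refl , cell-upward 1 w c (s≤s z≤n) (≼-row true true r r′ le) (proj₁ r′) (≼-column⁺ r r′ le))

  upward-closed : ∀ c σ σ′ {i j i′ j′} → IsRootₙ i j → IsRootₙ i′ j′ →
    root σ i j ≼ root σ′ i′ j′ → ⟦ c ⟧ σ i j → ⟦ c ⟧ σ′ i′ j′
  upward-closed (low w) σ σ′ r r′ le = strict-upward-closed true (false ∷ w) {σ} {σ′} r r′ le
  upward-closed (high s w) σ σ′ r r′ le = strict-upward-closed s (true ∷ w) {σ} {σ′} r r′ le
  upward-closed (wing u w) σ σ′ r r′ le = wing-upward-closed u w σ σ′ r r′ le

  -- A sum of two elements of X has weight at least 4, hence is not a root.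
  Separating : (Bool → ℕ → ℕ → Set) → (ℕ → ℤ) → Set
  Separating X w = (∀ σ i j → IsRootₙ i j → X σ i j → + 2 ℤ.≤ w i ℤ.+ signed σ (w j)) ×
                   (∀ σ i j → IsRootₙ i j → w i ℤ.+ signed σ (w j) ℤ.≤ + 3)

  strict-separating : ∀ s w → Separating (Strict s w) (ends s)
  strict-separating s w = lower , λ σ i j r → upper σ j (row<N r)
    where
    lower : ∀ σ i j → IsRootₙ i j → Strict s w σ i j → + 2 ℤ.≤ ends s i ℤ.+ signed σ (ends s j)
    lower σ i j r (refl , _) rewrite ends-< s (row<N r) | signed-involutive (colSign s j) (+ 1) = ℤP.≤-refl
    upper : ∀ σ {i} j → i < N → ends s i ℤ.+ signed σ (ends s j) ℤ.≤ + 3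
    upper σ j i<N rewrite ends-< s i<N with σ | colSign s j
    ... | true | true = +≤+ (s≤s (s≤s z≤n))
    ... | true | false = +≤+ z≤n
    ... | false | true = +≤+ z≤n
    ... | false | false = +≤+ (s≤s (s≤s z≤n))

  -- The weight is (2, 1, ..., 1, 0, ..., 0) with u ones. It gives 2 + 0 or 2 + 1 on the sums of row
  -- 0, 2 - 0 on ε_0 - ε_j with j > u, and 1 + 1 on the cells among 1, ..., u.
  wingWeight : ℕ → ℕ → ℤ
  wingWeight u zero = + 2
  wingWeight u (suc l) = step u l

  wing-separating : ∀ u w → Separating (Wing u w) (wingWeight u)
  wing-separating u w = lower , upper
    where
    cell-column : ∀ {v j} → 1 ≤ j → j ≤ pred v → j < v
    cell-column {zero} 1≤j j≤ = ⊥-elim (ℕP.<⇒≱ 1≤j j≤)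
    cell-column {suc v} 1≤j j≤ = s≤s j≤
    lower : ∀ σ i j → IsRootₙ i j → Wing u w σ i j → + 2 ℤ.≤ wingWeight u i ℤ.+ signed σ (wingWeight u j)
    lower true zero (suc j) r (inj₁ (refl , _)) with step-view u j
    ... | inj₁ (_ , eq) rewrite eq = +≤+ (s≤s (s≤s z≤n))
    ... | inj₂ (_ , eq) rewrite eq = ℤP.≤-refl
    lower false zero (suc j) r (inj₁ (refl , inj₂ u<j)) rewrite step-above (s≤s⁻¹ u<j) = ℤP.≤-refl
    lower true i j r (inj₂ (refl , c)) with cell-bounds 1 w c
    lower true (suc i) (suc j) (s≤s i<j , _) (inj₂ (refl , c)) | _ , _ , s≤s j≤
      rewrite step-below (cell-column {u} (ℕP.≤-<-trans z≤n i<j) j≤)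
            | step-below (ℕP.<-trans i<j (cell-column {u} (ℕP.≤-<-trans z≤n i<j) j≤)) = ℤP.≤-refl
    upper : ∀ σ i j → IsRootₙ i j → wingWeight u i ℤ.+ signed σ (wingWeight u j) ℤ.≤ + 3
    upper σ i (suc j) r = ℤP.+-mono-≤ {wingWeight u i} {+ 2} (≤2 i) (≤1 σ)
      where
      ≤2 : ∀ i → wingWeight u i ℤ.≤ + 2
      ≤2 zero = ℤP.≤-refl
      ≤2 (suc l) with step-view u l
      ... | inj₁ (_ , eq) rewrite eq = +≤+ (s≤s z≤n)
      ... | inj₂ (_ , eq) rewrite eq = +≤+ z≤n
      ≤1 : ∀ σ → signed σ (step u j) ℤ.≤ + 1
      ≤1 σ with step-view u j
      ≤1 true | inj₁ (_ , eq) rewrite eq = ℤP.≤-refl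
      ≤1 true | inj₂ (_ , eq) rewrite eq = +≤+ z≤n
      ≤1 false | inj₁ (_ , eq) rewrite eq = -≤+
      ≤1 false | inj₂ (_ , eq) rewrite eq = +≤+ z≤n

  separating : ∀ c → ∃ (Separating ⟦ c ⟧)
  separating (low w) = ends true , strict-separating true (false ∷ w)
  separating (high s w) = ends s , strict-separating s (true ∷ w)
  separating (wing u w) = wingWeight u , wing-separating u w

  matches⇒upper : ∀ {I} c → (∀ {v} → v ∈ I → v ∈ Δ⁺) → Matches I ⟦ c ⟧ → IsUpper I
  matches⇒upper {I} c I⊆ m = All.tabulate λ μ∈ → All.tabulate λ α∈ +∈ → up μ∈ α∈ (posRoots⁻ (I⊆ μ∈)) (posRoots⁻ +∈)
    where
    up : ∀ {μ α} → μ ∈ I → α ∈ simpleRoots n → (∃ λ σ → ∃ λ i → ∃ λ j → IsRootₙ i j × μ ≡ root σ i j) →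
      (∃ λ σ → ∃ λ i → ∃ λ j → IsRootₙ i j × μ +ᵥ α ≡ root σ i j) → μ +ᵥ α ∈ I
    up {μ} {α} μ∈ α∈ (σ , i , j , r , eq) (σ′ , i′ , j′ , r′ , eq′) = subst (_∈ I) (sym eq′)
      (proj₂ (m σ′ i′ j′ r′) (upward-closed c σ σ′ r r′ (subst₂ _≼_ eq eq′ (+simple-≼ α∈))
        (proj₁ (m σ i j r) (subst (_∈ I) eq μ∈))))

  matches⇒abelian : ∀ {I} c → (∀ {v} → v ∈ I → v ∈ Δ⁺) → Matches I ⟦ c ⟧ → IsAbelian I
  matches⇒abelian {I} c I⊆ m = All.tabulate λ a∈ → All.tabulate λ b∈ +∈ → clash a∈ b∈ (posRoots⁻ +∈)
    where
    w = proj₁ (separating c)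
    heavy : ∀ {a} → a ∈ I → + 2 ℤ.≤ dot w a
    heavy {a} a∈ with posRoots⁻ (I⊆ a∈)
    ... | σ , i , j , r , refl = subst (+ 2 ℤ.≤_) (sym (dot-rootₙ w σ r))
      (proj₁ (proj₂ (separating c)) σ i j r (proj₁ (m σ i j r) a∈))
    clash : ∀ {a b} → a ∈ I → b ∈ I → (∃ λ σ → ∃ λ i → ∃ λ j → IsRootₙ i j × a +ᵥ b ≡ root σ i j) → ⊥
    clash {a} {b} a∈ b∈ (σ , i , j , r , eq) with ℤP.≤-trans (ℤP.+-mono-≤ (heavy a∈) (heavy b∈))
      (subst (ℤ._≤ + 3) (trans (sym (trans (cong (dot w) eq) (dot-rootₙ w σ r))) (dot-+ {n} w a b)) (proj₂ (proj₂ (separating c)) σ i j r))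
    ... | +≤+ (s≤s (s≤s (s≤s ())))

  rootList : Code → List (Vecℤ n)
  rootList c = map (λ (σ , i , j) → root σ i j) (filter (λ (σ , i , j) → (i ℕ.<? j ×-dec j ℕ.<? n) ×-dec ⟦ c ⟧? σ i j)
    (cartesianProduct (true ∷ false ∷ []) (cartesianProduct (upTo n) (upTo n))))

  -- Filtering Δ⁺, rather than taking `rootList c` itself, puts the roots in the order of Δ⁺ and so
  -- yields an entry of `subsets Δ⁺`.
  decode : Code → List (Vecℤ n)
  decode c = filter (_∈? rootList c) Δ⁺

  decode-⊆ : ∀ c {v} → v ∈ decode c → v ∈ Δ⁺
  decode-⊆ c v∈ = proj₁ (∈-filter⁻ (_∈? rootList c) {xs = Δ⁺} v∈)

  decode-matches : ∀ c → Matches (decode c) ⟦ c ⟧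
  decode-matches c σ i j r = to , from
    where
    cells? : ∀ t → Dec (IsRootₙ (proj₁ (proj₂ t)) (proj₂ (proj₂ t)) × ⟦ c ⟧ (proj₁ t) (proj₁ (proj₂ t)) (proj₂ (proj₂ t)))
    cells? (σ , i , j) = (i ℕ.<? j ×-dec j ℕ.<? n) ×-dec ⟦ c ⟧? σ i j
    ∈-bools : ∀ σ → σ ∈ true ∷ false ∷ []
    ∈-bools true = here refl
    ∈-bools false = there (here refl)
    to : root σ i j ∈ decode c → ⟦ c ⟧ σ i j
    to r∈ with ∈-map⁻ (λ (σ , i , j) → root σ i j) (proj₂ (∈-filter⁻ (_∈? rootList c) {xs = Δ⁺} r∈))
    ... | (σ′ , i′ , j′) , t∈ , eq with ∈-filter⁻ cells? {xs = cartesianProduct (true ∷ false ∷ []) (cartesianProduct (upTo n) (upTo n))} t∈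
    ... | _ , r′ , x with root-injective σ σ′ r r′ eq
    ... | refl , refl , refl = x
    from : ⟦ c ⟧ σ i j → root σ i j ∈ decode c
    from x = ∈-filter⁺ (_∈? rootList c) (root∈posRoots σ r)
      (∈-map⁺ (λ (σ , i , j) → root σ i j) (∈-filter⁺ cells?
        (∈-cartesianProduct⁺ (∈-bools σ) (∈-cartesianProduct⁺ (∈-upTo⁺ (ℕP.<-trans (proj₁ r) (proj₂ r))) (∈-upTo⁺ (proj₂ r)))) (r , x)))

  decode∈Ab : ∀ c → decode c ∈ Ab
  decode∈Ab c = Ab⁺ (filter-∈-subsets (_∈? rootList c) {xs = Δ⁺} (self-∈-subsets Δ⁺))
    (matches⇒upper c (decode-⊆ c) (decode-matches c)) (matches⇒abelian c (decode-⊆ c) (decode-matches c))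

  matches-unique : ∀ {I J X} → I ∈ Ab → J ∈ Ab → Matches I X → Matches J X → I ≡ J
  matches-unique {X = X} I∈ J∈ mI mJ = Ab-ext I∈ J∈ (sub I∈ mI mJ) (sub J∈ mJ mI)
    where
    sub : ∀ {I J} → I ∈ Ab → Matches I X → Matches J X → ∀ {v} → v ∈ I → v ∈ J
    sub {I} {J} I∈ mI mJ v∈ = go (posRoots⁻ (∈-Ab-root I∈ v∈)) v∈
      where
      go : ∀ {v} → (∃ λ σ → ∃ λ i → ∃ λ j → IsRootₙ i j × v ≡ root σ i j) → v ∈ I → v ∈ J
      go (σ , i , j , r , refl) v∈ = proj₂ (mJ σ i j r) (proj₁ (mI σ i j r) v∈)

-- The covering relation on codes

module Order (p : ℕ) where
  open Decode p public

  AddsAt : (X Y : Bool → ℕ → ℕ → Set) → Bool → ℕ → ℕ → Set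
  AddsAt X Y τ a b = X τ a b × ¬ Y τ a b × (∀ σ i j → IsRootₙ i j → Y σ i j → X σ i j) ×
    (∀ σ i j → IsRootₙ i j → X σ i j → Y σ i j ⊎ (σ ≡ τ × i ≡ a × j ≡ b))

  AddsSome : (X Y : Bool → ℕ → ℕ → Set) → Set
  AddsSome X Y = ∃ λ τ → ∃ λ a → ∃ λ b → IsRootₙ a b × AddsAt X Y τ a b

  -- The constructors with a `Flip` remove one cell. `drop` removes the last corner of row 0, the
  -- one root among ε_0 ± ε_N present, and `merge` removes the one of ε_0 ± ε_N whose sign is not
  -- `s`. `shift` removes ε_0 - ε_{u+2}; the index u + 2 then joins the triangle as an empty column,
  -- hence the new letter `false`. `top` is the same move at ε_0 - ε_1, where the word stays empty.
  data _⋗_ : Code → Code → Set where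
    low : ∀ {w w′} → Flip w w′ → low w ⋗ low w′
    high : ∀ s {w w′} → Flip w w′ → high s w ⋗ high s w′
    drop : ∀ s w → high s (false ∷ w) ⋗ low (true ∷ w)
    merge : ∀ s w → wing (suc p) w ⋗ high s (false ∷ w)
    wing : ∀ u {w w′} → Flip w w′ → wing u w ⋗ wing u w′
    shift : ∀ {u} w → wing (suc u) w ⋗ wing (suc (suc u)) (false ∷ w)
    top : wing 0 [] ⋗ wing 1 []

  addsSome-⇔ : ∀ {X Y Y′} → (∀ {σ i j} → Y σ i j → Y′ σ i j) → (∀ {σ i j} → Y′ σ i j → Y σ i j) →
    AddsSome X Y → AddsSome X Y′
  addsSome-⇔ {X} {Y} {Y′} to from (τ , a , b , r , x , ¬y , sub , only) =
    τ , a , b , r , x , (λ y → ¬y (from y)) , (λ σ i j r y → sub σ i j r (from y)) , λ σ i j r x → case (only σ i j r x)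
    where
    case : ∀ {σ i j} → Y σ i j ⊎ (σ ≡ τ × i ≡ a × j ≡ b) → Y′ σ i j ⊎ (σ ≡ τ × i ≡ a × j ≡ b)
    case (inj₁ y) = inj₁ (to y)
    case (inj₂ eq) = inj₂ eq

  strict-adds : ∀ s {w w′} → Flip w w′ → AddsSome (Strict s w) (Strict s w′)
  strict-adds s {w} {w′} f with flip⇒addsCell 0 f
  ... | r , c , inside , notIn , sub , only =
    colSign s c , r , c , cell-isRoot w inside , (refl , inside) , (λ (_ , q) → notIn q) ,
    (λ { σ i j _ (eq , q) → eq , sub q }) , λ { σ i j _ (refl , q) → case (only q) }
    where
    case : ∀ {i j} → Cell 0 w′ i j ⊎ (i ≡ r × j ≡ c) → Strict s w′ (colSign s j) i j ⊎ (colSign s j ≡ colSign s c × i ≡ r × j ≡ c)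
    case (inj₁ q) = inj₁ (refl , q)
    case (inj₂ (refl , refl)) = inj₂ (refl , refl , refl)

  not-or-same : ∀ σ s → σ ≡ s ⊎ σ ≡ not s
  not-or-same true true = inj₁ refl
  not-or-same false false = inj₁ refl
  not-or-same true false = inj₂ refl
  not-or-same false true = inj₂ refl

  not-≢ : ∀ s → not s ≡ s → ⊥
  not-≢ true ()
  not-≢ false ()

  -- For u = p + 1 the only difference in row 0 of the wing is ε_0 - ε_N, and below row 0 both sets
  -- have the same cells. With `merge-only`, they differ exactly in the root of row 0, column N and
  -- sign `not s`.
  merge-sub : ∀ s w {σ i j} → IsRootₙ i j → Strict s (true ∷ false ∷ w) σ i j → Wing (suc p) w σ i j
  merge-sub s w {i = i} {j} r (refl , inj₁ (refl , _)) = inj₁ (refl , case (column-view r))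
    where
    case : j < N ⊎ j ≡ N → colSign s j ≡ true ⊎ suc p < j
    case (inj₁ j<N) = inj₁ (colSign-< s j<N)
    case (inj₂ refl) = inj₂ ℕP.≤-refl
  merge-sub s w r (refl , inj₂ c) = inj₂ (colSign-< s (s≤s (proj₂ (proj₂ (cell-bounds 1 w c)))) , c)

  merge-only : ∀ s w {σ i j} → IsRootₙ i j → Wing (suc p) w σ i j →
    Strict s (true ∷ false ∷ w) σ i j ⊎ (σ ≡ not s × i ≡ 0 × j ≡ N)
  merge-only s w {σ} {i} {j} r (inj₁ (refl , σ-or-j)) = case (column-view r) σ-or-j
    where
    case : j < N ⊎ j ≡ N → σ ≡ true ⊎ suc p < j → Strict s (true ∷ false ∷ w) σ 0 j ⊎ (σ ≡ not s × 0 ≡ 0 × j ≡ N)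
    case (inj₁ j<N) (inj₁ refl) = inj₁ (sym (colSign-< s j<N) , inj₁ (refl , proj₁ r , ℕP.<⇒≤ j<N))
    case (inj₁ j<N) (inj₂ N≤j) = ⊥-elim (ℕP.<⇒≱ j<N N≤j)
    case (inj₂ refl) _ with not-or-same σ s
    ... | inj₁ refl = inj₁ (sym (colSign-N σ) , inj₁ (refl , proj₁ r , ℕP.≤-refl))
    ... | inj₂ eq = inj₂ (eq , refl , refl)
  merge-only s w r (inj₂ (refl , c)) = inj₁ (sym (colSign-< s (s≤s (proj₂ (proj₂ (cell-bounds 1 w c))))) , inj₂ c)

  last-isRoot : IsRootₙ 0 N
  last-isRoot = s≤s z≤n , ℕP.n<1+n N

  wing-last : ∀ u w σ → u ≤ suc p → Wing u w σ 0 N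
  wing-last u w σ u≤ = inj₁ (refl , inj₂ (s≤s u≤))

  wing-cell-isRoot : ∀ {u} (w : Word (pred u)) → u ≤ suc p → ∀ {i j} → Cell 1 w i j → IsRootₙ i j
  wing-cell-isRoot {u} w u≤ c = let (_ , i<j , j≤) = cell-bounds 1 w c in
    i<j , s≤s (ℕP.≤-trans j≤ (s≤s (ℕP.≤-trans (ℕP.pred[n]≤n {u}) u≤)))

  ⋗⇒adds : ∀ {c d} → Valid c → Valid d → c ⋗ d → AddsSome ⟦ c ⟧ ⟦ d ⟧
  ⋗⇒adds _ _ (low f) = strict-adds true (cons false f)
  ⋗⇒adds _ _ (high s f) = strict-adds s (cons true f)
  ⋗⇒adds _ _ (drop s w) = addsSome-⇔ {Strict s (true ∷ false ∷ w)}
    (λ {σ} {i} {j} → low-unsign s (true ∷ w) {σ} {i} {j}) (λ {σ} {i} {j} → low-sign s (true ∷ w) {σ} {i} {j})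
    (strict-adds s {true ∷ false ∷ w} {false ∷ true ∷ w} swap)
  ⋗⇒adds _ _ (merge s w) = not s , 0 , N , last-isRoot , wing-last (suc p) w (not s) ℕP.≤-refl ,
    (λ (eq , _) → not-≢ s (trans eq (colSign-N s))) ,
    (λ σ i j r → merge-sub s w r) , (λ σ i j r → merge-only s w r)
  ⋗⇒adds _ u≤ (wing u {w} {w′} f) with flip⇒addsCell 1 f
  ... | r , c , inside , notIn , sub , only = true , r , c , wing-cell-isRoot {u} w u≤ inside , inj₂ (refl , inside) , notIn′ , sub′ , only′
    where
    notIn′ : ¬ Wing u w′ true r c
    notIn′ (inj₁ (refl , _)) = row-not-below 0 w inside
    notIn′ (inj₂ (_ , q)) = notIn q
    sub′ : ∀ σ i j → IsRootₙ i j → Wing u w′ σ i j → Wing u w σ i j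
    sub′ σ i j _ (inj₁ x) = inj₁ x
    sub′ σ i j _ (inj₂ (eq , q)) = inj₂ (eq , sub q)
    only′ : ∀ σ i j → IsRootₙ i j → Wing u w σ i j → Wing u w′ σ i j ⊎ (σ ≡ true × i ≡ r × j ≡ c)
    only′ σ i j _ (inj₁ x) = inj₁ (inj₁ x)
    only′ σ i j _ (inj₂ (eq , q)) with only q
    ... | inj₁ q′ = inj₁ (inj₂ (eq , q′))
    ... | inj₂ eqs = inj₂ (eq , eqs)
  ⋗⇒adds u≤ u+1≤ (shift {u} w) = false , 0 , suc (suc u) , (s≤s z≤n , s≤s (ℕP.m≤n⇒m≤1+n u+1≤)) , inj₁ (refl , inj₂ ℕP.≤-refl) ,
    (λ { (inj₁ (_ , inj₁ ())) ; (inj₁ (_ , inj₂ lt)) → ℕP.<-irrefl refl lt ; (inj₂ (() , _)) }) ,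
    (λ { σ i j _ (inj₁ (eq , inj₁ eq′)) → inj₁ (eq , inj₁ eq′)
       ; σ i j _ (inj₁ (eq , inj₂ lt)) → inj₁ (eq , inj₂ (ℕP.<-trans (ℕP.n<1+n _) lt))
       ; σ i j _ (inj₂ x) → inj₂ x }) ,
    λ { true i j _ (inj₁ (eq , _)) → inj₁ (inj₁ (eq , inj₁ refl))
      ; false i j _ (inj₁ (eq , inj₂ lt)) → case eq (ℕP.m≤n⇒m<n∨m≡n lt)
      ; σ i j _ (inj₂ x) → inj₁ (inj₂ x) }
    where
    case : ∀ {i j} → i ≡ 0 → suc (suc u) < j ⊎ suc (suc u) ≡ j →
      Wing (suc (suc u)) (false ∷ w) false i j ⊎ (false ≡ false × i ≡ 0 × j ≡ suc (suc u))
    case eq (inj₁ lt) = inj₁ (inj₁ (eq , inj₂ lt))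
    case eq (inj₂ eq′) = inj₂ (refl , eq , sym eq′)
  ⋗⇒adds _ _ top = false , 0 , 1 , (s≤s z≤n , s≤s (s≤s z≤n)) , inj₁ (refl , inj₂ (s≤s z≤n)) ,
    (λ { (inj₁ (_ , inj₁ ())) ; (inj₁ (_ , inj₂ lt)) → ℕP.<-irrefl refl lt ; (inj₂ (() , _)) }) ,
    (λ { σ i j _ (inj₁ (eq , inj₁ eq′)) → inj₁ (eq , inj₁ eq′)
       ; σ i j _ (inj₁ (eq , inj₂ lt)) → inj₁ (eq , inj₂ (ℕP.<-trans (ℕP.n<1+n _) lt)) }) ,
    λ { true i j _ (inj₁ (eq , _)) → inj₁ (inj₁ (eq , inj₁ refl))
      ; false i (suc zero) _ (inj₁ (eq , inj₂ _)) → inj₂ (refl , eq , refl)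
      ; false i (suc (suc j)) _ (inj₁ (eq , inj₂ _)) → inj₁ (inj₁ (eq , inj₂ (s≤s (s≤s z≤n))))
      ; σ i j _ (inj₂ (_ , ())) }

  strict-adds⁻ : ∀ s {w w′ τ a b} → AddsAt (Strict s w) (Strict s w′) τ a b → Flip w w′
  strict-adds⁻ s {w} {w′} {τ} {a} {b} ((eq , inside) , notIn , sub , only) = addsCell⇒flip 0 (inside , (λ q → notIn (eq , q)) ,
    (λ q → proj₂ (sub _ _ _ (cell-isRoot w′ q) (refl , q))) , λ q → case (only _ _ _ (cell-isRoot w q) (refl , q)))
    where
    case : ∀ {σ i j} → Strict s w′ σ i j ⊎ (σ ≡ τ × i ≡ a × j ≡ b) → Cell 0 w′ i j ⊎ (i ≡ a × j ≡ b)
    case (inj₁ (_ , q)) = inj₁ q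
    case (inj₂ (_ , eqs)) = inj₂ eqs

  flip-tail : ∀ {m x} {w w′ : Word m} → Flip (x ∷ w) (x ∷ w′) → Flip w w′
  flip-tail (cons _ f) = f

  high-last : ∀ s w → Strict s (true ∷ w) (colSign s N) 0 N
  high-last s w = refl , corner 0 w

  -- The codes `low`, `high` and `wing` contain 0, 1 and 2 of the roots ε_0 ± ε_N. Removing a single
  -- root cannot raise this number, lower it by two, or exchange one of these roots for the other,
  -- which excludes the remaining pairs of families.
  adds⇒⋗ : ∀ c d {τ a b} → Valid c → Valid d → IsRootₙ a b → AddsAt ⟦ c ⟧ ⟦ d ⟧ τ a b → c ⋗ d
  adds⇒⋗ (low w) (low w′) _ _ _ adds = low (flip-tail (strict-adds⁻ true {false ∷ w} {false ∷ w′} adds))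
  adds⇒⋗ (low w) (high s w′) _ _ _ (_ , _ , sub , _) = ⊥-elim (no-corner 0 w (proj₂ (sub _ 0 N last-isRoot (high-last s w′))))
  adds⇒⋗ (low w) (wing u w′) _ u≤ _ (_ , _ , sub , _) = ⊥-elim (no-corner 0 w (proj₂ (sub true 0 N last-isRoot (wing-last u w′ true u≤))))
  adds⇒⋗ (high s w) (low w′) {τ} {a} {b} _ _ r adds with addsSome-⇔ {Strict s (true ∷ w)}
    (λ {σ} {i} {j} → low-sign s w′ {σ} {i} {j}) (λ {σ} {i} {j} → low-unsign s w′ {σ} {i} {j}) (τ , a , b , r , adds)
  ... | _ , _ , _ , _ , adds′ with strict-adds⁻ s {true ∷ w} {false ∷ w′} adds′
  ... | swap = drop s _
  adds⇒⋗ (high s w) (high s′ w′) _ _ _ adds with sub-sign (sub′ adds _ 0 N last-isRoot (high-last s′ w′))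
    where
    sub′ : ∀ {X Y τ a b} → AddsAt X Y τ a b → ∀ σ i j → IsRootₙ i j → Y σ i j → X σ i j
    sub′ (_ , _ , sub , _) = sub
    sub-sign : Strict s (true ∷ w) (colSign s′ N) 0 N → s′ ≡ s
    sub-sign (eq , _) = trans (sym (colSign-N s′)) (trans eq (colSign-N s))
  ... | refl = high s (flip-tail (strict-adds⁻ s {true ∷ w} {true ∷ w′} adds))
  adds⇒⋗ (high s w) (wing u w′) _ u≤ _ (_ , _ , sub , _) = ⊥-elim (not-≢ s
    (trans (proj₁ (sub (not s) 0 N last-isRoot (wing-last u w′ (not s) u≤))) (colSign-N s)))
  adds⇒⋗ (wing u w) (low w′) u≤ _ _ (_ , _ , _ , only) = ⊥-elim (distinct
    (only true 0 N last-isRoot (wing-last u w true u≤)) (only false 0 N last-isRoot (wing-last u w false u≤)))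
    where
    distinct : ∀ {τ a b} → Strict true (false ∷ w′) true 0 N ⊎ (true ≡ τ × 0 ≡ a × N ≡ b) →
      Strict true (false ∷ w′) false 0 N ⊎ (false ≡ τ × 0 ≡ a × N ≡ b) → ⊥
    distinct (inj₁ (_ , q)) _ = no-corner 0 w′ q
    distinct _ (inj₁ (_ , q)) = no-corner 0 w′ q
    distinct (inj₂ (refl , _)) (inj₂ (() , _))
  adds⇒⋗ (wing u w) (high s w′) {τ} {a} {b} u≤ _ _ (_ , _ , sub , only) =
    finish u≡ w sub only
    where
    extra : not s ≡ τ × 0 ≡ a × N ≡ b
    extra with only (not s) 0 N last-isRoot (wing-last u w (not s) u≤)
    ... | inj₁ (eq , _) = ⊥-elim (not-≢ s (trans eq (colSign-N s)))
    ... | inj₂ eqs = eqs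
    -- For u < p + 1 the difference ε_0 - ε_{u+1} lies in a column before N, so it would be lost in
    -- addition to the root in column N.
    u≡ : u ≡ suc p
    u≡ with ℕP.m≤n⇒m<n∨m≡n u≤
    ... | inj₂ eq = eq
    ... | inj₁ u< with only false 0 (suc u) (s≤s z≤n , s≤s (ℕP.m≤n⇒m≤1+n u<)) (inj₁ (refl , inj₂ ℕP.≤-refl))
    ...   | inj₁ (eq , _) with () ← trans eq (colSign-< s (s≤s u<))
    ...   | inj₂ (_ , _ , eq) = ⊥-elim (ℕP.<-irrefl (ℕP.suc-injective (trans eq (sym (proj₂ (proj₂ extra))))) u<)
    finish : ∀ {u} → u ≡ suc p → (w : Word (pred u)) →
      (∀ σ i j → IsRootₙ i j → Strict s (true ∷ w′) σ i j → Wing u w σ i j) →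
      (∀ σ i j → IsRootₙ i j → Wing u w σ i j → Strict s (true ∷ w′) σ i j ⊎ (σ ≡ τ × i ≡ a × j ≡ b)) →
      wing u w ⋗ high s w′
    finish refl w sub only with cells-injective 0 (true ∷ false ∷ w) (true ∷ w′) to from
      where
      to : ∀ {i j} → Cell 0 (true ∷ false ∷ w) i j → Cell 0 (true ∷ w′) i j
      to {i} {j} c with only (colSign s j) i j (cell-isRoot (true ∷ false ∷ w) c) (merge-sub s w (cell-isRoot (true ∷ false ∷ w) c) (refl , c))
      ... | inj₁ (_ , c′) = c′
      ... | inj₂ (eq , _ , eq′) = ⊥-elim (not-≢ s (trans (proj₁ extra)
              (trans (sym eq) (trans (cong (colSign s) (trans eq′ (sym (proj₂ (proj₂ extra))))) (colSign-N s)))))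
      from : ∀ {i j} → Cell 0 (true ∷ w′) i j → Cell 0 (true ∷ false ∷ w) i j
      from {i} {j} c with merge-only s w (cell-isRoot (true ∷ w′) c) (sub (colSign s j) i j (cell-isRoot (true ∷ w′) c) (refl , c))
      ... | inj₁ (_ , c′) = c′
      ... | inj₂ (eq , _ , refl) = ⊥-elim (not-≢ s (trans (sym eq) (colSign-N s)))
    ... | refl = merge s w
  adds⇒⋗ (wing u w) (wing u′ w′) {τ} {a} {b} u≤ u′≤ _ (inside , notIn , sub , only) with ℕP.<-cmp u u′
  ... | tri> _ _ u′<u = ⊥-elim (absurd (sub false 0 (suc u′) (s≤s z≤n , s≤s (s≤s u′≤)) (inj₁ (refl , inj₂ ℕP.≤-refl))))
    where
    absurd : Wing u w false 0 (suc u′) → ⊥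
    absurd (inj₁ (_ , inj₂ u<)) = ℕP.<⇒≱ u′<u (s≤s⁻¹ u<)
  ... | tri≈ _ refl _ = wing u (addsCell⇒flip 1 (proj₂ cell , (λ q → notIn (inj₂ (proj₁ cell , q))) , sub′ , only′))
    where
    not-first : Wing u w τ a b → τ ≡ true × Cell 1 w a b
    not-first (inj₁ x) = ⊥-elim (notIn (inj₁ x))
    not-first (inj₂ x) = x
    cell : τ ≡ true × Cell 1 w a b
    cell = not-first inside
    sub′ : ∀ {i j} → Cell 1 w′ i j → Cell 1 w i j
    sub′ c with sub true _ _ (wing-cell-isRoot {u} w′ u≤ c) (inj₂ (refl , c))
    ... | inj₂ (_ , c′) = c′
    ... | inj₁ (refl , _) = ⊥-elim (row-not-below 0 w′ c)
    only′ : ∀ {i j} → Cell 1 w i j → Cell 1 w′ i j ⊎ (i ≡ a × j ≡ b)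
    only′ c with only true _ _ (wing-cell-isRoot {u} w u≤ c) (inj₂ (refl , c))
    ... | inj₁ (inj₂ (_ , c′)) = inj₁ c′
    ... | inj₁ (inj₁ (refl , _)) = ⊥-elim (row-not-below 0 w c)
    ... | inj₂ (_ , eqs) = inj₂ eqs
  ... | tri< u<u′ _ _ = finish u u′ u′≡ w w′ u≤ u′≤ to from
    where
    -- Every ε_0 - ε_j with u < j ≤ u′ is lost. Only one root may be, so the interval has a single
    -- element.
    next : ∀ {j} → suc u ≤ j → j ≤ u′ → j ≡ b × τ ≡ false
    next {j} u<j j≤u′ with only false 0 j (ℕP.<-≤-trans (s≤s z≤n) u<j , s≤s (ℕP.≤-trans j≤u′ (ℕP.m≤n⇒m≤1+n u′≤))) (inj₁ (refl , inj₂ u<j))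
    ... | inj₂ (eq , _ , eq′) = eq′ , sym eq
    ... | inj₁ (inj₁ (_ , inj₂ u′<j)) = ⊥-elim (ℕP.<⇒≱ u′<j j≤u′)
    τ≡false : τ ≡ false
    τ≡false = proj₂ (next ℕP.≤-refl u<u′)
    u′≡ : u′ ≡ suc u
    u′≡ = trans (proj₁ (next u<u′ ℕP.≤-refl)) (sym (proj₁ (next ℕP.≤-refl u<u′)))
    to : ∀ {i j} → Cell 1 w i j → Cell 1 w′ i j
    to c with only true _ _ (wing-cell-isRoot {u} w u≤ c) (inj₂ (refl , c))
    ... | inj₁ (inj₂ (_ , c′)) = c′
    ... | inj₁ (inj₁ (refl , _)) = ⊥-elim (row-not-below 0 w c)
    ... | inj₂ (eq , _) with () ← trans eq τ≡false
    from : ∀ {i j} → Cell 1 w′ i j → Cell 1 w i j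
    from c with sub true _ _ (wing-cell-isRoot {u′} w′ u′≤ c) (inj₂ (refl , c))
    ... | inj₂ (_ , c′) = c′
    ... | inj₁ (refl , _) = ⊥-elim (row-not-below 0 w′ c)
    finish : ∀ u u′ → u′ ≡ suc u → (w : Word (pred u)) (w′ : Word (pred u′)) → u ≤ suc p → u′ ≤ suc p →
      (∀ {i j} → Cell 1 w i j → Cell 1 w′ i j) → (∀ {i j} → Cell 1 w′ i j → Cell 1 w i j) → wing u w ⋗ wing u′ w′
    finish zero _ refl [] [] _ _ _ _ = top
    finish (suc m) _ refl w w′ _ _ to from with cells-injective 1 (false ∷ w) w′ to from
    ... | refl = shift w

  Coordinates : Vecℤ n → Set
  Coordinates v = ∃ λ σ → ∃ λ i → ∃ λ j → IsRootₙ i j × v ≡ root σ i j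

  covers⇒⋗ : ∀ {I J} c d → I ∈ Ab → J ∈ Ab → Valid c → Valid d → Matches I ⟦ c ⟧ → Matches J ⟦ d ⟧ → Poset.Covers I J → c ⋗ d
  covers⇒⋗ {I} {J} c d I∈ J∈ vc vd mI mJ cov =
    let (γ , adds) = covers⇒addsRoot I∈ J∈ cov in go (posRoots⁻ (∈-Ab-root I∈ (proj₁ adds))) adds
    where
    go : ∀ {γ} → Coordinates γ → AddsRoot I J γ → c ⋗ d
    go (τ , a , b , r , refl) (γ∈I , γ∉J , J⊆I , only) = adds⇒⋗ c d vc vd r
      (proj₁ (mI τ a b r) γ∈I , (λ y → γ∉J (proj₂ (mJ τ a b r) y)) ,
       (λ σ i j r′ y → proj₁ (mI σ i j r′) (J⊆I (proj₂ (mJ σ i j r′) y))) ,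
       λ σ i j r′ x → case σ i j r′ (only (proj₂ (mI σ i j r′) x)))
      where
      case : ∀ σ i j → IsRootₙ i j → root σ i j ∈ J ⊎ root σ i j ≡ root τ a b → ⟦ d ⟧ σ i j ⊎ (σ ≡ τ × i ≡ a × j ≡ b)
      case σ i j r′ (inj₁ ∈J) = inj₁ (proj₁ (mJ σ i j r′) ∈J)
      case σ i j r′ (inj₂ eq) = inj₂ (root-injective σ τ r′ r eq)

  ⋗⇒covers : ∀ {I J} c d → I ∈ Ab → J ∈ Ab → Valid c → Valid d → Matches I ⟦ c ⟧ → Matches J ⟦ d ⟧ → c ⋗ d → Poset.Covers I J
  ⋗⇒covers {I} {J} c d I∈ J∈ vc vd mI mJ c⋗d = go (⋗⇒adds vc vd c⋗d)
    where
    go : AddsSome ⟦ c ⟧ ⟦ d ⟧ → Poset.Covers I J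
    go (τ , a , b , r , x , ¬y , sub , only) = addsRoot⇒covers
      (proj₂ (mI τ a b r) x , (λ ∈J → ¬y (proj₁ (mJ τ a b r) ∈J)) ,
       (λ δ∈ → sub′ (posRoots⁻ (∈-Ab-root J∈ δ∈)) δ∈) , (λ δ∈ → only′ (posRoots⁻ (∈-Ab-root I∈ δ∈)) δ∈))
      where
      sub′ : ∀ {δ} → Coordinates δ → δ ∈ J → δ ∈ I
      sub′ (σ , i , j , r′ , refl) δ∈ = proj₂ (mI σ i j r′) (sub σ i j r′ (proj₁ (mJ σ i j r′) δ∈))
      back : ∀ σ i j → IsRootₙ i j → ⟦ d ⟧ σ i j ⊎ (σ ≡ τ × i ≡ a × j ≡ b) → root σ i j ∈ J ⊎ root σ i j ≡ root τ a b
      back σ i j r′ (inj₁ y) = inj₁ (proj₂ (mJ σ i j r′) y)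
      back _ _ _ _ (inj₂ (refl , refl , refl)) = inj₂ refl
      only′ : ∀ {δ} → Coordinates δ → δ ∈ I → δ ∈ J ⊎ δ ≡ root τ a b
      only′ (σ , i , j , r′ , refl) δ∈ = back σ i j r′ (only σ i j r′ (proj₁ (mI σ i j r′) δ∈))

-- Counting words by their flips

words : ∀ m → List (Word m)
words zero = [] ∷ []
words (suc m) = map (true ∷_) (words m) ++ map (false ∷_) (words m)

∈-words : ∀ {m} (w : Word m) → w ∈ words m
∈-words [] = here refl
∈-words (true ∷ w) = ∈-++⁺ˡ (∈-map⁺ (true ∷_) (∈-words w))
∈-words {suc m} (false ∷ w) = ∈-++⁺ʳ (map (true ∷_) (words m)) (∈-map⁺ (false ∷_) (∈-words w))

∷-disjoint : ∀ {m} {xs ys : List (Word m)} {w} → w ∈ map (true ∷_) xs × w ∈ map (false ∷_) ys → ⊥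
∷-disjoint (p , q) with ∈-map⁻ (true ∷_) p | ∈-map⁻ (false ∷_) q
... | _ , _ , refl | _ , _ , ()

words-unique : ∀ m → Unique (words m)
words-unique zero = [] ∷ []
words-unique (suc m) = Uniq.++⁺ (Uniq.map⁺ VecP.∷-injectiveʳ (words-unique m))
  (Uniq.map⁺ VecP.∷-injectiveʳ (words-unique m)) ∷-disjoint

downFlips upFlips : ∀ {m} → Word m → List (Word m)
downFlips [] = []
downFlips (false ∷ w) = map (false ∷_) (downFlips w)
downFlips (true ∷ []) = (false ∷ []) ∷ []
downFlips (true ∷ false ∷ w) = (false ∷ true ∷ w) ∷ map (true ∷_) (downFlips (false ∷ w))
downFlips (true ∷ true ∷ w) = map (true ∷_) (downFlips (true ∷ w))
upFlips [] = []
upFlips (true ∷ w) = map (true ∷_) (upFlips w)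
upFlips (false ∷ []) = (true ∷ []) ∷ []
upFlips (false ∷ true ∷ w) = (true ∷ false ∷ w) ∷ map (false ∷_) (upFlips (true ∷ w))
upFlips (false ∷ false ∷ w) = map (false ∷_) (upFlips (false ∷ w))

downFlips⁺ : ∀ {m} {w w′ : Word m} → Flip w w′ → w′ ∈ downFlips w
downFlips⁺ last = here refl
downFlips⁺ swap = here refl
downFlips⁺ (cons false f) = ∈-map⁺ (false ∷_) (downFlips⁺ f)
downFlips⁺ {w = true ∷ []} (cons true ())
downFlips⁺ {w = true ∷ false ∷ w} (cons true f) = there (∈-map⁺ (true ∷_) (downFlips⁺ f))
downFlips⁺ {w = true ∷ true ∷ w} (cons true f) = ∈-map⁺ (true ∷_) (downFlips⁺ f)

downFlips⁻ : ∀ {m} (w : Word m) {w′} → w′ ∈ downFlips w → Flip w w′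
downFlips⁻ (false ∷ w) w′∈ with ∈-map⁻ (false ∷_) w′∈
... | _ , v∈ , refl = cons false (downFlips⁻ w v∈)
downFlips⁻ (true ∷ []) (here refl) = last
downFlips⁻ (true ∷ false ∷ w) (here refl) = swap
downFlips⁻ (true ∷ false ∷ w) (there w′∈) with ∈-map⁻ (true ∷_) w′∈
... | _ , v∈ , refl = cons true (downFlips⁻ (false ∷ w) v∈)
downFlips⁻ (true ∷ true ∷ w) w′∈ with ∈-map⁻ (true ∷_) w′∈
... | _ , v∈ , refl = cons true (downFlips⁻ (true ∷ w) v∈)

upFlips⁺ : ∀ {m} {w w′ : Word m} → Flip w′ w → w′ ∈ upFlips w
upFlips⁺ last = here refl
upFlips⁺ swap = here refl
upFlips⁺ (cons true f) = ∈-map⁺ (true ∷_) (upFlips⁺ f)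
upFlips⁺ {w = false ∷ []} (cons false ())
upFlips⁺ {w = false ∷ true ∷ w} (cons false f) = there (∈-map⁺ (false ∷_) (upFlips⁺ f))
upFlips⁺ {w = false ∷ false ∷ w} (cons false f) = ∈-map⁺ (false ∷_) (upFlips⁺ f)

upFlips⁻ : ∀ {m} (w : Word m) {w′} → w′ ∈ upFlips w → Flip w′ w
upFlips⁻ (true ∷ w) w′∈ with ∈-map⁻ (true ∷_) w′∈
... | _ , v∈ , refl = cons true (upFlips⁻ w v∈)
upFlips⁻ (false ∷ []) (here refl) = last
upFlips⁻ (false ∷ true ∷ w) (here refl) = swap
upFlips⁻ (false ∷ true ∷ w) (there w′∈) with ∈-map⁻ (false ∷_) w′∈
... | _ , v∈ , refl = cons false (upFlips⁻ (true ∷ w) v∈)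
upFlips⁻ (false ∷ false ∷ w) w′∈ with ∈-map⁻ (false ∷_) w′∈
... | _ , v∈ , refl = cons false (upFlips⁻ (false ∷ w) v∈)

head-∉ : ∀ {m x y} {w : Word m} {xs : List (Word m)} → x ≢ y → All (λ v → ¬ (x ∷ w ≡ v)) (map (y ∷_) xs)
head-∉ {y = y} {xs = xs} x≢y = All.tabulate λ v∈ eq → absurd (∈-map⁻ (y ∷_) v∈) eq
  where
  absurd : ∀ {v} → (∃ λ u → u ∈ xs × v ≡ y ∷ u) → ¬ (_ ≡ v)
  absurd (_ , _ , refl) refl = x≢y refl

downFlips-unique : ∀ {m} (w : Word m) → Unique (downFlips w)
downFlips-unique [] = []
downFlips-unique (false ∷ w) = Uniq.map⁺ VecP.∷-injectiveʳ (downFlips-unique w)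
downFlips-unique (true ∷ []) = [] ∷ []
downFlips-unique (true ∷ false ∷ w) = head-∉ {x = false} {true} {true ∷ w} (λ ()) ∷ Uniq.map⁺ VecP.∷-injectiveʳ (downFlips-unique (false ∷ w))
downFlips-unique (true ∷ true ∷ w) = Uniq.map⁺ VecP.∷-injectiveʳ (downFlips-unique (true ∷ w))

upFlips-unique : ∀ {m} (w : Word m) → Unique (upFlips w)
upFlips-unique [] = []
upFlips-unique (true ∷ w) = Uniq.map⁺ VecP.∷-injectiveʳ (upFlips-unique w)
upFlips-unique (false ∷ []) = [] ∷ []
upFlips-unique (false ∷ true ∷ w) = head-∉ {x = true} {false} {false ∷ w} (λ ()) ∷ Uniq.map⁺ VecP.∷-injectiveʳ (upFlips-unique (true ∷ w))
upFlips-unique (false ∷ false ∷ w) = Uniq.map⁺ VecP.∷-injectiveʳ (upFlips-unique (false ∷ w))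

-- Coefficients of generating functions and Pascal's rule

δ : ℕ → ℤ → ℤ
δ _ -[1+ _ ] = + 0
δ zero (+ zero) = + 1
δ zero (+ suc _) = + 0
δ (suc a) (+ zero) = + 0
δ (suc a) (+ suc k) = δ a (+ k)

δ-suc : ∀ a k → δ (suc a) k ≡ δ a (k ℤ.- + 1)
δ-suc a (+ zero) = refl
δ-suc a (+ suc k) = refl
δ-suc a -[1+ k ] = refl

δ-refl : ∀ a → δ a (+ a) ≡ + 1
δ-refl zero = refl
δ-refl (suc a) = δ-refl a

δ-≢ : ∀ a b → a ≢ b → δ a (+ b) ≡ + 0
δ-≢ zero zero ne = ⊥-elim (ne refl)
δ-≢ zero (suc b) _ = refl
δ-≢ (suc a) zero _ = refl
δ-≢ (suc a) (suc b) ne = δ-≢ a b (λ eq → ne (cong suc eq))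

module _ {A : Set} where

  -- The argument k is an integer so that shifts of f become shifts of k.
  count : (A → ℕ) → List A → ℤ → ℤ
  count f [] k = + 0
  count f (x ∷ xs) k = δ (f x) k ℤ.+ count f xs k

  length-filter : ∀ (f : A → ℕ) xs k → + length (filter (λ x → f x ℕ.≟ k) xs) ≡ count f xs (+ k)
  length-filter f [] k = refl
  length-filter f (x ∷ xs) k = go (P? x)
    where
    P? : ∀ y → Dec (f y ≡ k)
    P? y = f y ℕ.≟ k
    go : Dec (f x ≡ k) → + length (filter P? (x ∷ xs)) ≡ δ (f x) (+ k) ℤ.+ count f xs (+ k)
    go (yes eq) = trans (cong (λ l → + length l) (filter-accept P? eq))
      (cong₂ ℤ._+_ (trans (sym (δ-refl (f x))) (cong (λ k → δ (f x) (+ k)) eq)) (length-filter f xs k))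
    go (no ne) = trans (cong (λ l → + length l) (filter-reject P? ne))
      (trans (length-filter f xs k) (trans (sym (ℤP.+-identityˡ _)) (cong (ℤ._+ count f xs (+ k)) (sym (δ-≢ (f x) k ne)))))

  count-++ : ∀ f (xs ys : List A) k → count f (xs ++ ys) k ≡ count f xs k ℤ.+ count f ys k
  count-++ f [] ys k = sym (ℤP.+-identityˡ _)
  count-++ f (x ∷ xs) ys k rewrite count-++ f xs ys k = sym (ℤP.+-assoc (δ (f x) k) (count f xs k) (count f ys k))

  count-cong : ∀ {f g : A → ℕ} → (∀ x → f x ≡ g x) → ∀ xs k → count f xs k ≡ count g xs k
  count-cong eq [] k = refl
  count-cong eq (x ∷ xs) k = cong₂ (λ a b → δ a k ℤ.+ b) (eq x) (count-cong eq xs k)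

  count-suc : ∀ (f : A → ℕ) xs k → count (λ x → suc (f x)) xs k ≡ count f xs (k ℤ.- + 1)
  count-suc f [] k = refl
  count-suc f (x ∷ xs) k = cong₂ ℤ._+_ (δ-suc (f x) k) (count-suc f xs k)

count-map : ∀ {A B : Set} (f : B → ℕ) (g : A → B) xs k → count f (map g xs) k ≡ count (λ x → f (g x)) xs k
count-map f g [] k = refl
count-map f g (x ∷ xs) k = cong (ℤ._+_ (δ (f (g x)) k)) (count-map f g xs k)

count-words : ∀ {m} (f : Word (suc m) → ℕ) k →
  count f (words (suc m)) k ≡ count (λ w → f (true ∷ w)) (words m) k ℤ.+ count (λ w → f (false ∷ w)) (words m) k
count-words {m} f k = trans (count-++ f (map (true ∷_) (words m)) _ k)
  (cong₂ ℤ._+_ (count-map f (true ∷_) (words m) k) (count-map f (false ∷_) (words m) k))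

-- With integer lower indices there is no boundary case: the extra term at x = 0 has a negative
-- index and vanishes.
binom-pascal : ∀ m x → binom (suc m) x ≡ binom m (x ℤ.- + 1) ℤ.+ binom m x
binom-pascal m (+ zero) = refl
binom-pascal m (+ suc k) = cong +_ (sym (nCk+nC[k+1]≡[n+1]C[k+1] m k))
binom-pascal m -[1+ k ] = refl

binom-zero : ∀ x → binom 0 x ≡ δ 0 x
binom-zero (+ zero) = refl
binom-zero (+ suc k) = refl
binom-zero -[1+ k ] = refl

-- With the offset i in this form, Pascal's rule just increments i.
β : ℤ → ℕ → ℕ → ℤ
β k m i = binom m (+ 2 ℤ.* k ℤ.+ + 1 ℤ.- + i)

β-pascal : ∀ k m i → β k (suc m) i ≡ β k m (suc i) ℤ.+ β k m i
β-pascal k m i = trans (binom-pascal m _) (cong (λ x → binom m x ℤ.+ β k m i) (lem (+ 2 ℤ.* k ℤ.+ + 1) i))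
  where
  lem′ : ∀ x y → x ℤ.- y ℤ.- + 1 ≡ x ℤ.- (+ 1 ℤ.+ y)
  lem′ = solve-∀
  lem : ∀ x i → x ℤ.- + i ℤ.- + 1 ≡ x ℤ.- + suc i
  lem x i = lem′ x (+ i)

-- This is the effect of multiplying a generating function by q. Each additional cover of all
-- members of a family costs an offset of two.
β-pred : ∀ k m i → β (k ℤ.- + 1) m i ≡ β k m (2 ℕ.+ i)
β-pred k m i = cong (binom m) (lem k (+ i))
  where
  lem : ∀ k y → + 2 ℤ.* (k ℤ.- + 1) ℤ.+ + 1 ℤ.- y ≡ + 2 ℤ.* k ℤ.+ + 1 ℤ.- (+ 2 ℤ.+ y)
  lem = solve-∀

δ-even : ∀ k → δ 0 (+ 2 ℤ.* k) ≡ δ 0 k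
δ-even (+ zero) = refl
δ-even (+ suc k) = refl
δ-even -[1+ k ] = refl

δ-odd : ∀ k → δ 0 (+ 2 ℤ.* k ℤ.+ + 1) ≡ + 0
δ-odd (+ zero) = refl
δ-odd (+ suc k) = refl
δ-odd -[1+ zero ] = refl
δ-odd -[1+ suc k ] = refl

β-zero-even : ∀ k → β k 0 0 ≡ + 0
β-zero-even k = trans (binom-zero _) (trans (cong (δ 0) (ℤP.+-identityʳ (+ 2 ℤ.* k ℤ.+ + 1))) (δ-odd k))

β-zero-odd : ∀ k → β k 0 1 ≡ δ 0 k
β-zero-odd k = trans (binom-zero _) (trans (cong (δ 0) (lem (+ 2 ℤ.* k))) (δ-even k))
  where
  lem : ∀ x → x ℤ.+ + 1 ℤ.- + 1 ≡ x
  lem = solve-∀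

β-one-zero : ∀ k → β k 1 0 ≡ δ 0 k
β-one-zero k = trans (β-pascal k 0 0) (trans (cong₂ ℤ._+_ (β-zero-odd k) (β-zero-even k)) (ℤP.+-identityʳ _))

β-one-one : ∀ k → β k 1 1 ≡ δ 0 k
β-one-one k = trans (β-pascal k 0 1) (trans (cong₂ ℤ._+_ (trans (sym (β-pred k 0 0)) (β-zero-even (k ℤ.- + 1))) (β-zero-odd k)) (ℤP.+-identityˡ _))

β-one-two : ∀ k → β k 1 2 ≡ δ 1 k
β-one-two k = trans (sym (β-pred k 1 0)) (trans (β-one-zero (k ℤ.- + 1)) (sym (δ-suc 0 k)))

β-one-three : ∀ k → β k 1 3 ≡ δ 1 k
β-one-three k = trans (sym (β-pred k 1 1)) (trans (β-one-one (k ℤ.- + 1)) (sym (δ-suc 0 k)))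

flips-below flips-above : ∀ {m} → Word m → ℕ
flips-below w = length (downFlips w)
flips-above w = length (upFlips w)

below-false : ∀ {m} (w : Word m) → flips-below (false ∷ w) ≡ flips-below w
below-false w = length-map (false ∷_) (downFlips w)

below-true-true : ∀ {m} (w : Word m) → flips-below (true ∷ true ∷ w) ≡ flips-below (true ∷ w)
below-true-true w = length-map (true ∷_) (downFlips (true ∷ w))

below-true-false : ∀ {m} (w : Word m) → flips-below (true ∷ false ∷ w) ≡ suc (flips-below w)
below-true-false w = cong suc (trans (length-map (true ∷_) (downFlips (false ∷ w))) (below-false w))

above-true : ∀ {m} (w : Word m) → flips-above (true ∷ w) ≡ flips-above w
above-true w = length-map (true ∷_) (upFlips w)

above-false-false : ∀ {m} (w : Word m) → flips-above (false ∷ false ∷ w) ≡ flips-above (false ∷ w)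
above-false-false w = length-map (false ∷_) (upFlips (false ∷ w))

above-false-true : ∀ {m} (w : Word m) → flips-above (false ∷ true ∷ w) ≡ suc (flips-above w)
above-false-true w = cong suc (trans (length-map (false ∷_) (upFlips (true ∷ w))) (above-true w))

-- Put `false` before and after the word. The flips are the changes from `true` to `false`, so k
-- flips mean 2k changes among m + 1 neighbouring pairs, giving binom(m + 1, 2k). With `true` in
-- front instead there are 2k - 1 changes. The proof builds words letter by letter, which is
-- Pascal's rule.
count-below : ∀ m k → count flips-below (words m) k ≡ β k (suc m) 1
count-below-true : ∀ m k → count (λ w → flips-below (true ∷ w)) (words m) k ≡ β k (suc m) 2
count-below zero k = trans (ℤP.+-identityʳ _) (sym (β-one-one k))
count-below (suc m) k = begin
  count flips-below (words (suc m)) k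
    ≡⟨ count-words {m} flips-below k ⟩
  count (λ w → flips-below (true ∷ w)) (words m) k ℤ.+ count (λ w → flips-below (false ∷ w)) (words m) k
    ≡⟨ cong₂ ℤ._+_ (count-below-true m k) (trans (count-cong below-false (words m) k) (count-below m k)) ⟩
  β k (suc m) 2 ℤ.+ β k (suc m) 1
    ≡⟨ β-pascal k (suc m) 1 ⟨
  β k (suc (suc m)) 1 ∎
count-below-true zero k = trans (ℤP.+-identityʳ _) (sym (β-one-two k))
count-below-true (suc m) k = begin
  count (λ w → flips-below (true ∷ w)) (words (suc m)) k
    ≡⟨ count-words {m} (λ w → flips-below (true ∷ w)) k ⟩
  count (λ w → flips-below (true ∷ true ∷ w)) (words m) k ℤ.+ count (λ w → flips-below (true ∷ false ∷ w)) (words m) k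
    ≡⟨ cong₂ ℤ._+_ (trans (count-cong below-true-true (words m) k) (count-below-true m k))
         (trans (count-cong below-true-false (words m) k) (trans (count-suc flips-below (words m) k)
           (trans (count-below m (k ℤ.- + 1)) (β-pred k (suc m) 1)))) ⟩
  β k (suc m) 2 ℤ.+ β k (suc m) 3
    ≡⟨ ℤP.+-comm (β k (suc m) 2) (β k (suc m) 3) ⟩
  β k (suc m) 3 ℤ.+ β k (suc m) 2
    ≡⟨ β-pascal k (suc m) 2 ⟨
  β k (suc (suc m)) 2 ∎

-- Complementing all letters exchanges upward and downward flips, so the numbers are those of
-- `count-below` and `count-below-true`.
count-above : ∀ m k → count flips-above (words m) k ≡ β k (suc m) 1
count-above-false : ∀ m k → count (λ w → flips-above (false ∷ w)) (words m) k ≡ β k (suc m) 2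
count-above zero k = trans (ℤP.+-identityʳ _) (sym (β-one-one k))
count-above (suc m) k = begin
  count flips-above (words (suc m)) k
    ≡⟨ count-words {m} flips-above k ⟩
  count (λ w → flips-above (true ∷ w)) (words m) k ℤ.+ count (λ w → flips-above (false ∷ w)) (words m) k
    ≡⟨ cong₂ ℤ._+_ (trans (count-cong above-true (words m) k) (count-above m k)) (count-above-false m k) ⟩
  β k (suc m) 1 ℤ.+ β k (suc m) 2
    ≡⟨ ℤP.+-comm (β k (suc m) 1) (β k (suc m) 2) ⟩
  β k (suc m) 2 ℤ.+ β k (suc m) 1
    ≡⟨ β-pascal k (suc m) 1 ⟨
  β k (suc (suc m)) 1 ∎
count-above-false zero k = trans (ℤP.+-identityʳ _) (sym (β-one-two k))
count-above-false (suc m) k = begin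
  count (λ w → flips-above (false ∷ w)) (words (suc m)) k
    ≡⟨ count-words {m} (λ w → flips-above (false ∷ w)) k ⟩
  count (λ w → flips-above (false ∷ true ∷ w)) (words m) k ℤ.+ count (λ w → flips-above (false ∷ false ∷ w)) (words m) k
    ≡⟨ cong₂ ℤ._+_ (trans (count-cong above-false-true (words m) k) (trans (count-suc flips-above (words m) k)
           (trans (count-above m (k ℤ.- + 1)) (β-pred k (suc m) 1))))
         (trans (count-cong above-false-false (words m) k) (count-above-false m k)) ⟩
  β k (suc m) 3 ℤ.+ β k (suc m) 2
    ≡⟨ β-pascal k (suc m) 2 ⟨
  β k (suc (suc m)) 2 ∎

-- Enumeration of the codes and of their neighbours

module Enumeration (p : ℕ) where
  open Order p public

  _⊑_ : (X Y : Bool → ℕ → ℕ → Set) → Set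
  X ⊑ Y = ∀ σ i j → IsRootₙ i j → X σ i j → Y σ i j

  strict-⊑ : ∀ s {w w′} → Strict s w ⊑ Strict s w′ → ∀ {i j} → Cell 0 w i j → Cell 0 w′ i j
  strict-⊑ s {w} le c = proj₂ (le _ _ _ (cell-isRoot w c) (refl , c))

  strict-injective : ∀ s {w w′} → Strict s w ⊑ Strict s w′ → Strict s w′ ⊑ Strict s w → w ≡ w′
  strict-injective s {w} {w′} le ge = cells-injective 0 w w′ (strict-⊑ s {w} {w′} le) (strict-⊑ s {w′} {w} ge)

  high⋢low : ∀ s {w w′} → ¬ (Strict s (true ∷ w) ⊑ Strict true (false ∷ w′))
  high⋢low s {w} {w′} le = no-corner 0 w′ (proj₂ (le _ 0 N last-isRoot (high-last s w)))

  wing⋢strict : ∀ s {u w w′} → u ≤ suc p → ¬ (Wing u w ⊑ Strict s w′)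
  wing⋢strict s {u} {w} u≤ le = not-≢ s (trans (proj₁ (le (not s) 0 N last-isRoot (wing-last u w (not s) u≤))) (colSign-N s))

  wing-⊑ : ∀ {u u′ w w′} → u ≤ suc p → Wing u w ⊑ Wing u′ w′ → u′ ≤ u
  wing-⊑ {u} {u′} {w} {w′} u≤ le = case (le false 0 (suc u) (s≤s z≤n , s≤s (s≤s u≤)) (inj₁ (refl , inj₂ ℕP.≤-refl)))
    where
    case : Wing u′ w′ false 0 (suc u) → u′ ≤ u
    case (inj₁ (_ , inj₂ lt)) = s≤s⁻¹ lt

  wing-⊑-cells : ∀ {u u′ w w′} → u ≤ suc p → Wing u w ⊑ Wing u′ w′ → ∀ {i j} → Cell 1 w i j → Cell 1 w′ i j
  wing-⊑-cells {u} {u′} {w} {w′} u≤ le {i} {j} c = case c (le true i j (wing-cell-isRoot {u} w u≤ c) (inj₂ (refl , c)))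
    where
    case : ∀ {i j} → Cell 1 w i j → Wing u′ w′ true i j → Cell 1 w′ i j
    case c (inj₁ (refl , _)) = ⊥-elim (row-not-below 0 w c)
    case c (inj₂ (_ , c′)) = c′

  -- The roots ε_0 ± ε_N determine the family and the sign, the end of row 0 determines u, and the
  -- cells determine the word.
  code-injective : ∀ c d → Valid c → Valid d → ⟦ c ⟧ ⊑ ⟦ d ⟧ → ⟦ d ⟧ ⊑ ⟦ c ⟧ → c ≡ d
  code-injective (low w) (low w′) _ _ le ge = cong low (VecP.∷-injectiveʳ (strict-injective true {false ∷ w} {false ∷ w′} le ge))
  code-injective (low w) (high s w′) _ _ le ge = ⊥-elim (high⋢low s {w′} {w} ge)
  code-injective (low w) (wing u w′) _ u≤ le ge = ⊥-elim (wing⋢strict true {u} {w′} {false ∷ w} u≤ ge)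
  code-injective (high s w) (low w′) _ _ le ge = ⊥-elim (high⋢low s {w} {w′} le)
  code-injective (high s w) (high s′ w′) _ _ le ge
    with trans (sym (colSign-N s)) (trans (proj₁ (le _ 0 N last-isRoot (high-last s w))) (colSign-N s′))
  ... | refl = cong (high s) (VecP.∷-injectiveʳ (strict-injective s {true ∷ w} {true ∷ w′} le ge))
  code-injective (high s w) (wing u w′) _ u≤ le ge = ⊥-elim (wing⋢strict s {u} {w′} {true ∷ w} u≤ ge)
  code-injective (wing u w) (low w′) u≤ _ le ge = ⊥-elim (wing⋢strict true {u} {w} {false ∷ w′} u≤ le)
  code-injective (wing u w) (high s w′) u≤ _ le ge = ⊥-elim (wing⋢strict s {u} {w} {true ∷ w′} u≤ le)
  code-injective (wing u w) (wing u′ w′) u≤ u′≤ le ge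
    with ℕP.≤-antisym (wing-⊑ {u′} {u} {w′} {w} u′≤ ge) (wing-⊑ {u} {u′} {w} {w′} u≤ le)
  ... | refl = cong (wing u) (cells-injective 1 w w′ (wing-⊑-cells {u} {u} {w} {w′} u≤ le) (wing-⊑-cells {u} {u} {w′} {w} u≤ ge))

  decode-injective : ∀ c d → Valid c → Valid d → decode c ≡ decode d → c ≡ d
  decode-injective c d vc vd eq = code-injective c d vc vd
    (λ σ i j r x → proj₁ (decode-matches d σ i j r) (subst (root σ i j ∈_) eq (proj₂ (decode-matches c σ i j r) x)))
    (λ σ i j r x → proj₁ (decode-matches c σ i j r) (subst (root σ i j ∈_) (sym eq) (proj₂ (decode-matches d σ i j r) x)))

  wings : ℕ → List Code
  wings zero = []
  wings (suc u) = map (wing u) (words (pred u)) ++ wings u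

  -- The families have 2^(n-2), 2 · 2^(n-2) and 1 + (1 + 2 + ... + 2^(n-3)) = 2^(n-2) members,
  -- together 2^n, the known number of abelian ideals.
  codes : List Code
  codes = map low (words (suc p)) ++ map (high true) (words (suc p)) ++ map (high false) (words (suc p)) ++ wings (suc (suc p))

  ∈-wings⁺ : ∀ {k u} (w : Word (pred u)) → u < k → wing u w ∈ wings k
  ∈-wings⁺ {suc k} {u} w u<k+1 with ℕP.m≤n⇒m<n∨m≡n (s≤s⁻¹ u<k+1)
  ... | inj₂ refl = ∈-++⁺ˡ (∈-map⁺ (wing u) (∈-words w))
  ... | inj₁ u<k = ∈-++⁺ʳ (map (wing k) (words (pred k))) (∈-wings⁺ w u<k)

  ∈-wings⁻ : ∀ k {c} → c ∈ wings k → ∃ λ u → ∃ λ w → u < k × c ≡ wing u w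
  ∈-wings⁻ (suc k) c∈ with ∈-++⁻ (map (wing k) (words (pred k))) c∈
  ... | inj₁ q = let (w , _ , eq) = ∈-map⁻ (wing k) q in k , w , ℕP.≤-refl , eq
  ... | inj₂ q = let (u , w , u<k , eq) = ∈-wings⁻ k q in u , w , ℕP.m<n⇒m<1+n u<k , eq

  ∈-codes⁺ : ∀ c → Valid c → c ∈ codes
  ∈-codes⁺ (low w) _ = ∈-++⁺ˡ (∈-map⁺ low (∈-words w))
  ∈-codes⁺ (high true w) _ = ∈-++⁺ʳ (map low (words (suc p))) (∈-++⁺ˡ (∈-map⁺ (high true) (∈-words w)))
  ∈-codes⁺ (high false w) _ = ∈-++⁺ʳ (map low (words (suc p))) (∈-++⁺ʳ (map (high true) (words (suc p)))
    (∈-++⁺ˡ (∈-map⁺ (high false) (∈-words w))))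
  ∈-codes⁺ (wing u w) u≤ = ∈-++⁺ʳ (map low (words (suc p))) (∈-++⁺ʳ (map (high true) (words (suc p)))
    (∈-++⁺ʳ (map (high false) (words (suc p))) (∈-wings⁺ w (s≤s u≤))))

  ∈-codes⁻ : ∀ {c} → c ∈ codes → Valid c
  ∈-codes⁻ {low w} _ = tt
  ∈-codes⁻ {high s w} _ = tt
  ∈-codes⁻ {wing u w} c∈ with ∈-++⁻ (map low (words (suc p))) c∈
  ... | inj₁ q with ∈-map⁻ low q
  ...   | _ , _ , ()
  ∈-codes⁻ {wing u w} c∈ | inj₂ q with ∈-++⁻ (map (high true) (words (suc p))) q
  ... | inj₁ q with ∈-map⁻ (high true) q
  ...   | _ , _ , ()
  ∈-codes⁻ {wing u w} c∈ | inj₂ q | inj₂ q′ with ∈-++⁻ (map (high false) (words (suc p))) q′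
  ... | inj₁ q with ∈-map⁻ (high false) q
  ...   | _ , _ , ()
  ∈-codes⁻ {wing u w} c∈ | inj₂ q | inj₂ q′ | inj₂ q″ with ∈-wings⁻ (suc (suc p)) q″
  ... | _ , _ , lt , refl = s≤s⁻¹ lt

  low-injective : ∀ {w w′} → _≡_ {A = Code} (low w) (low w′) → w ≡ w′
  low-injective refl = refl

  high-injective : ∀ {s w w′} → _≡_ {A = Code} (high s w) (high s w′) → w ≡ w′
  high-injective refl = refl

  wing-injective : ∀ {u w w′} → _≡_ {A = Code} (wing u w) (wing u w′) → w ≡ w′
  wing-injective refl = refl

  wings-unique : ∀ k → Unique (wings k)
  wings-unique zero = []
  wings-unique (suc k) = Uniq.++⁺ (Uniq.map⁺ wing-injective (words-unique (pred k))) (wings-unique k) disjoint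
    where
    disjoint : ∀ {c} → c ∈ map (wing k) (words (pred k)) × c ∈ wings k → ⊥
    disjoint (p , q) with ∈-map⁻ (wing k) p | ∈-wings⁻ k q
    ... | _ , _ , refl | _ , _ , lt , refl = ℕP.<-irrefl refl lt

  codes-unique : Unique codes
  codes-unique = Uniq.++⁺ (Uniq.map⁺ low-injective (words-unique _))
    (Uniq.++⁺ (Uniq.map⁺ high-injective (words-unique _))
      (Uniq.++⁺ (Uniq.map⁺ high-injective (words-unique _)) (wings-unique (suc (suc p))) d₃) d₂) d₁
    where
    d₃ : ∀ {c} → c ∈ map (high false) (words (suc p)) × c ∈ wings (suc (suc p)) → ⊥
    d₃ (x , y) with ∈-map⁻ (high false) x | ∈-wings⁻ (suc (suc p)) y
    ... | _ , _ , refl | _ , _ , _ , ()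
    d₂ : ∀ {c} → c ∈ map (high true) (words (suc p)) × c ∈ map (high false) (words (suc p)) ++ wings (suc (suc p)) → ⊥
    d₂ (x , y) with ∈-map⁻ (high true) x | ∈-++⁻ (map (high false) (words (suc p))) y
    ... | _ , _ , refl | inj₁ z = absurd (∈-map⁻ (high false) z)
      where
      absurd : ∀ {w} → ¬ (∃ λ v → v ∈ words (suc p) × _≡_ {A = Code} (high true w) (high false v))
      absurd (_ , _ , ())
    ... | _ , _ , refl | inj₂ z = absurd (∈-wings⁻ (suc (suc p)) z)
      where
      absurd : ∀ {w} → ¬ (∃ λ u → ∃ λ v → u < suc (suc p) × _≡_ {A = Code} (high true w) (wing u v))
      absurd (_ , _ , _ , ())
    d₁ : ∀ {c} → c ∈ map low (words (suc p)) × c ∈ map (high true) (words (suc p)) ++ map (high false) (words (suc p)) ++ wings (suc (suc p)) → ⊥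
    d₁ (x , y) with ∈-map⁻ low x
    ... | w , _ , refl = case (∈-++⁻ (map (high true) (words (suc p))) y)
      where
      not-high : ∀ s → low w ∈ map (high s) (words (suc p)) → ⊥
      not-high s z with ∈-map⁻ (high s) z
      ... | _ , _ , ()
      not-wing : low w ∈ wings (suc (suc p)) → ⊥
      not-wing z with ∈-wings⁻ (suc (suc p)) z
      ... | _ , _ , _ , ()
      case′ : low w ∈ map (high false) (words (suc p)) ⊎ low w ∈ wings (suc (suc p)) → ⊥
      case′ (inj₁ z) = not-high false z
      case′ (inj₂ z) = not-wing z
      case : low w ∈ map (high true) (words (suc p)) ⊎ low w ∈ map (high false) (words (suc p)) ++ wings (suc (suc p)) → ⊥
      case (inj₁ z) = not-high true z
      case (inj₂ z) = case′ (∈-++⁻ (map (high false) (words (suc p))) z)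

  -- The ways to shorten row 0 of `wing (suc u) w`. At u = p the row ends in the fork and either of
  -- ε_0 ± ε_N may go; before that only its last difference can. The decision is an argument so that
  -- proofs can split on it.
  shrinks : ∀ {u} → Dec (u ≡ p) → Word u → List Code
  shrinks (yes refl) w = high true (false ∷ w) ∷ high false (false ∷ w) ∷ []
  shrinks {u} (no _) w = wing (suc (suc u)) (false ∷ w) ∷ []

  downs ups : Code → List Code
  downs (low w) = map low (downFlips w)
  downs (high s (true ∷ w)) = map (high s) (downFlips (true ∷ w))
  downs (high s (false ∷ w)) = low (true ∷ w) ∷ map (high s) (downFlips (false ∷ w))
  downs (wing zero w) = wing 1 w ∷ []
  downs (wing (suc u) w) = shrinks (u ℕ.≟ p) w ++ map (wing (suc u)) (downFlips w)
  -- The letter `true` says that ε_0 + ε_{N-1} is present; it covers both of ε_0 ± ε_N, so either of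
  -- them can be added.
  ups (low (true ∷ w)) = high true (false ∷ w) ∷ high false (false ∷ w) ∷ map low (upFlips (true ∷ w))
  ups (low (false ∷ w)) = map low (upFlips (false ∷ w))
  ups (high s (true ∷ w)) = map (high s) (upFlips (true ∷ w))
  ups (high s (false ∷ w)) = wing (suc p) w ∷ map (high s) (upFlips (false ∷ w))
  ups (wing zero w) = []
  ups (wing (suc zero) w) = wing 0 w ∷ []
  ups (wing (suc (suc u)) (true ∷ w)) = map (wing (suc (suc u))) (upFlips (true ∷ w))
  ups (wing (suc (suc u)) (false ∷ w)) = wing (suc u) w ∷ map (wing (suc (suc u))) (upFlips (false ∷ w))

  downs⁺ : ∀ {c d} → Valid c → Valid d → c ⋗ d → d ∈ downs c
  downs⁺ _ _ (low f) = ∈-map⁺ low (downFlips⁺ f)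
  downs⁺ _ _ (high s {true ∷ w} f) = ∈-map⁺ (high s) (downFlips⁺ f)
  downs⁺ _ _ (high s {false ∷ w} f) = there (∈-map⁺ (high s) (downFlips⁺ f))
  downs⁺ _ _ (drop s w) = here refl
  downs⁺ _ _ (merge s w) = ∈-++⁺ˡ (member s (p ℕ.≟ p))
    where
    member : ∀ s (d : Dec (p ≡ p)) → high s (false ∷ w) ∈ shrinks d w
    member true (yes refl) = here refl
    member false (yes refl) = there (here refl)
    member _ (no ne) = ⊥-elim (ne refl)
  downs⁺ _ _ (wing zero {[]} ())
  downs⁺ _ _ (wing (suc u) {w} f) = ∈-++⁺ʳ (shrinks (u ℕ.≟ p) w) (∈-map⁺ (wing (suc u)) (downFlips⁺ f))
  downs⁺ _ u≤ (shift {u} w) = ∈-++⁺ˡ (member (u ℕ.≟ p))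
    where
    member : (d : Dec (u ≡ p)) → wing (suc (suc u)) (false ∷ w) ∈ shrinks d w
    member (yes refl) = ⊥-elim (ℕP.<-irrefl refl u≤)
    member (no _) = here refl
  downs⁺ _ _ top = here refl

  downs⁻ : ∀ c {d} → Valid c → d ∈ downs c → Valid d × c ⋗ d
  downs⁻ (low w) _ d∈ with ∈-map⁻ low d∈
  ... | _ , v∈ , refl = tt , low (downFlips⁻ w v∈)
  downs⁻ (high s (true ∷ w)) _ d∈ with ∈-map⁻ (high s) d∈
  ... | _ , v∈ , refl = tt , high s (downFlips⁻ (true ∷ w) v∈)
  downs⁻ (high s (false ∷ w)) _ (here refl) = tt , drop s w
  downs⁻ (high s (false ∷ w)) _ (there d∈) with ∈-map⁻ (high s) d∈
  ... | _ , v∈ , refl = tt , high s (downFlips⁻ (false ∷ w) v∈)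
  downs⁻ (wing zero []) _ (here refl) = s≤s z≤n , top
  downs⁻ (wing (suc u) w) {d} u≤ d∈ = case (∈-++⁻ (shrinks (u ℕ.≟ p) w) d∈)
    where
    shrunk : (e : Dec (u ≡ p)) → d ∈ shrinks e w → Valid d × wing (suc u) w ⋗ d
    shrunk (yes refl) (here refl) = tt , merge true w
    shrunk (yes refl) (there (here refl)) = tt , merge false w
    shrunk (no ne) (here refl) = s≤s (ℕP.≤∧≢⇒< (s≤s⁻¹ u≤) ne) , shift w
    case : d ∈ shrinks (u ℕ.≟ p) w ⊎ d ∈ map (wing (suc u)) (downFlips w) → Valid d × wing (suc u) w ⋗ d
    case (inj₁ q) = shrunk (u ℕ.≟ p) q
    case (inj₂ q) with ∈-map⁻ (wing (suc u)) q
    ... | _ , v∈ , refl = u≤ , wing (suc u) (downFlips⁻ w v∈)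

  ups⁺ : ∀ {c d} → c ⋗ d → c ∈ ups d
  ups⁺ (low {w′ = true ∷ w} f) = there (there (∈-map⁺ low (upFlips⁺ f)))
  ups⁺ (low {w′ = false ∷ w} f) = ∈-map⁺ low (upFlips⁺ f)
  ups⁺ (high s {w′ = true ∷ w} f) = ∈-map⁺ (high s) (upFlips⁺ f)
  ups⁺ (high s {w′ = false ∷ w} f) = there (∈-map⁺ (high s) (upFlips⁺ f))
  ups⁺ (drop true w) = here refl
  ups⁺ (drop false w) = there (here refl)
  ups⁺ (merge s w) = here refl
  ups⁺ (wing zero {[]} ())
  ups⁺ (wing (suc zero) {[]} ())
  ups⁺ (wing (suc (suc u)) {w′ = true ∷ w} f) = ∈-map⁺ (wing (suc (suc u))) (upFlips⁺ f)
  ups⁺ (wing (suc (suc u)) {w′ = false ∷ w} f) = there (∈-map⁺ (wing (suc (suc u))) (upFlips⁺ f))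
  ups⁺ (shift w) = here refl
  ups⁺ top = here refl

  ups⁻ : ∀ d {c} → Valid d → c ∈ ups d → Valid c × c ⋗ d
  ups⁻ (low (true ∷ w)) _ (here refl) = tt , drop true w
  ups⁻ (low (true ∷ w)) _ (there (here refl)) = tt , drop false w
  ups⁻ (low (true ∷ w)) _ (there (there c∈)) with ∈-map⁻ low c∈
  ... | _ , v∈ , refl = tt , low (upFlips⁻ (true ∷ w) v∈)
  ups⁻ (low (false ∷ w)) _ c∈ with ∈-map⁻ low c∈
  ... | _ , v∈ , refl = tt , low (upFlips⁻ (false ∷ w) v∈)
  ups⁻ (high s (true ∷ w)) _ c∈ with ∈-map⁻ (high s) c∈
  ... | _ , v∈ , refl = tt , high s (upFlips⁻ (true ∷ w) v∈)
  ups⁻ (high s (false ∷ w)) _ (here refl) = ℕP.≤-refl , merge s w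
  ups⁻ (high s (false ∷ w)) _ (there c∈) with ∈-map⁻ (high s) c∈
  ... | _ , v∈ , refl = tt , high s (upFlips⁻ (false ∷ w) v∈)
  ups⁻ (wing (suc zero) []) _ (here refl) = z≤n , top
  ups⁻ (wing (suc (suc u)) (true ∷ w)) u≤ c∈ with ∈-map⁻ (wing (suc (suc u))) c∈
  ... | _ , v∈ , refl = u≤ , wing (suc (suc u)) (upFlips⁻ (true ∷ w) v∈)
  ups⁻ (wing (suc (suc u)) (false ∷ w)) u≤ (here refl) = ℕP.<⇒≤ u≤ , shift w
  ups⁻ (wing (suc (suc u)) (false ∷ w)) u≤ (there c∈) with ∈-map⁻ (wing (suc (suc u))) c∈
  ... | _ , v∈ , refl = u≤ , wing (suc (suc u)) (upFlips⁻ (false ∷ w) v∈)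

  ∉-map : ∀ {A : Set} {f : A → Code} {xs c} → (∀ x → c ≢ f x) → All (λ d → ¬ (c ≡ d)) (map f xs)
  ∉-map {f = f} ne = All.tabulate λ d∈ eq → let (x , _ , eq′) = ∈-map⁻ f d∈ in ne x (trans eq eq′)

  downs-unique : ∀ c → Unique (downs c)
  downs-unique (low w) = Uniq.map⁺ low-injective (downFlips-unique w)
  downs-unique (high s (true ∷ w)) = Uniq.map⁺ high-injective (downFlips-unique (true ∷ w))
  downs-unique (high s (false ∷ w)) = ∉-map (λ _ ()) ∷ Uniq.map⁺ high-injective (downFlips-unique (false ∷ w))
  downs-unique (wing zero w) = [] ∷ []
  downs-unique (wing (suc u) w) = Uniq.++⁺ (shrinks-unique (u ℕ.≟ p)) (Uniq.map⁺ wing-injective (downFlips-unique w)) (disjoint (u ℕ.≟ p))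
    where
    shrinks-unique : (e : Dec (u ≡ p)) → Unique (shrinks e w)
    shrinks-unique (yes refl) = ((λ ()) ∷ []) ∷ [] ∷ []
    shrinks-unique (no _) = [] ∷ []
    disjoint : (e : Dec (u ≡ p)) → ∀ {c} → c ∈ shrinks e w × c ∈ map (wing (suc u)) (downFlips w) → ⊥
    disjoint e (p , q) with ∈-map⁻ (wing (suc u)) q
    disjoint (yes refl) (here () , q) | _ , _ , refl
    disjoint (yes refl) (there (here ()) , q) | _ , _ , refl
    disjoint (no _) (here () , q) | _ , _ , refl

  ups-unique : ∀ c → Unique (ups c)
  ups-unique (low (true ∷ w)) = ((λ ()) ∷ ∉-map (λ _ ())) ∷ ∉-map (λ _ ()) ∷ Uniq.map⁺ low-injective (upFlips-unique (true ∷ w))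
  ups-unique (low (false ∷ w)) = Uniq.map⁺ low-injective (upFlips-unique (false ∷ w))
  ups-unique (high s (true ∷ w)) = Uniq.map⁺ high-injective (upFlips-unique (true ∷ w))
  ups-unique (high s (false ∷ w)) = ∉-map (λ _ ()) ∷ Uniq.map⁺ high-injective (upFlips-unique (false ∷ w))
  ups-unique (wing zero w) = []
  ups-unique (wing (suc zero) w) = [] ∷ []
  ups-unique (wing (suc (suc u)) (true ∷ w)) = Uniq.map⁺ wing-injective (upFlips-unique (true ∷ w))
  ups-unique (wing (suc (suc u)) (false ∷ w)) = ∉-map (λ _ ()) ∷ Uniq.map⁺ wing-injective (upFlips-unique (false ∷ w))

  decode-classify : ∀ {I} → I ∈ Ab → ∃ λ c → Valid c × decode c ≡ I
  decode-classify I∈ = let (c , vc , m) = classify I∈ in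
    c , vc , matches-unique (decode∈Ab c) I∈ (decode-matches c) m

  κ-decode : ∀ c → Valid c → κ (decode c) ≡ length (downs c)
  κ-decode c vc = length-bijection decode (Uniq.filter⁺ (Poset.covers? (decode c)) Ab-unique) (downs-unique c)
    (λ {d} {d′} d∈ d′∈ → decode-injective d d′ (proj₁ (downs⁻ c vc d∈)) (proj₁ (downs⁻ c vc d′∈)))
    (λ {d} d∈ → let (vd , c⋗d) = downs⁻ c vc d∈ in ∈-filter⁺ (Poset.covers? (decode c)) (decode∈Ab d)
      (⋗⇒covers c d (decode∈Ab c) (decode∈Ab d) vc vd (decode-matches c) (decode-matches d) c⋗d))
    λ J∈ → let (J∈Ab , cov) = ∈-filter⁻ (Poset.covers? (decode c)) {xs = Ab} J∈ in surjective (decode-classify J∈Ab) cov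
    where
    surjective : ∀ {J} → (∃ λ d → Valid d × decode d ≡ J) → Poset.Covers (decode c) J → ∃ λ d → d ∈ downs c × decode d ≡ J
    surjective (d , vd , refl) cov =
      d , downs⁺ vc vd (covers⇒⋗ c d (decode∈Ab c) (decode∈Ab d) vc vd (decode-matches c) (decode-matches d) cov) , refl

  ι-decode : ∀ d → Valid d → ι (decode d) ≡ length (ups d)
  ι-decode d vd = length-bijection decode (Uniq.filter⁺ (λ I → Poset.covers? I (decode d)) Ab-unique) (ups-unique d)
    (λ {c} {c′} c∈ c′∈ → decode-injective c c′ (proj₁ (ups⁻ d vd c∈)) (proj₁ (ups⁻ d vd c′∈)))
    (λ {c} c∈ → let (vc , c⋗d) = ups⁻ d vd c∈ in ∈-filter⁺ (λ I → Poset.covers? I (decode d)) (decode∈Ab c)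
      (⋗⇒covers c d (decode∈Ab c) (decode∈Ab d) vc vd (decode-matches c) (decode-matches d) c⋗d))
    λ I∈ → let (I∈Ab , cov) = ∈-filter⁻ (λ I → Poset.covers? I (decode d)) {xs = Ab} I∈ in surjective (decode-classify I∈Ab) cov
    where
    surjective : ∀ {I} → (∃ λ c → Valid c × decode c ≡ I) → Poset.Covers I (decode d) → ∃ λ c → c ∈ ups d × decode c ≡ I
    surjective (c , vc , refl) cov =
      c , ups⁺ (covers⇒⋗ c d (decode∈Ab c) (decode∈Ab d) vc vd (decode-matches c) (decode-matches d) cov) , refl

  length-filter-codes : ∀ {f : List (Vecℤ n) → ℕ} {g : Code → ℕ} → (∀ c → Valid c → f (decode c) ≡ g c) →
    ∀ k → + length (filter (λ I → f I ℕ.≟ k) Ab) ≡ count g codes (+ k)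
  length-filter-codes {f} {g} eq k = trans (cong +_ (length-bijection decode (Uniq.filter⁺ (λ I → f I ℕ.≟ k) Ab-unique)
      (Uniq.filter⁺ (λ c → g c ℕ.≟ k) codes-unique)
      (λ {c} {d} c∈ d∈ → decode-injective c d (∈-codes⁻ (proj₁ (split c∈))) (∈-codes⁻ (proj₁ (split d∈))))
      (λ {c} c∈ → ∈-filter⁺ (λ I → f I ℕ.≟ k) (decode∈Ab c) (trans (eq c (∈-codes⁻ (proj₁ (split c∈)))) (proj₂ (split c∈))))
      λ I∈ → let (I∈Ab , f≡) = ∈-filter⁻ (λ I → f I ℕ.≟ k) {xs = Ab} I∈ in surjective (decode-classify I∈Ab) f≡))
    (length-filter g codes k)
    where
    split : ∀ {c} → c ∈ filter (λ c → g c ℕ.≟ k) codes → c ∈ codes × g c ≡ k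
    split = ∈-filter⁻ (λ c → g c ℕ.≟ k) {xs = codes}
    surjective : ∀ {I} → (∃ λ c → Valid c × decode c ≡ I) → f I ≡ k → ∃ λ c → c ∈ filter (λ c → g c ℕ.≟ k) codes × decode c ≡ I
    surjective (c , vc , refl) f≡ = c , ∈-filter⁺ (λ c → g c ℕ.≟ k) (∈-codes⁺ c vc) (trans (sym (eq c vc)) f≡) , refl

  Ku-count : ∀ k → + Ku k ≡ count (λ c → length (downs c)) codes (+ k)
  Ku-count = length-filter-codes κ-decode

  Kl-count : ∀ k → + Kl k ≡ count (λ c → length (ups c)) codes (+ k)
  Kl-count = length-filter-codes ι-decode

-- Counting the ideals by their covers

module _ (p : ℕ) where
  open Enumeration p

  below above : Code → ℕ
  below c = length (downs c)
  above c = length (ups c)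

  count-codes : ∀ f k → count f codes k ≡
    count (λ w → f (low w)) (words (suc p)) k +ℤ (count (λ w → f (high true w)) (words (suc p)) k +ℤ
      (count (λ w → f (high false w)) (words (suc p)) k +ℤ count f (wings (suc (suc p))) k))
  count-codes f k =
    trans (count-++ f (map low (words (suc p))) _ k) (cong₂ _+ℤ_ (count-map f low (words (suc p)) k)
      (trans (count-++ f (map (high true) (words (suc p))) _ k) (cong₂ _+ℤ_ (count-map f (high true) (words (suc p)) k)
        (trans (count-++ f (map (high false) (words (suc p))) _ k)
          (cong (_+ℤ count f (wings (suc (suc p))) k) (count-map f (high false) (words (suc p)) k))))))

  below-low : ∀ w → below (low w) ≡ flips-below w
  below-low w = length-map low (downFlips w)

  -- The move `drop` takes the place of the flip at the first letter of `true ∷ w`, although it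
  -- leads into another family.
  below-high : ∀ s w → below (high s w) ≡ flips-below (true ∷ w)
  below-high s (true ∷ w) = trans (length-map (high s) (downFlips (true ∷ w))) (sym (below-true-true w))
  below-high s (false ∷ w) = trans (cong suc (length-map (high s) (downFlips (false ∷ w))))
    (trans (cong suc (below-false w)) (sym (below-true-false w)))

  below-wing : ∀ {u} → u < p → ∀ w → below (wing (suc u) w) ≡ suc (flips-below w)
  below-wing {u} u<p w = trans (length-++ (shrinks (u ℕ.≟ p) w)) (cong₂ _+_ (one (u ℕ.≟ p)) (length-map (wing (suc u)) (downFlips w)))
    where
    one : (e : Dec (u ≡ p)) → length (shrinks e w) ≡ 1
    one (yes refl) = ⊥-elim (ℕP.<-irrefl refl u<p)
    one (no _) = refl

  below-last-wing : ∀ w → below (wing (suc p) w) ≡ suc (suc (flips-below w))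
  below-last-wing w = trans (length-++ (shrinks (p ℕ.≟ p) w)) (cong₂ _+_ (two (p ℕ.≟ p)) (length-map (wing (suc p)) (downFlips w)))
    where
    two : (e : Dec (p ≡ p)) → length (shrinks e w) ≡ 2
    two (yes refl) = refl
    two (no ne) = ⊥-elim (ne refl)

  count-wings-suc : ∀ f u k → count f (wings (suc u)) k ≡ count (λ w → f (wing u w)) (words (pred u)) k +ℤ count f (wings u) k
  count-wings-suc f u k = trans (count-++ f (map (wing u) (words (pred u))) _ k)
    (cong (_+ℤ count f (wings u) k) (count-map f (wing u) (words (pred u)) k))

  -- A hockey-stick sum: each new wing family supplies the missing term of one Pascal step. The sum
  -- starts with `wing 0 []`, whose single move `top` contributes q. The last family, at p + 1, is
  -- left out because it has one more downward move.
  count-below-wings : ∀ u → u ≤ p → ∀ k → count below (wings (suc u)) k ≡ β k (suc u) 2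
  count-below-wings zero _ k = trans (count-wings-suc below 0 k)
    (trans (ℤP.+-identityʳ _) (trans (ℤP.+-identityʳ _) (sym (β-one-two k))))
  count-below-wings (suc u) u<p k = begin
    count below (wings (suc (suc u))) k
      ≡⟨ count-wings-suc below (suc u) k ⟩
    count (λ w → below (wing (suc u) w)) (words u) k +ℤ count below (wings (suc u)) k
      ≡⟨ cong₂ _+ℤ_ (trans (count-cong (below-wing u<p) (words u) k) (trans (count-suc flips-below (words u) k)
           (trans (count-below u (k - + 1)) (β-pred k (suc u) 1)))) (count-below-wings u (ℕP.<⇒≤ u<p) k) ⟩
    β k (suc u) 3 +ℤ β k (suc u) 2
      ≡⟨ β-pascal k (suc u) 2 ⟨
    β k (suc (suc u)) 2 ∎

  count-below-codes : ∀ k → count below codes k ≡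
    β k (2 + p) 1 +ℤ (β k (2 + p) 2 +ℤ (β k (2 + p) 2 +ℤ (β k (1 + p) 5 +ℤ β k (1 + p) 2)))
  count-below-codes k = trans (count-codes below k)
    (cong₂ _+ℤ_ (trans (count-cong below-low (words (suc p)) k) (count-below (suc p) k))
    (cong₂ _+ℤ_ (trans (count-cong (below-high true) (words (suc p)) k) (count-below-true (suc p) k))
    (cong₂ _+ℤ_ (trans (count-cong (below-high false) (words (suc p)) k) (count-below-true (suc p) k))
    (trans (count-wings-suc below (suc p) k) (cong₂ _+ℤ_ last-wing (count-below-wings p ℕP.≤-refl k))))))
    where
    -- The two removals in row 0 contribute a factor q², which moves the offset from 1 to 5.
    last-wing : count (λ w → below (wing (suc p) w)) (words p) k ≡ β k (1 + p) 5
    last-wing = begin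
      count (λ w → below (wing (suc p) w)) (words p) k
        ≡⟨ count-cong below-last-wing (words p) k ⟩
      count (λ w → suc (suc (flips-below w))) (words p) k
        ≡⟨ count-suc (λ w → suc (flips-below w)) (words p) k ⟩
      count (λ w → suc (flips-below w)) (words p) (k - + 1)
        ≡⟨ count-suc flips-below (words p) (k - + 1) ⟩
      count flips-below (words p) (k - + 1 - + 1)
        ≡⟨ count-below p (k - + 1 - + 1) ⟩
      β (k - + 1 - + 1) (1 + p) 1
        ≡⟨ β-pred (k - + 1) (1 + p) 1 ⟩
      β (k - + 1) (1 + p) 3
        ≡⟨ β-pred k (1 + p) 3 ⟩
      β k (1 + p) 5 ∎

  above-low-true : ∀ w → above (low (true ∷ w)) ≡ suc (suc (flips-above w))
  above-low-true w = cong (λ x → suc (suc x)) (trans (length-map low (upFlips (true ∷ w))) (above-true w))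

  above-low-false : ∀ w → above (low (false ∷ w)) ≡ flips-above (false ∷ w)
  above-low-false w = length-map low (upFlips (false ∷ w))

  above-high-true : ∀ s w → above (high s (true ∷ w)) ≡ flips-above w
  above-high-true s w = trans (length-map (high s) (upFlips (true ∷ w))) (above-true w)

  above-high-false : ∀ s w → above (high s (false ∷ w)) ≡ suc (flips-above (false ∷ w))
  above-high-false s w = cong suc (length-map (high s) (upFlips (false ∷ w)))

  above-wing-true : ∀ u w → above (wing (suc (suc u)) (true ∷ w)) ≡ flips-above w
  above-wing-true u w = trans (length-map (wing (suc (suc u))) (upFlips (true ∷ w))) (above-true w)

  above-wing-false : ∀ u w → above (wing (suc (suc u)) (false ∷ w)) ≡ suc (flips-above (false ∷ w))
  above-wing-false u w = cong suc (length-map (wing (suc (suc u))) (upFlips (false ∷ w)))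

  -- For high s, and for wing u with u ≥ 2, row 0 can be enlarged exactly when the word starts with false.
  count-above-growing : ∀ {m} (f : Word (suc m) → ℕ) → (∀ w → f (true ∷ w) ≡ flips-above w) →
    (∀ w → f (false ∷ w) ≡ suc (flips-above (false ∷ w))) → ∀ k → count f (words (suc m)) k ≡ β k (suc m) 1 +ℤ β k (suc m) 4
  count-above-growing {m} f f-true f-false k = trans (count-words {m} f k) (cong₂ _+ℤ_
    (trans (count-cong f-true (words m) k) (count-above m k))
    (trans (count-cong f-false (words m) k) (trans (count-suc (λ w → flips-above (false ∷ w)) (words m) k)
      (trans (count-above-false m (k - + 1)) (β-pred k (suc m) 2)))))

  count-above-low : ∀ k → count (λ w → above (low w)) (words (suc p)) k ≡ β k (suc p) 5 +ℤ β k (suc p) 2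
  count-above-low k = trans (count-words {p} (λ w → above (low w)) k) (cong₂ _+ℤ_
    (begin
      count (λ w → above (low (true ∷ w))) (words p) k
        ≡⟨ count-cong above-low-true (words p) k ⟩
      count (λ w → suc (suc (flips-above w))) (words p) k
        ≡⟨ count-suc (λ w → suc (flips-above w)) (words p) k ⟩
      count (λ w → suc (flips-above w)) (words p) (k - + 1)
        ≡⟨ count-suc flips-above (words p) (k - + 1) ⟩
      count flips-above (words p) (k - + 1 - + 1)
        ≡⟨ count-above p (k - + 1 - + 1) ⟩
      β (k - + 1 - + 1) (1 + p) 1
        ≡⟨ β-pred (k - + 1) (1 + p) 1 ⟩
      β (k - + 1) (1 + p) 3
        ≡⟨ β-pred k (1 + p) 3 ⟩
      β k (1 + p) 5 ∎)
    (trans (count-cong above-low-false (words p) k) (count-above-false p k)))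

  -- Two hockey-stick sums run in parallel, at the offsets 0 and 3. They start from `wing 0 []`,
  -- which contributes 1, and `wing 1 []`, which contributes q.
  count-above-wings : ∀ m k → count above (wings (suc (suc m))) k ≡ β k (suc m) 0 +ℤ β k (suc m) 3
  count-above-wings zero k = begin
    count above (wings 2) k
      ≡⟨ cong (λ x → δ 1 k +ℤ x) (ℤP.+-identityʳ (δ 0 k)) ⟩
    δ 1 k +ℤ δ 0 k
      ≡⟨ ℤP.+-comm (δ 1 k) (δ 0 k) ⟩
    δ 0 k +ℤ δ 1 k
      ≡⟨ cong₂ _+ℤ_ (β-one-zero k) (β-one-three k) ⟨
    β k 1 0 +ℤ β k 1 3 ∎
  count-above-wings (suc m) k = begin
    count above (wings (suc (suc (suc m)))) k
      ≡⟨ count-wings-suc above (suc (suc m)) k ⟩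
    count (λ w → above (wing (suc (suc m)) w)) (words (suc m)) k +ℤ count above (wings (suc (suc m))) k
      ≡⟨ cong₂ _+ℤ_ (count-above-growing (λ w → above (wing (suc (suc m)) w)) (above-wing-true m) (above-wing-false m) k)
           (count-above-wings m k) ⟩
    (β k (suc m) 1 +ℤ β k (suc m) 4) +ℤ (β k (suc m) 0 +ℤ β k (suc m) 3)
      ≡⟨ interchange (β k (suc m) 1) (β k (suc m) 4) (β k (suc m) 0) (β k (suc m) 3) ⟩
    (β k (suc m) 1 +ℤ β k (suc m) 0) +ℤ (β k (suc m) 4 +ℤ β k (suc m) 3)
      ≡⟨ cong₂ _+ℤ_ (β-pascal k (suc m) 0) (β-pascal k (suc m) 3) ⟨
    β k (suc (suc m)) 0 +ℤ β k (suc (suc m)) 3 ∎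
    where
    interchange : ∀ a b c d → (a +ℤ b) +ℤ (c +ℤ d) ≡ (a +ℤ c) +ℤ (b +ℤ d)
    interchange = solve-∀

  count-above-codes : ∀ k → count above codes k ≡
    (β k (1 + p) 5 +ℤ β k (1 + p) 2) +ℤ ((β k (1 + p) 1 +ℤ β k (1 + p) 4) +ℤ
      ((β k (1 + p) 1 +ℤ β k (1 + p) 4) +ℤ (β k (1 + p) 0 +ℤ β k (1 + p) 3)))
  count-above-codes k = trans (count-codes above k)
    (cong₂ _+ℤ_ (count-above-low k)
    (cong₂ _+ℤ_ (count-above-growing (λ w → above (high true w)) (above-high-true true) (above-high-false true) k)
    (cong₂ _+ℤ_ (count-above-growing (λ w → above (high false w)) (above-high-true false) (above-high-false false) k)
      (count-above-wings p k))))

-- Extending f by zero to −1 and −2 lets one formula cover the truncated convolutions at k = 0 and k = 1.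
second-difference : ∀ {f : ℕ → ℤ} {g : ℤ → ℤ} → (∀ j → f j ≡ g (+ j)) → g -[1+ 0 ] ≡ + 0 → g -[1+ 1 ] ≡ + 0 → ∀ k →
  (q-1² *ₚ f) k ≡ g (+ k) - + 2 *ℤ g (+ k - + 1) +ℤ g (+ k - + 2)
second-difference {f} {g} f≡g g₋₁ g₋₂ zero rewrite g₋₁ | g₋₂ | f≡g 0 = lem (g (+ 0))
  where
  lem : ∀ x → + 1 *ℤ x ≡ x - + 2 *ℤ + 0 +ℤ + 0
  lem = solve-∀
second-difference {f} {g} f≡g g₋₁ g₋₂ (suc zero) rewrite g₋₁ | f≡g 0 | f≡g 1 = lem (g (+ 1)) (g (+ 0))
  where
  lem : ∀ x y → + 1 *ℤ x +ℤ - (+ 2) *ℤ y ≡ x - + 2 *ℤ y +ℤ + 0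
  lem = solve-∀
second-difference {f} {g} f≡g g₋₁ g₋₂ (suc (suc k)) =
  trans (truncate (λ i → q-1² i *ℤ f (suc (suc k) ∸ i)) (λ i → ℤP.*-zeroˡ (f (suc (suc k) ∸ suc (suc (suc i))))) k)
    (trans (lem (f (suc (suc k))) (f (suc k)) (f k))
      (cong₂ _+ℤ_ (cong₂ (λ x y → x - + 2 *ℤ y) (f≡g (suc (suc k))) (f≡g (suc k))) (f≡g k)))
  where
  truncate : (f : ℕ → ℤ) → (∀ i → f (3 + i) ≡ + 0) → ∀ k → sumTo (2 + k) f ≡ f 0 +ℤ f 1 +ℤ f 2
  truncate f f₃ zero = refl
  truncate f f₃ (suc k) rewrite f₃ k = trans (ℤP.+-identityʳ _) (truncate f f₃ k)
  lem : ∀ x y z → + 1 *ℤ x +ℤ - (+ 2) *ℤ y +ℤ + 1 *ℤ z ≡ x - + 2 *ℤ y +ℤ z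
  lem = solve-∀

-- Reduction to one row of Pascal's triangle and the closed forms

raise : ℕ → (ℕ → ℤ) → ℕ → ℤ
raise zero b i = b i
raise (suc m) b i = raise m b (suc i) +ℤ raise m b i

-- The operator `raise m` is (1 + shift)^m acting on sequences. For a numeral m it unfolds by
-- computation, so every binomial of the theorem becomes an explicit sum of entries from row p = n -
-- 3.
β-raise : ∀ k m q i → β k (m + q) i ≡ raise m (β k q) i
β-raise k zero q i = refl
β-raise k (suc m) q i = trans (β-pascal k (m + q) i) (cong₂ _+ℤ_ (β-raise k m q (suc i)) (β-raise k m q i))

module ClosedForms (p k : ℕ) where
  open Enumeration p using (Ku; Kl; Ku-count; Kl-count)

  b : ℕ → ℤ
  b = β (+ k) p

  r : ∀ m i → β (+ k) (m + p) i ≡ raise m b i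
  r m i = β-raise (+ k) m p i

  2k : + (2 * k) ≡ + 2 *ℤ + k
  2k = ℤP.pos-* 2 k

  below-total : + Ku k ≡ raise 2 b 1 +ℤ (raise 2 b 2 +ℤ (raise 2 b 2 +ℤ (raise 1 b 5 +ℤ raise 1 b 2)))
  below-total = trans (Ku-count k) (trans (count-below-codes p (+ k))
    (cong₂ _+ℤ_ (r 2 1) (cong₂ _+ℤ_ (r 2 2) (cong₂ _+ℤ_ (r 2 2) (cong₂ _+ℤ_ (r 1 5) (r 1 2))))))

  above-total : + Kl k ≡ (raise 1 b 5 +ℤ raise 1 b 2) +ℤ ((raise 1 b 1 +ℤ raise 1 b 4) +ℤ
    ((raise 1 b 1 +ℤ raise 1 b 4) +ℤ (raise 1 b 0 +ℤ raise 1 b 3)))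
  above-total = trans (Kl-count k) (trans (count-above-codes p (+ k))
    (cong₂ _+ℤ_ (cong₂ _+ℤ_ (r 1 5) (r 1 2)) (cong₂ _+ℤ_ (cong₂ _+ℤ_ (r 1 1) (r 1 4))
      (cong₂ _+ℤ_ (cong₂ _+ℤ_ (r 1 1) (r 1 4)) (cong₂ _+ℤ_ (r 1 0) (r 1 3))))))

  binom-raise : ∀ m {x} i → x ≡ + 2 *ℤ + k +ℤ + 1 - + i → binom (m + p) x ≡ raise m b i
  binom-raise m i eq = trans (cong (binom (m + p)) eq) (r m i)

  at-2k+1 : + (2 * k) +ℤ + 1 ≡ + 2 *ℤ + k +ℤ + 1 - + 0
  at-2k+1 = trans (cong (_+ℤ + 1) 2k) (lem (+ k))
    where
    lem : ∀ x → + 2 *ℤ x +ℤ + 1 ≡ + 2 *ℤ x +ℤ + 1 - + 0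
    lem = solve-∀

  at-2k : + (2 * k) ≡ + 2 *ℤ + k +ℤ + 1 - + 1
  at-2k = trans 2k (lem (+ k))
    where
    lem : ∀ x → + 2 *ℤ x ≡ + 2 *ℤ x +ℤ + 1 - + 1
    lem = solve-∀

  at-2k−1 : + (2 * k) - + 1 ≡ + 2 *ℤ + k +ℤ + 1 - + 2
  at-2k−1 = trans (cong (_- + 1) 2k) (lem (+ k))
    where
    lem : ∀ x → + 2 *ℤ x - + 1 ≡ + 2 *ℤ x +ℤ + 1 - + 2
    lem = solve-∀

  at-2k−2 : + (2 * k) - + 2 ≡ + 2 *ℤ + k +ℤ + 1 - + 3
  at-2k−2 = trans (cong (_- + 2) 2k) (lem (+ k))
    where
    lem : ∀ x → + 2 *ℤ x - + 2 ≡ + 2 *ℤ x +ℤ + 1 - + 3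
    lem = solve-∀

  at-2k−4 : + (2 * k) - + 4 ≡ + 2 *ℤ + k +ℤ + 1 - + 5
  at-2k−4 = trans (cong (_- + 4) 2k) (lem (+ k))
    where
    lem : ∀ x → + 2 *ℤ x - + 4 ≡ + 2 *ℤ x +ℤ + 1 - + 5
    lem = solve-∀

  private
    -- In these four identities b_i stands for binom(p, 2k + 1 - i), and each bracketed binary tree
    -- is an unfolded `raise`. They hold for arbitrary integers b_i.
    identity₁ : ∀ b1 b2 b3 b4 b5 b6 →
      (((b3 +ℤ b2) +ℤ (b2 +ℤ b1)) +ℤ (((b4 +ℤ b3) +ℤ (b3 +ℤ b2)) +ℤ (((b4 +ℤ b3) +ℤ (b3 +ℤ b2)) +ℤ ((b6 +ℤ b5) +ℤ
        (b3 +ℤ b2)))))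
        ≡ (((((b6 +ℤ b5) +ℤ (b5 +ℤ b4)) +ℤ ((b5 +ℤ b4) +ℤ (b4 +ℤ b3))) +ℤ (((b5 +ℤ b4) +ℤ (b4 +ℤ b3)) +ℤ ((b4 +ℤ b3) +ℤ
          (b3 +ℤ b2)))) +ℤ ((((b5 +ℤ b4) +ℤ (b4 +ℤ b3)) +ℤ ((b4 +ℤ b3) +ℤ (b3 +ℤ b2))) +ℤ (((b4 +ℤ b3) +ℤ (b3 +ℤ b2)) +ℤ
          ((b3 +ℤ b2) +ℤ (b2 +ℤ b1))))) - + 4 *ℤ ((b5 +ℤ b4) +ℤ (b4 +ℤ b3))
    identity₁ = solve-∀
    identity₂ : ∀ b1 b2 b3 b4 b5 b6 →
      (((b3 +ℤ b2) +ℤ (b2 +ℤ b1)) +ℤ (((b4 +ℤ b3) +ℤ (b3 +ℤ b2)) +ℤ (((b4 +ℤ b3) +ℤ (b3 +ℤ b2)) +ℤ ((b6 +ℤ b5) +ℤ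
        (b3 +ℤ b2)))))
        ≡ (((b4 +ℤ b3) +ℤ (b3 +ℤ b2)) +ℤ ((b3 +ℤ b2) +ℤ (b2 +ℤ b1))) +ℤ ((b4 +ℤ b3) +ℤ (b3 +ℤ b2)) +ℤ (b3 +ℤ b2) +ℤ (b6
          +ℤ b5)
    identity₂ = solve-∀
    identity₃ : ∀ b0 b1 b2 b3 b4 b5 b6 →
      (((b6 +ℤ b5) +ℤ (b3 +ℤ b2)) +ℤ (((b2 +ℤ b1) +ℤ (b5 +ℤ b4)) +ℤ (((b2 +ℤ b1) +ℤ (b5 +ℤ b4)) +ℤ ((b1 +ℤ b0) +ℤ
        (b4 +ℤ b3)))))
        ≡ (((b3 +ℤ b2) +ℤ (b2 +ℤ b1)) +ℤ ((b2 +ℤ b1) +ℤ (b1 +ℤ b0))) +ℤ (((b6 +ℤ b5) +ℤ (b5 +ℤ b4)) +ℤ ((b5 +ℤ b4) +ℤ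
          (b4 +ℤ b3)))
    identity₃ = solve-∀
    identity₄ : ∀ b0 b1 b2 b3 b4 b5 b6 →
      (((b3 +ℤ b2) +ℤ (b2 +ℤ b1)) +ℤ (((b4 +ℤ b3) +ℤ (b3 +ℤ b2)) +ℤ (((b4 +ℤ b3) +ℤ (b3 +ℤ b2)) +ℤ ((b6 +ℤ b5) +ℤ
        (b3 +ℤ b2))))) - (((b6 +ℤ b5) +ℤ (b3 +ℤ b2)) +ℤ (((b2 +ℤ b1) +ℤ (b5 +ℤ b4)) +ℤ (((b2 +ℤ b1) +ℤ (b5 +ℤ b4)) +ℤ
        ((b1 +ℤ b0) +ℤ (b4 +ℤ b3)))))
        ≡ - ((b1 +ℤ b0) +ℤ b1) - + 2 *ℤ (- ((b3 +ℤ b2) +ℤ b3)) +ℤ - ((b5 +ℤ b4) +ℤ b5)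
    identity₄ = solve-∀

  Ku-first : + Ku k ≡ binom (3 + p + 2) (+ (2 * k)) - + 4 *ℤ binom (2 + p) (+ (2 * k) - + 2)
  Ku-first = trans below-total (trans (identity₁ (b 1) (b 2) (b 3) (b 4) (b 5) (b 6))
    -- The upper index n + 2 computes only to 3 + (p + 2); commuting the inner sum exhibits it as 5
    -- + p.
    (cong₂ _-_ (sym (trans (cong (λ n → binom (3 + n) (+ (2 * k))) (ℕP.+-comm p 2)) (binom-raise 5 1 at-2k)))
      (cong (+ 4 *ℤ_) (sym (binom-raise 2 3 at-2k−2)))))

  Ku-second : + Ku k ≡ binom (3 + p) (+ (2 * k)) +ℤ binom (2 + p) (+ (2 * k) - + 1)
    +ℤ binom (1 + p) (+ (2 * k) - + 1) +ℤ binom (1 + p) (+ (2 * k) - + 4)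
  Ku-second = trans below-total (trans (identity₂ (b 1) (b 2) (b 3) (b 4) (b 5) (b 6))
    (sym (cong₂ _+ℤ_ (cong₂ _+ℤ_ (cong₂ _+ℤ_ (binom-raise 3 1 at-2k) (binom-raise 2 2 at-2k−1)) (binom-raise 1 2 at-2k−1))
      (binom-raise 1 5 at-2k−4))))

  Kl-closed : + Kl k ≡ binom (3 + p) (+ (2 * k) +ℤ + 1) +ℤ binom (3 + p) (+ (2 * k) - + 2)
  Kl-closed = trans above-total (trans (identity₃ (b 0) (b 1) (b 2) (b 3) (b 4) (b 5) (b 6))
    (sym (cong₂ _+ℤ_ (binom-raise 3 0 at-2k+1) (binom-raise 3 3 at-2k−2))))

  -- The coefficient of q^z in D, taken at integers z so that multiplication by (q - 1)² is a second
  -- difference.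
  quotient : ℤ → ℤ
  quotient z = - (β z (1 + p) 0 +ℤ β z p 1)

  Ku−Kl : + Ku k - + Kl k ≡ quotient (+ k) - + 2 *ℤ quotient (+ k - + 1) +ℤ quotient (+ k - + 2)
  Ku−Kl = trans (cong₂ _-_ below-total above-total) (trans (identity₄ (b 0) (b 1) (b 2) (b 3) (b 4) (b 5) (b 6))
    (sym (cong₂ _+ℤ_ (cong₂ (λ x y → x - + 2 *ℤ y) (cong (λ x → - (x +ℤ b 1)) (r 1 0))
      (cong -_ (cong₂ _+ℤ_ (trans (β-pred (+ k) (1 + p) 0) (r 1 2)) (β-pred (+ k) p 1))))
      (trans (cong quotient (sym (two-steps (+ k))))
        (cong -_ (cong₂ _+ℤ_ (trans (β-pred (+ k - + 1) (1 + p) 0) (trans (β-pred (+ k) (1 + p) 2) (r 1 4)))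
          (trans (β-pred (+ k - + 1) p 1) (β-pred (+ k) p 3))))))))
    where
    two-steps : ∀ x → x - + 1 - + 1 ≡ x - + 2
    two-steps = solve-∀

theorem5p4 : (n : ℕ) → 4 ≤ n →
    let open TypeD n in
    ((k : ℕ) →
    (+ Ku k ≡ binom (n + 2) (+ (2 * k)) - + 4 *ℤ binom (n ∸ 1) (+ (2 * k) - + 2))
    × (+ Ku k ≡ binom n (+ (2 * k)) +ℤ binom (n ∸ 1) (+ (2 * k) - + 1)
    +ℤ binom (n ∸ 2) (+ (2 * k) - + 1) +ℤ binom (n ∸ 2) (+ (2 * k) - + 4)))
    × ((k : ℕ) → + Kl k ≡ binom n (+ (2 * k) +ℤ + 1) +ℤ binom n (+ (2 * k) - + 2))
    × ((k : ℕ) → + Ku k - + Kl k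
    ≡ (q-1² *ₚ (λ j → - (binom (n ∸ 2) (+ (2 * j) +ℤ + 1) +ℤ binom (n ∸ 3) (+ (2 * j))))) k)
theorem5p4 (suc (suc (suc p))) _ =
  (λ k → Ku-first p k , Ku-second p k) , (λ k → Kl-closed p k) ,
  λ k → trans (Ku−Kl p k) (sym (second-difference {g = quotient p k}
    -- Both `refl` hold because at z = -1 and z = -2 all lower indices are negative.
    (λ j → cong₂ (λ x y → - (binom (1 + p) x +ℤ binom p y)) (at-2k+1 p j) (at-2k p j)) refl refl k))
  where open ClosedForms
theorem5p4 (suc (suc zero)) (s≤s (s≤s ()))
theorem5p4 (suc zero) (s≤s ())
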